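{- Let $\rho$ be a non-degenerate probability distribution on $U\times V$. Let $1\le p\le q\le\infty$, and let $q'$ and $c$ be defined by $1/q+1/q'=1$ and $1/c=1/p+1/q'$. If $\rho$ is $q$-to-$p$ hypercontractive, then for every $z\in[0,1]$, $$\mathrm{agr}_\rho(z)\ \ge\ \frac{\bigl(p^{1/p}\,(q')^{1/q'}\,z\bigr)^c}{c},$$ and in particular $\mathrm{col}_\rho(n)=\Omega(n^{1-c})$ as $n\to\infty$, where the implied constant does not depend on $n$. (Convention: $1/\infty=0$ and $\infty^{1/\infty}=1$.)
   Context: $U,V$ are finite sets. $\rho$ is degenerate if its marginal $\rho_U$ on $U$ or its marginal $\rho_V$ on $V$ is a point mass, and non-degenerate otherwise. Hypercontractivity. For a probability distribution $\mu$ on $X$ and $f\colon X\to\mathbb{C}$, $\|f\|_{L_p(\mu)}=(\mathbf{E}_{x\sim\mu}|f(x)|^p)^{1/p}$ for $1\le p<\infty$ and $\|f\|_{L_\infty(\mu)}=\max_{x:\mu(x)>0}|f(x)|$. For $f\colon U\to\mathbb{C}$ define $(T_\rho f)(v)=\sum_{u\in U}\frac{\rho(u,v)}{\rho_V(v)}f(u)$ (for $v$ in the support of $\rho_V$). $\rho$ is $q$-to-$p$ hypercontractive if $\|T_\rho f\|_{L_q(\rho_V)}\le\|f\|_{L_p(\rho_U)}$ for all $f\colon U\to\mathbb{C}$. Agreement complexity. An agreement protocol for $\rho$ consists of $\ell\in\mathbb{N}$ and functions $f\colon U^\ell\to[0,1]$, $g\colon V^\ell\to[0,1]$. Its cost is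 $\mathbf{E}[f(\vec u)+g(\vec v)]$ and its success probability is $\mathbf{E}[f(\vec u)g(\vec v)]$, where $(\vec u,\vec v)\sim\rho^{\otimes\ell}$. $\mathrm{agr}_\rho(z)$ is the infimum of the cost over all agreement protocols for $\rho$ with success probability at least $z$. Collision complexity. A $p$-collision protocol for $\rho$ with domain size $n$ consists of $\ell\in\mathbb{N}$ and maps $A\colon U^\ell\to\mathcal P([n])$, $B\colon V^\ell\to\mathcal P([n])$ (possibly randomised using private independent randomness) such that $\Pr_{(\vec u,\vec v)\sim\rho^{\otimes\ell}}[i\in A(\vec u)\cap B(\vec v)]\ge p$ for every $i\in[n]$. Its output size is the maximum possible value of $\max\{|A(\vec u)|,|B(\vec v)|\}$. $\mathrm{col}_\rho(n,p)$ is the infimum of the output size over all $p$-collision protocols for $\rho$ with domain size $n$, and $\mathrm{col}_\rho(n)=\mathrm{col}_\rho(n,1/n)$. -}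

module Defs where

open import Level using (0ℓ)
open import Algebra.Bundles using (CommutativeRing)
open import Data.Bool.Base using (if_then_else_)
open import Data.Fin.Base using (Fin)
open import Data.Fin.Subset using (Subset; ∣_∣; _∩_)
open import Data.Fin.Subset.Properties using (_∈?_)
open import Data.Nat.Base as ℕ using (ℕ; zero; suc)
open import Data.Product.Base using (∃; ∃-syntax; _×_)
open import Data.Sum.Base using (_⊎_)
open import Data.Unit.Base using (⊤)
open import Data.Empty using (⊥)
open import Data.Vec.Base using (Vec; []; _∷_)
open import Relation.Binary.Core using (Rel)
open import Relation.Binary.Structures using (IsDecTotalOrder)
open import Relation.Nullary using (¬_; does)
import Algebra.Properties.Semiring.Exp as Exp
import Algebra.Properties.Semiring.Mult as Mult
import Algebra.Properties.Semiring.Sum as Sum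
import Relation.Binary.Construct.NonStrictToStrict as Strict

-- The library has no real numbers.  "The reals" are any Dedekind-complete
-- ordered field, which determines them up to isomorphism.  As usual in classical
-- analysis, the order is decidable, and `_⁻¹` and `sup` are total with
-- unspecified values at 0 and at sets that are empty or unbounded above.
record Reals : Set₁ where
  infix  4 _≤_
  infix  9 _⁻¹
  field
    commutativeRing : CommutativeRing 0ℓ 0ℓ

  open CommutativeRing commutativeRing public renaming (Carrier to ℝ)

  field
    _≤_             : Rel ℝ 0ℓ
    isDecTotalOrder : IsDecTotalOrder _≈_ _≤_
    +-monoˡ-≤       : ∀ z {x y} → x ≤ y → x + z ≤ y + z
    *-nonNeg        : ∀ {x y} → 0# ≤ x → 0# ≤ y → 0# ≤ x * y
    0≉1             : ¬ (0# ≈ 1#)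
    _⁻¹             : ℝ → ℝ
    ⁻¹-cong         : ∀ {x y} → x ≈ y → x ⁻¹ ≈ y ⁻¹
    ⁻¹-inverseʳ     : ∀ x → ¬ (x ≈ 0#) → x * x ⁻¹ ≈ 1#

  UpperBound : (ℝ → Set) → ℝ → Set
  UpperBound S b = ∀ x → S x → x ≤ b

  field
    sup       : (ℝ → Set) → ℝ
    sup-upper : ∀ S → ∃ S → ∃ (UpperBound S) → UpperBound S (sup S)
    sup-least : ∀ S → ∃ S → ∃ (UpperBound S) → ∀ b → UpperBound S b → sup S ≤ b

module Analysis (R : Reals) where
  open Reals R public
  open Strict _≈_ _≤_ public using (_<_)
  open Exp semiring public using (_^_)
  open Mult semiring public using () renaming (_×_ to _·_)
  open Sum semiring public using (sum)

  infixl 7 _÷_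

  _÷_ : ℝ → ℝ → ℝ
  x ÷ y = x * y ⁻¹

  fromℕ : ℕ → ℝ
  fromℕ n = n · 1#

  inf : (ℝ → Set) → ℝ
  inf S = - sup (λ x → S (- x))

  -- Real powers x ^ a, meaningful for x ≥ 0 and a ≥ 0 (with x ^ 0 = 1).
  -- x ^ a is the supremum of the rational powers x ^ (m / k) over m / k ≤ a when
  -- x ≥ 1 and over m / k ≥ a when x ≤ 1; `y ^ k ≤ x ^ m` says y ≤ x ^ (m / k).
  pow : ℝ → ℝ → ℝ
  pow x a = sup λ y → 0# ≤ y × ∃[ m ] ∃[ k ]
    (1 ℕ.≤ k) × (y ^ k ≤ x ^ m) ×
    ((1# ≤ x × fromℕ m ≤ fromℕ k * a) ⊎ (x ≤ 1# × fromℕ k * a ≤ fromℕ m))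

  record ℂ : Set where
    constructor _+i_
    field
      re im : ℝ

  _•_ : ℝ → ℂ → ℂ
  r • (a +i b) = (r * a) +i (r * b)

  ∣_∣ℂ : ℂ → ℝ
  ∣ a +i b ∣ℂ = pow (a * a + b * b) ((1# + 1#) ⁻¹)

  sumℂ : ∀ {n} → (Fin n → ℂ) → ℂ
  sumℂ z = sum (λ i → ℂ.re (z i)) +i sum (λ i → ℂ.im (z i))

  data [1,∞] : Set where
    fin : (x : ℝ) → 1# ≤ x → [1,∞]
    ∞   : [1,∞]

  _≼_ : [1,∞] → [1,∞] → Set
  fin x _ ≼ fin y _ = x ≤ y
  _       ≼ ∞       = ⊤
  ∞       ≼ fin _ _ = ⊥

  recip : [1,∞] → ℝ
  recip (fin x _) = x ⁻¹
  recip ∞         = 0#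

  -- p ↦ p ^ (1 / p)
  selfRoot : [1,∞] → ℝ
  selfRoot (fin x _) = pow x (x ⁻¹)
  selfRoot ∞         = 1#

  -- Finite sets are represented by Fin.
  record Distribution (n : ℕ) : Set where
    field
      mass   : Fin n → ℝ
      nonNeg : ∀ i → 0# ≤ mass i
      total  : sum mass ≈ 1#

  record JointDistribution (m k : ℕ) : Set where
    field
      mass   : Fin m → Fin k → ℝ
      nonNeg : ∀ u v → 0# ≤ mass u v
      total  : sum (λ u → sum (λ v → mass u v)) ≈ 1#

    marginalU : Fin m → ℝ
    marginalU u = sum λ v → mass u v

    marginalV : Fin k → ℝ
    marginalV v = sum λ u → mass u v

  IsPointMass : ∀ {n} → (Fin n → ℝ) → Set
  IsPointMass μ = ∃[ x ] μ x ≈ 1#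

  -- ‖ f ‖ in L_p(μ); the supremum is over a finite set, hence a maximum.
  norm : ∀ {n} → (Fin n → ℝ) → [1,∞] → (Fin n → ℂ) → ℝ
  norm μ (fin p _) f = pow (sum λ x → μ x * pow ∣ f x ∣ℂ p) (p ⁻¹)
  norm μ ∞         f = sup λ r → ∃[ x ] (0# < μ x) × (r ≈ ∣ f x ∣ℂ)

  sumVec : ∀ {n} ℓ → (Vec (Fin n) ℓ → ℝ) → ℝ
  sumVec zero    F = F []
  sumVec (suc ℓ) F = sum λ i → sumVec ℓ λ is → F (i ∷ is)

  indicator : ∀ {n} → Fin n → Subset n → ℝ
  indicator i S = if does (i ∈? S) then 1# else 0#

  module _ {m k : ℕ} (ρ : JointDistribution m k) where
    open JointDistribution ρ

    Degenerate : Set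
    Degenerate = IsPointMass marginalU ⊎ IsPointMass marginalV

    NonDegenerate : Set
    NonDegenerate = ¬ Degenerate

    -- Off the support of the marginal the value is irrelevant: `norm marginalV`
    -- ignores it.
    T : (Fin m → ℂ) → (Fin k → ℂ)
    T f v = sumℂ λ u → (mass u v ÷ marginalV v) • f u

    -- "q-to-p hypercontractive"
    Hypercontractive : (q p : [1,∞]) → Set
    Hypercontractive q p =
      ∀ (f : Fin m → ℂ) → norm marginalV q (T f) ≤ norm marginalU p f

    power : ∀ {ℓ} → Vec (Fin m) ℓ → Vec (Fin k) ℓ → ℝ
    power []       []       = 1#
    power (u ∷ us) (v ∷ vs) = mass u v * power us vs

    𝔼 : ∀ ℓ → (Vec (Fin m) ℓ → Vec (Fin k) ℓ → ℝ) → ℝ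
    𝔼 ℓ F = sumVec ℓ λ us → sumVec ℓ λ vs → power us vs * F us vs

    record AgreementProtocol : Set where
      field
        ℓ       : ℕ
        f       : Vec (Fin m) ℓ → ℝ
        g       : Vec (Fin k) ℓ → ℝ
        f-range : ∀ us → 0# ≤ f us × f us ≤ 1#
        g-range : ∀ vs → 0# ≤ g vs × g vs ≤ 1#

      cost : ℝ
      cost = 𝔼 ℓ λ us vs → f us + g vs

      success : ℝ
      success = 𝔼 ℓ λ us vs → f us * g vs

    agr : ℝ → ℝ
    agr z = inf λ r → ∃[ P ]
      (z ≤ AgreementProtocol.success P) × (r ≈ AgreementProtocol.cost P)

    -- The private randomness of each party is a seed drawn from a finite
    -- probability space.  As there are finitely many maps from inputs to
    -- subsets, any private randomness yields the same laws as such a seed.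
    record CollisionProtocol (n : ℕ) (p : ℝ) : Set where
      field
        ℓ     : ℕ
        {a b} : ℕ
        α     : Distribution a
        β     : Distribution b
        A     : Fin a → Vec (Fin m) ℓ → Subset n
        B     : Fin b → Vec (Fin k) ℓ → Subset n

      collisionProb : Fin n → ℝ
      collisionProb i =
        sum λ s → sum λ t → Distribution.mass α s * Distribution.mass β t *
          𝔼 ℓ λ us vs → indicator i (A s us ∩ B t vs)

      field
        collides : ∀ i → p ≤ collisionProb i

      outputSize : ℝ
      outputSize = sup λ r → ∃[ s ] ∃[ t ] ∃[ us ] ∃[ vs ]
        r ≈ fromℕ (∣ A s us ∣ ℕ.⊔ ∣ B t vs ∣)

    colAt : ℕ → ℝ → ℝ
    colAt n p = inf λ r → ∃[ P ] r ≈ CollisionProtocol.outputSize {n} {p} P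

    col : ℕ → ℝ
    col n = colAt n (fromℕ n ⁻¹)

  -- F(n) = Ω(G(n)) as n → ∞
  IsΩ : (F G : ℕ → ℝ) → Set
  IsΩ F G = ∃[ K ] (0# < K) × ∃[ N ] (∀ n → N ℕ.≤ n → K * G n ≤ F n)

{-# OPTIONS --safe #-}

-- Put α = 1/p and β = 1/q'.  Substituting φ = f ^ p and ψ = g ^ q', Hölder's inequality
-- turns q-to-p hypercontractivity into 𝔼[φ ^ α ψ ^ β] ≤ (𝔼 φ) ^ α (𝔼 ψ) ^ β, which
-- tensorises by conditioning on the first coordinate.  As f ≤ f ^ α on [0,1], an agreement
-- protocol with 𝔼 f = a and 𝔼 g = b succeeds with probability at most a ^ α b ^ β, and
-- weighted AM-GM minimises a + b under this constraint.  For collisions, the events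
-- i ∈ A and i ∈ B define an agreement protocol for each i, and the costs of these n
-- protocols add up to the expected sizes of A and B.
--
-- Only ¬ ¬ ∃ n (x ≤ n) is available constructively, but this is enough to prove the
-- inequalities and equations below, which are stable because _≤_ is decidable.

module Submission where

import Algebra.Properties.CommutativeSemiring.Exp as ExpProperties
import Algebra.Properties.Ring as RingProperties
import Algebra.Properties.Semiring.Mult as MultProperties
import Algebra.Properties.Semiring.Mult.TCOptimised as MultTC
import Algebra.Properties.Semiring.Sum as SumProperties
import Algebra.Solver.Ring as RingSolver
open import Algebra.Solver.Ring.AlmostCommutativeRing
  using (AlmostCommutativeRing; fromCommutativeRing; _-Raw-AlmostCommutative⟶_)
open import Data.Fin.Base using (Fin; zero; suc)
open import Data.Fin.Subset using (Subset; inside; outside; ⊤; ∣_∣; _∩_)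
open import Data.Fin.Subset.Properties using (_∈?_; ∈⊤; ∣p∣≤n)
open import Data.Integer.Base as ℤ using (ℤ; -[1+_])
import Data.Integer.Properties as ℤ
import Data.Maybe.Base as Maybe
open import Data.Maybe.Base using (Maybe)
open import Data.Nat.Base as ℕ using (ℕ; zero; suc)
import Data.Nat.Properties as ℕ
open import Data.Product.Base using (∃; ∃-syntax; _×_; _,_; proj₁; proj₂)
import Data.Sign.Base as Sign
open import Data.Sum.Base using (_⊎_; inj₁; inj₂)
open import Data.Vec.Base using (Vec; []; _∷_; replicate)
open import Defs
open import Function.Base using (_∘_)
open import Level using (0ℓ)
open import Relation.Binary.Bundles using (DecTotalOrder)
open import Relation.Binary.Consequences using (dec⇒weaklyDec)
import Relation.Binary.PropositionalEquality.Core as ≡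
import Relation.Binary.Reasoning.PartialOrder as PartialOrderReasoning
open import Relation.Nullary using (¬_; yes; no; contradiction)
open import Relation.Nullary.Decidable using (decidable-stable)

-- Conjugacy enters twice. The identity 1/q + 1/q′ = 1 lets Hölder's inequality test T f against ψ ^
-- β, and together with p ≤ q it gives α + β ≥ 1/q + 1/q′ = 1, hence c ≤ 1.
--
-- The constant is that of a constrained minimum. For finite p and q′ put a = α a′ and b = β b′.
-- Then z ≤ a ^ α b ^ β becomes p ^ (1/p) q′ ^ (1/q′) z ≤ a′ ^ α b′ ^ β. The weights α c and β c add
-- up to 1, so AM-GM bounds the c-th power of the right side by α c a′ + β c b′ = c (a + b).
--
-- Most of the length is due to real powers: `pow` is a supremum of rational powers, and the set of
-- admissible exponents changes sides at x = 1. The laws are first proved for bases at least 1,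
-- where x ^ a is pinned down by inequalities between natural powers, and are then carried to
-- smaller bases through reciprocals. Base 0 is treated apart, with 0 ^ 0 = 1, because p = ∞ and q′
-- = ∞ produce the exponent 0.

-- Ordered-field arithmetic, natural powers and the Archimedean property

module OrderedField (R : Reals) where
  open Analysis R hiding (zero)
  open MultTC semiring using () renaming (_×_ to _×′_)
  private
    module Mult′ = MultTC semiring
  open RingProperties ring using (-‿distribˡ-*; -‿distribʳ-*; -‿involutive; -0#≈0#)

  -- A solver with integer coefficients decides identities with subtraction,
  -- although equality of constants of the field is opaque.
  module IntegerCoefficients where
    -- With the optimised multiple `_×′_`, 1 is sent to `1#` itself and not to `1# + 0#`, so `:1`
    -- reads back as the unit in goals.
    embed : ℤ → ℝ
    embed (ℤ.+ n)  = n ×′ 1#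
    embed -[1+ n ] = - (suc n ×′ 1#)

    private
      almostCommutativeRing : AlmostCommutativeRing 0ℓ 0ℓ
      almostCommutativeRing = fromCommutativeRing commutativeRing
      open AlmostCommutativeRing almostCommutativeRing using (-‿+-comm)

      cancel : ∀ x y z → (z + x) + - (z + y) ≈ x + - y
      cancel x y z = begin
        (z + x) + - (z + y)      ≈⟨ +-cong (+-comm z x) (sym (-‿+-comm z y)) ⟩
        (x + z) + (- z + - y)    ≈⟨ +-assoc x z _ ⟩
        x + (z + (- z + - y))    ≈⟨ +-congˡ (+-assoc z (- z) (- y)) ⟨
        x + ((z + - z) + - y)    ≈⟨ +-congˡ (+-congʳ (-‿inverseʳ z)) ⟩
        x + (0# + - y)           ≈⟨ +-congˡ (+-identityˡ _) ⟩
        x + - y                  ∎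
        where open import Relation.Binary.Reasoning.Setoid setoid

      ⊖-homo : ∀ m n → embed (m ℤ.⊖ n) ≈ m ×′ 1# + - (n ×′ 1#)
      ⊖-homo m       zero    = sym (trans (+-congˡ -0#≈0#) (+-identityʳ _))
      ⊖-homo zero    (suc n) = sym (+-identityˡ _)
      ⊖-homo (suc m) (suc n) = trans (reflexive (≡.cong embed (ℤ.[1+m]⊖[1+n]≡m⊖n m n)))
        (trans (⊖-homo m n) (sym (trans
          (+-cong (Mult′.1+× m 1#) (-‿cong (Mult′.1+× n 1#)))
          (cancel _ _ 1#))))

      +-homo : ∀ i j → embed (i ℤ.+ j) ≈ embed i + embed j
      +-homo (ℤ.+ m)  (ℤ.+ n)  = Mult′.×-homo-+ 1# m n
      +-homo (ℤ.+ m)  -[1+ n ] = ⊖-homo m (suc n)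
      +-homo -[1+ m ] (ℤ.+ n)  = trans (⊖-homo n (suc m)) (+-comm _ _)
      +-homo -[1+ m ] -[1+ n ] = trans
        (-‿cong (trans (reflexive (≡.cong (_×′ 1#) (≡.cong suc (≡.sym (ℕ.+-suc m n)))))
          (Mult′.×-homo-+ 1# (suc m) (suc n))))
        (sym (-‿+-comm _ _))

      ◃⁺ : ∀ n → embed (Sign.+ ℤ.◃ n) ≈ n ×′ 1#
      ◃⁺ zero    = refl
      ◃⁺ (suc n) = refl

      ◃⁻ : ∀ n → embed (Sign.- ℤ.◃ n) ≈ - (n ×′ 1#)
      ◃⁻ zero    = sym -0#≈0#
      ◃⁻ (suc n) = refl

      *-homo : ∀ i j → embed (i ℤ.* j) ≈ embed i * embed j
      *-homo (ℤ.+ m)  (ℤ.+ n)  = trans (◃⁺ (m ℕ.* n)) (Mult′.×1-homo-* m n)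
      *-homo (ℤ.+ m)  -[1+ n ] = trans (◃⁻ (m ℕ.* suc n))
        (trans (-‿cong (Mult′.×1-homo-* m (suc n))) (-‿distribʳ-* _ _))
      *-homo -[1+ m ] (ℤ.+ n)  = trans (◃⁻ (suc m ℕ.* n))
        (trans (-‿cong (Mult′.×1-homo-* (suc m) n)) (-‿distribˡ-* _ _))
      *-homo -[1+ m ] -[1+ n ] = trans (◃⁺ (suc m ℕ.* suc n))
        (trans (Mult′.×1-homo-* (suc m) (suc n))
          (trans (sym (-‿involutive _))
            (trans (-‿cong (-‿distribˡ-* _ _)) (-‿distribʳ-* _ _))))

      neg-homo : ∀ i → embed (ℤ.- i) ≈ - embed i
      neg-homo (ℤ.+ zero)  = sym -0#≈0#
      neg-homo (ℤ.+ suc n) = refl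
      neg-homo -[1+ n ]    = sym (-‿involutive _)

      morphism : ℤ.+-*-rawRing -Raw-AlmostCommutative⟶ almostCommutativeRing
      morphism = record
        { ⟦_⟧    = embed
        ; +-homo = +-homo
        ; *-homo = *-homo
        ; -‿homo = neg-homo
        ; 0-homo = refl
        ; 1-homo = refl
        }

      embed-≟ : ∀ i j → Maybe (embed i ≈ embed j)
      embed-≟ i j = Maybe.map (λ i≡j → reflexive (≡.cong embed i≡j)) (dec⇒weaklyDec ℤ._≟_ i j)

    open RingSolver ℤ.+-*-rawRing almostCommutativeRing morphism embed-≟ public

    :0 :1 : ∀ {n} → Polynomial n
    :0 = con ℤ.0ℤ
    :1 = con ℤ.1ℤ

  open IntegerCoefficients public using (solve; _:=_; _:+_; _:*_; _:-_; :-_; :0; :1)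

  private
    decTotalOrder : DecTotalOrder 0ℓ 0ℓ 0ℓ
    decTotalOrder = record { isDecTotalOrder = isDecTotalOrder }

  open DecTotalOrder decTotalOrder public using (_≟_; _≤?_; poset; ≤-respˡ-≈; ≤-respʳ-≈)
    renaming (refl to ≤-refl; trans to ≤-trans; antisym to ≤-antisym
             ; reflexive to ≤-reflexive; total to ≤-total)
  module ≤-Reasoning = PartialOrderReasoning poset
  open ≤-Reasoning

  ≤-stable : ∀ {x y} → ¬ ¬ (x ≤ y) → x ≤ y
  ≤-stable = decidable-stable (_ ≤? _)

  ≰⇒> : ∀ {x y} → ¬ (x ≤ y) → y < x
  ≰⇒> {x} {y} x≰y with ≤-total x y
  ... | inj₁ x≤y = contradiction x≤y x≰y
  ... | inj₂ y≤x = y≤x , λ y≈x → x≰y (≤-reflexive (sym y≈x))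

  <⇒≱ : ∀ {x y} → x < y → ¬ (y ≤ x)
  <⇒≱ (x≤y , x≉y) y≤x = x≉y (≤-antisym x≤y y≤x)

  <-≤-trans : ∀ {x y z} → x < y → y ≤ z → x < z
  <-≤-trans x<y y≤z = begin-strict _ <⟨ x<y ⟩ _ ≤⟨ y≤z ⟩ _ ∎

  ≤-<-trans : ∀ {x y z} → x ≤ y → y < z → x < z
  ≤-<-trans x≤y y<z = begin-strict _ ≤⟨ x≤y ⟩ _ <⟨ y<z ⟩ _ ∎

  <⇒≤ : ∀ {x y} → x < y → x ≤ y
  <⇒≤ = proj₁

  >⇒≉ : ∀ {x y} → x < y → y ≉ x
  >⇒≉ x<y y≈x = proj₂ x<y (sym y≈x)

  pos-or-zero : ∀ {x} → 0# ≤ x → x ≈ 0# ⊎ 0# < x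
  pos-or-zero {x} 0≤x with x ≟ 0#
  ... | yes x≈0 = inj₁ x≈0
  ... | no  x≉0 = inj₂ (0≤x , λ 0≈x → x≉0 (sym 0≈x))

  +-mono-≤ : ∀ {x y u v} → x ≤ y → u ≤ v → x + u ≤ y + v
  +-mono-≤ {x} {y} {u} {v} x≤y u≤v = begin
    x + u  ≤⟨ +-monoˡ-≤ u x≤y ⟩
    y + u  ≈⟨ +-comm y u ⟩
    u + y  ≤⟨ +-monoˡ-≤ y u≤v ⟩
    v + y  ≈⟨ +-comm v y ⟩
    y + v  ∎

  +-monoʳ-≤ : ∀ z {x y} → x ≤ y → z + x ≤ z + y
  +-monoʳ-≤ z = +-mono-≤ ≤-refl

  +-cancelʳ-≤ : ∀ z {x y} → x + z ≤ y + z → x ≤ y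
  +-cancelʳ-≤ z {x} {y} x+z≤y+z = begin
    x              ≈⟨ solve 2 (λ x z → x := x :+ z :- z) refl x z ⟩
    x + z + - z    ≤⟨ +-monoˡ-≤ (- z) x+z≤y+z ⟩
    y + z + - z    ≈⟨ solve 2 (λ y z → y :+ z :- z := y) refl y z ⟩
    y              ∎

  +-nonNeg : ∀ {x y} → 0# ≤ x → 0# ≤ y → 0# ≤ x + y
  +-nonNeg {x} {y} 0≤x 0≤y = begin
    0#       ≈⟨ +-identityˡ 0# ⟨
    0# + 0#  ≤⟨ +-mono-≤ 0≤x 0≤y ⟩
    x + y    ∎

  +-pos-nonNeg : ∀ {x y} → 0# < x → 0# ≤ y → 0# < x + y
  +-pos-nonNeg {x} {y} 0<x 0≤y = <-≤-trans 0<x (begin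
    x       ≈⟨ +-identityʳ x ⟨
    x + 0#  ≤⟨ +-monoʳ-≤ x 0≤y ⟩
    x + y   ∎)

  -- Splits an inequality into the sign of an explicit slack `e` and an identity, which the ring
  -- solver can settle.
  ≤-by : ∀ {x y} e → 0# ≤ e → x + e ≈ y → x ≤ y
  ≤-by {x} {y} e 0≤e x+e≈y = begin
    x       ≈⟨ +-identityʳ x ⟨
    x + 0#  ≤⟨ +-monoʳ-≤ x 0≤e ⟩
    x + e   ≈⟨ x+e≈y ⟩
    y       ∎

  x≤y⇒0≤y-x : ∀ {x y} → x ≤ y → 0# ≤ y - x
  x≤y⇒0≤y-x {x} {y} x≤y = begin
    0#     ≈⟨ -‿inverseʳ x ⟨
    x - x  ≤⟨ +-monoˡ-≤ (- x) x≤y ⟩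
    y - x  ∎

  x<y⇒0<y-x : ∀ {x y} → x < y → 0# < y - x
  x<y⇒0<y-x {x} {y} (x≤y , x≉y) = x≤y⇒0≤y-x x≤y , λ 0≈y-x → x≉y (begin-equality
    x            ≈⟨ +-identityʳ x ⟨
    x + 0#       ≈⟨ +-congˡ 0≈y-x ⟩
    x + (y - x)  ≈⟨ solve 2 (λ x y → x :+ (y :- x) := y) refl x y ⟩
    y            ∎)

  neg-mono-≤ : ∀ {x y} → x ≤ y → - y ≤ - x
  neg-mono-≤ {x} {y} x≤y = ≤-by (y - x) (x≤y⇒0≤y-x x≤y)
    (solve 2 (λ x y → :- y :+ (y :- x) := :- x) refl x y)

  0≤1 : 0# ≤ 1#
  0≤1 with ≤-total 0# 1#
  ... | inj₁ 0≤1 = 0≤1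
  ... | inj₂ 1≤0 = begin
    0#           ≤⟨ *-nonNeg 0≤-1 0≤-1 ⟩
    - 1# * - 1#  ≈⟨ solve 0 (:- :1 :* :- :1 := :1) refl ⟩
    1#           ∎
    where
    0≤-1 : 0# ≤ - 1#
    0≤-1 = ≤-respˡ-≈ -0#≈0# (neg-mono-≤ 1≤0)

  0<1 : 0# < 1#
  0<1 = 0≤1 , 0≉1

  1≉0 : 1# ≉ 0#
  1≉0 = >⇒≉ 0<1

  *-monoʳ-≤ : ∀ {z x y} → 0# ≤ z → x ≤ y → z * x ≤ z * y
  *-monoʳ-≤ {z} {x} {y} 0≤z x≤y = ≤-by (z * (y - x)) (*-nonNeg 0≤z (x≤y⇒0≤y-x x≤y))
    (solve 3 (λ x y z → z :* x :+ z :* (y :- x) := z :* y) refl x y z)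

  *-monoˡ-≤ : ∀ {z x y} → 0# ≤ z → x ≤ y → x * z ≤ y * z
  *-monoˡ-≤ {z} {x} {y} 0≤z x≤y = begin
    x * z  ≈⟨ *-comm x z ⟩
    z * x  ≤⟨ *-monoʳ-≤ 0≤z x≤y ⟩
    z * y  ≈⟨ *-comm z y ⟩
    y * z  ∎

  *-mono-≤ : ∀ {x y u v} → 0# ≤ x → 0# ≤ u → x ≤ y → u ≤ v → x * u ≤ y * v
  *-mono-≤ 0≤x 0≤u x≤y u≤v = ≤-trans (*-monoˡ-≤ 0≤u x≤y) (*-monoʳ-≤ (≤-trans 0≤x x≤y) u≤v)

  square-nonNeg : ∀ x → 0# ≤ x * x
  square-nonNeg x with ≤-total 0# x
  ... | inj₁ 0≤x = *-nonNeg 0≤x 0≤x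
  ... | inj₂ x≤0 = begin
    0#         ≤⟨ *-nonNeg 0≤-x 0≤-x ⟩
    - x * - x  ≈⟨ solve 1 (λ x → :- x :* :- x := x :* x) refl x ⟩
    x * x      ∎
    where
    0≤-x : 0# ≤ - x
    0≤-x = ≤-respˡ-≈ -0#≈0# (neg-mono-≤ x≤0)

  ⁻¹-inverseˡ : ∀ x → x ≉ 0# → x ⁻¹ * x ≈ 1#
  ⁻¹-inverseˡ x x≉0 = trans (*-comm _ _) (⁻¹-inverseʳ x x≉0)

  *-cancelʳ : ∀ {x y z} → z ≉ 0# → x * z ≈ y * z → x ≈ y
  *-cancelʳ {x} {y} {z} z≉0 xz≈yz = begin-equality
    x               ≈⟨ *-identityʳ x ⟨
    x * 1#          ≈⟨ *-congˡ (⁻¹-inverseʳ z z≉0) ⟨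
    x * (z * z ⁻¹)  ≈⟨ *-assoc x z (z ⁻¹) ⟨
    x * z * z ⁻¹    ≈⟨ *-congʳ xz≈yz ⟩
    y * z * z ⁻¹    ≈⟨ *-assoc y z (z ⁻¹) ⟩
    y * (z * z ⁻¹)  ≈⟨ *-congˡ (⁻¹-inverseʳ z z≉0) ⟩
    y * 1#          ≈⟨ *-identityʳ y ⟩
    y               ∎

  ⁻¹-unique : ∀ {x y} → x * y ≈ 1# → y ⁻¹ ≈ x
  ⁻¹-unique {x} {y} xy≈1 = *-cancelʳ y≉0 (trans (⁻¹-inverseˡ y y≉0) (sym xy≈1))
    where
    y≉0 : y ≉ 0#
    y≉0 y≈0 = 1≉0 (begin-equality
      1#      ≈⟨ xy≈1 ⟨
      x * y   ≈⟨ *-congˡ y≈0 ⟩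
      x * 0#  ≈⟨ zeroʳ x ⟩
      0#      ∎)

  1⁻¹≈1 : 1# ⁻¹ ≈ 1#
  1⁻¹≈1 = ⁻¹-unique (*-identityʳ 1#)

  *-pos : ∀ {x y} → 0# < x → 0# < y → 0# < x * y
  *-pos {x} {y} (0≤x , 0≉x) (0≤y , 0≉y) = *-nonNeg 0≤x 0≤y , λ 0≈xy →
    0≉x (*-cancelʳ (0≉y ∘ sym) (trans (zeroˡ y) 0≈xy))

  ⁻¹-pos : ∀ {x} → 0# < x → 0# < x ⁻¹
  ⁻¹-pos {x} 0<x@(0≤x , 0≉x) with ≤-total 0# (x ⁻¹)
  ... | inj₁ 0≤x⁻¹ = 0≤x⁻¹ , λ 0≈x⁻¹ → 1≉0 (begin-equality
    1#        ≈⟨ ⁻¹-inverseʳ x (>⇒≉ 0<x) ⟨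
    x * x ⁻¹  ≈⟨ *-congˡ 0≈x⁻¹ ⟨
    x * 0#    ≈⟨ zeroʳ x ⟩
    0#        ∎)
  ... | inj₂ x⁻¹≤0 = contradiction (begin
    1#        ≈⟨ ⁻¹-inverseʳ x (>⇒≉ 0<x) ⟨
    x * x ⁻¹  ≤⟨ *-monoʳ-≤ 0≤x x⁻¹≤0 ⟩
    x * 0#    ≈⟨ zeroʳ x ⟩
    0#        ∎) (<⇒≱ 0<1)

  *-cancelʳ-≤ : ∀ {z x y} → 0# < z → x * z ≤ y * z → x ≤ y
  *-cancelʳ-≤ {z} {x} {y} 0<z xz≤yz = begin
    x               ≈⟨ *-identityʳ x ⟨
    x * 1#          ≈⟨ *-congˡ (⁻¹-inverseʳ z (>⇒≉ 0<z)) ⟨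
    x * (z * z ⁻¹)  ≈⟨ *-assoc x z (z ⁻¹) ⟨
    x * z * z ⁻¹    ≤⟨ *-monoˡ-≤ (<⇒≤ (⁻¹-pos 0<z)) xz≤yz ⟩
    y * z * z ⁻¹    ≈⟨ *-assoc y z (z ⁻¹) ⟩
    y * (z * z ⁻¹)  ≈⟨ *-congˡ (⁻¹-inverseʳ z (>⇒≉ 0<z)) ⟩
    y * 1#          ≈⟨ *-identityʳ y ⟩
    y               ∎

  *-cancelˡ-≤ : ∀ {z x y} → 0# < z → z * x ≤ z * y → x ≤ y
  *-cancelˡ-≤ {z} {x} {y} 0<z zx≤zy = *-cancelʳ-≤ 0<z (begin
    x * z  ≈⟨ *-comm x z ⟩
    z * x  ≤⟨ zx≤zy ⟩
    z * y  ≈⟨ *-comm z y ⟩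
    y * z  ∎)

  x÷y*y : ∀ {y} x → y ≉ 0# → x ÷ y * y ≈ x
  x÷y*y {y} x y≉0 = trans (*-assoc x (y ⁻¹) y) (trans (*-congˡ (⁻¹-inverseˡ y y≉0)) (*-identityʳ x))

  ÷-nonNeg : ∀ {x y} → 0# ≤ x → 0# < y → 0# ≤ x ÷ y
  ÷-nonNeg 0≤x 0<y = *-nonNeg 0≤x (<⇒≤ (⁻¹-pos 0<y))

  1≤x⇒0<x : ∀ {x} → 1# ≤ x → 0# < x
  1≤x⇒0<x = <-≤-trans 0<1

  ⁻¹-antitone : ∀ {x y} → 0# < x → x ≤ y → y ⁻¹ ≤ x ⁻¹
  ⁻¹-antitone {x} {y} 0<x x≤y = *-cancelʳ-≤ 0<y (*-cancelˡ-≤ 0<x (begin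
    x * (y ⁻¹ * y)  ≈⟨ *-congˡ (⁻¹-inverseˡ y (>⇒≉ 0<y)) ⟩
    x * 1#          ≈⟨ *-identityʳ x ⟩
    x               ≤⟨ x≤y ⟩
    y               ≈⟨ *-identityˡ y ⟨
    1# * y          ≈⟨ *-congʳ (⁻¹-inverseʳ x (>⇒≉ 0<x)) ⟨
    x * x ⁻¹ * y    ≈⟨ *-assoc x (x ⁻¹) y ⟩
    x * (x ⁻¹ * y)  ∎))
    where
    0<y : 0# < y
    0<y = <-≤-trans 0<x x≤y

  x≤1⇒1≤x⁻¹ : ∀ {x} → 0# < x → x ≤ 1# → 1# ≤ x ⁻¹
  x≤1⇒1≤x⁻¹ 0<x x≤1 = ≤-respˡ-≈ 1⁻¹≈1 (⁻¹-antitone 0<x x≤1)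

  1≤x⇒x⁻¹≤1 : ∀ {x} → 1# ≤ x → x ⁻¹ ≤ 1#
  1≤x⇒x⁻¹≤1 1≤x = ≤-respʳ-≈ 1⁻¹≈1 (⁻¹-antitone 0<1 1≤x)

  ⁻¹-involutive : ∀ {x} → x ≉ 0# → x ⁻¹ ⁻¹ ≈ x
  ⁻¹-involutive {x} x≉0 = ⁻¹-unique (⁻¹-inverseʳ x x≉0)

  open ExpProperties commutativeSemiring public
    using (^-congˡ; ^-congʳ; ^-homo-*; ^-assocʳ; ^-distrib-*)

  ^-nonNeg : ∀ {x} n → 0# ≤ x → 0# ≤ x ^ n
  ^-nonNeg zero    0≤x = 0≤1
  ^-nonNeg (suc n) 0≤x = *-nonNeg 0≤x (^-nonNeg n 0≤x)

  ^-pos : ∀ {x} n → 0# < x → 0# < x ^ n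
  ^-pos zero    0<x = 0<1
  ^-pos (suc n) 0<x = *-pos 0<x (^-pos n 0<x)

  ^-mono-≤ : ∀ {x y} n → 0# ≤ x → x ≤ y → x ^ n ≤ y ^ n
  ^-mono-≤ zero    0≤x x≤y = ≤-refl
  ^-mono-≤ (suc n) 0≤x x≤y = *-mono-≤ 0≤x (^-nonNeg n 0≤x) x≤y (^-mono-≤ n 0≤x x≤y)

  1^n≈1 : ∀ n → 1# ^ n ≈ 1#
  1^n≈1 zero    = refl
  1^n≈1 (suc n) = trans (*-identityˡ _) (1^n≈1 n)

  1≤x^n : ∀ {x} n → 1# ≤ x → 1# ≤ x ^ n
  1≤x^n n 1≤x = ≤-respˡ-≈ (1^n≈1 n) (^-mono-≤ n 0≤1 1≤x)

  x^n≤1 : ∀ {x} n → 0# ≤ x → x ≤ 1# → x ^ n ≤ 1#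
  x^n≤1 n 0≤x x≤1 = ≤-respʳ-≈ (1^n≈1 n) (^-mono-≤ n 0≤x x≤1)

  -- Serves in place of extracting roots. If y < x, then x is positive, and x xⁿ ≤ y yⁿ ≤ y xⁿ
  -- yields x ≤ y after cancelling xⁿ.
  ^-cancel-≤ : ∀ {x y} n → 1 ℕ.≤ n → 0# ≤ y → x ^ n ≤ y ^ n → x ≤ y
  ^-cancel-≤ {x} {y} (suc n) _ 0≤y xⁿ≤yⁿ = ≤-stable λ x≰y →
    let y<x = ≰⇒> x≰y
        0<x = ≤-<-trans 0≤y y<x
    in x≰y (*-cancelʳ-≤ (^-pos n 0<x) (begin
      x * x ^ n  ≤⟨ xⁿ≤yⁿ ⟩
      y * y ^ n  ≤⟨ *-monoʳ-≤ 0≤y (^-mono-≤ n 0≤y (<⇒≤ y<x)) ⟩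
      y * x ^ n  ∎))

  ^-monoʳ-≤ : ∀ {x m n} → 1# ≤ x → m ℕ.≤ n → x ^ m ≤ x ^ n
  ^-monoʳ-≤ {n = n} 1≤x ℕ.z≤n = 1≤x^n n 1≤x
  ^-monoʳ-≤ 1≤x (ℕ.s≤s m≤n) = *-monoʳ-≤ (<⇒≤ (1≤x⇒0<x 1≤x)) (^-monoʳ-≤ 1≤x m≤n)

  ^-antitoneʳ-≤ : ∀ {x m n} → 0# ≤ x → x ≤ 1# → m ℕ.≤ n → x ^ n ≤ x ^ m
  ^-antitoneʳ-≤ {n = n} 0≤x x≤1 ℕ.z≤n = x^n≤1 n 0≤x x≤1
  ^-antitoneʳ-≤ 0≤x x≤1 (ℕ.s≤s m≤n) = *-monoʳ-≤ 0≤x (^-antitoneʳ-≤ 0≤x x≤1 m≤n)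

  ^-swap : ∀ x m n → (x ^ m) ^ n ≈ (x ^ n) ^ m
  ^-swap x m n = trans (^-assocʳ x m n) (trans (^-congʳ x (ℕ.*-comm m n)) (sym (^-assocʳ x n m)))

  ^-⁻¹ : ∀ {x} n → x ≉ 0# → (x ⁻¹) ^ n * x ^ n ≈ 1#
  ^-⁻¹ {x} n x≉0 = begin-equality
    (x ⁻¹) ^ n * x ^ n  ≈⟨ ^-distrib-* (x ⁻¹) x n ⟨
    (x ⁻¹ * x) ^ n      ≈⟨ ^-congˡ n (⁻¹-inverseˡ x x≉0) ⟩
    1# ^ n              ≈⟨ 1^n≈1 n ⟩
    1#                  ∎

  fromℕ-+ : ∀ m n → fromℕ (m ℕ.+ n) ≈ fromℕ m + fromℕ n
  fromℕ-+ = MultProperties.×-homo-+ semiring 1#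

  fromℕ-* : ∀ m n → fromℕ (m ℕ.* n) ≈ fromℕ m * fromℕ n
  fromℕ-* = MultProperties.×1-homo-* semiring

  fromℕ-1 : fromℕ 1 ≈ 1#
  fromℕ-1 = +-identityʳ 1#

  fromℕ-nonNeg : ∀ n → 0# ≤ fromℕ n
  fromℕ-nonNeg zero    = ≤-refl
  fromℕ-nonNeg (suc n) = +-nonNeg 0≤1 (fromℕ-nonNeg n)

  fromℕ-pos : ∀ {n} → 1 ℕ.≤ n → 0# < fromℕ n
  fromℕ-pos {suc n} _ = +-pos-nonNeg 0<1 (fromℕ-nonNeg n)

  fromℕ-mono-≤ : ∀ {m n} → m ℕ.≤ n → fromℕ m ≤ fromℕ n
  fromℕ-mono-≤ {n = n} ℕ.z≤n = fromℕ-nonNeg n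
  fromℕ-mono-≤ (ℕ.s≤s m≤n) = +-monoʳ-≤ 1# (fromℕ-mono-≤ m≤n)

  fromℕ-cancel-≤ : ∀ {m n} → fromℕ m ≤ fromℕ n → m ℕ.≤ n
  fromℕ-cancel-≤ {m} {n} m≤n with m ℕ.≤? n
  ... | yes m≤n′ = m≤n′
  ... | no  m≰n  = contradiction m≤n (<⇒≱ (<-≤-trans n<1+n (fromℕ-mono-≤ (ℕ.≰⇒> m≰n))))
    where
    n<1+n : fromℕ n < 1# + fromℕ n
    n<1+n = ≤-by 1# 0≤1 (+-comm _ _) , λ n≈1+n → 0≉1 (begin-equality
      0#                      ≈⟨ -‿inverseʳ (fromℕ n) ⟨
      fromℕ n - fromℕ n       ≈⟨ +-congʳ n≈1+n ⟩
      1# + fromℕ n - fromℕ n  ≈⟨ solve 1 (λ n → :1 :+ n :- n := :1) refl (fromℕ n) ⟩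
      1#                      ∎)

  -- Were every natural number below x, their supremum s would exist. As each n + 1 is at most s,
  -- the smaller number s - 1 would be an upper bound too.
  archimedean : ∀ x → ¬ ¬ (∃[ n ] x ≤ fromℕ n)
  archimedean x unbounded = <⇒≱ 0<1 (+-cancelʳ-≤ (sup S) (begin
    1# + sup S                ≤⟨ +-monoʳ-≤ 1# s≤s-1 ⟩
    1# + (sup S - 1#)         ≈⟨ solve 1 (λ s → :1 :+ (s :- :1) := s) refl (sup S) ⟩
    sup S                     ≈⟨ +-identityˡ (sup S) ⟨
    0# + sup S                ∎))
    where
    S : ℝ → Set
    S y = ∃[ n ] y ≈ fromℕ n
    S-inhabited : ∃ S
    S-inhabited = 0# , 0 , refl
    S-bounded : ∃ (UpperBound S)
    S-bounded = x , λ { y (n , y≈n) → ≤-respˡ-≈ (sym y≈n)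
      (≤-stable λ n≰x → unbounded (n , <⇒≤ (≰⇒> n≰x))) }
    s≤s-1 : sup S ≤ sup S - 1#
    s≤s-1 = sup-least S S-inhabited S-bounded (sup S - 1#) λ { y (n , y≈n) → begin
      y                ≈⟨ y≈n ⟩
      fromℕ n          ≈⟨ solve 1 (λ n → n := :1 :+ n :- :1) refl (fromℕ n) ⟩
      fromℕ (suc n) - 1#  ≤⟨ +-monoˡ-≤ (- 1#)
        (sup-upper S S-inhabited S-bounded (fromℕ (suc n)) (suc n , refl)) ⟩
      sup S - 1#       ∎ }

  n<1+n : ∀ n → fromℕ n < fromℕ (suc n)
  n<1+n n = ≰⇒> λ 1+n≤n → ℕ.<-irrefl ≡.refl (fromℕ-cancel-≤ {suc n} {n} 1+n≤n)

  -- If no n qualified, n ≤ x would always imply n + 1 ≤ x, and induction from 0 ≤ x would put every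
  -- natural number below x.
  floor : ∀ x → 0# ≤ x → ¬ ¬ (∃[ n ] (fromℕ n ≤ x × x < fromℕ (suc n)))
  floor x 0≤x no-floor = archimedean x λ (n , x≤n) → <⇒≱ (n<1+n n) (≤-trans (below (suc n)) x≤n)
    where
    below : ∀ n → fromℕ n ≤ x
    below zero    = 0≤x
    below (suc n) = ≤-stable λ 1+n≰x → no-floor (n , below n , ≰⇒> 1+n≰x)

  -- `inf` negates the supremum of the reflected set, which is unspecified for an empty set; hence
  -- the first hypothesis, stated for `- x`.
  ≤-inf : ∀ S {b} → ∃ (λ x → S (- x)) → (∀ x → S x → b ≤ x) → b ≤ inf S
  ≤-inf S {b} inhabited bound = begin
    b                          ≈⟨ solve 1 (λ b → b := :- (:- b)) refl b ⟩
    - - b                      ≤⟨ neg-mono-≤ (sup-least (λ x → S (- x)) inhabited (- b , upper) (- b) upper) ⟩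
    - sup (λ x → S (- x))      ∎
    where
    upper : UpperBound (λ x → S (- x)) (- b)
    upper x S-x = begin
      x      ≈⟨ solve 1 (λ x → x := :- (:- x)) refl x ⟩
      - - x  ≤⟨ neg-mono-≤ (bound (- x) S-x) ⟩
      - b    ∎

-- Real powers as suprema of rational powers

module Powers (R : Reals) where
  open Analysis R hiding (zero)
  open OrderedField R
  open ≤-Reasoning

  -- The tangent to t ↦ tⁿ⁺¹ at y lies below the graph.
  tangent : ∀ {x y} n → 0# ≤ x → 0# ≤ y →
    fromℕ (suc n) * (x * y ^ n) ≤ x ^ suc n + fromℕ n * y ^ suc n
  tangent {x} {y} zero 0≤x 0≤y = ≤-reflexive
    (solve 2 (λ x y → (:1 :+ :0) :* (x :* :1) := x :* :1 :+ :0 :* (y :* :1)) refl x y)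
  tangent {x} {y} (suc n) 0≤x 0≤y = +-cancelʳ-≤ (fromℕ n * (x * y ^ suc n)) (begin
    fromℕ (2 ℕ.+ n) * (x * (y * y ^ n)) + fromℕ n * (x * (y * y ^ n))
      -- Adding (n + 1) yⁿ (x - y)² ≥ 0 removes the mixed terms and leaves x times the left side of
      -- the induction hypothesis.
      ≤⟨ ≤-by (fromℕ (suc n) * (y ^ n * ((x - y) * (x - y))))
           (*-nonNeg (fromℕ-nonNeg (suc n)) (*-nonNeg (^-nonNeg n 0≤y) (square-nonNeg (x - y))))
           (solve 4 (λ x y n z →
               (:1 :+ (:1 :+ n)) :* (x :* (y :* z)) :+ n :* (x :* (y :* z))
                 :+ (:1 :+ n) :* (z :* ((x :- y) :* (x :- y)))
               := x :* ((:1 :+ n) :* (x :* z)) :+ (:1 :+ n) :* (y :* (y :* z)))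
             refl x y (fromℕ n) (y ^ n)) ⟩
    x * (fromℕ (suc n) * (x * y ^ n)) + fromℕ (suc n) * y ^ (2 ℕ.+ n)
      ≤⟨ +-monoˡ-≤ _ (*-monoʳ-≤ 0≤x (tangent n 0≤x 0≤y)) ⟩
    x * (x ^ suc n + fromℕ n * y ^ suc n) + fromℕ (suc n) * y ^ (2 ℕ.+ n)
      ≈⟨ solve 5 (λ x u n v w → x :* (u :+ n :* v) :+ w := x :* u :+ w :+ n :* (x :* v))
           refl x (x ^ suc n) (fromℕ n) (y ^ suc n) _ ⟩
    x ^ (2 ℕ.+ n) + fromℕ (suc n) * y ^ (2 ℕ.+ n) + fromℕ n * (x * y ^ suc n)
      ∎)

  -- Bernoulli's inequality, the tangent at 1, gives (1 - δ)ᵏ ≥ 1 - k δ, and δ is chosen to make y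
  -- (1 - k δ) equal to x. A strict inequality thus leaves room for a factor rᵏ, by which a
  -- candidate for x ^ (m / k) can be rescaled without extracting a root.
  root-gap : ∀ {x y} k → 1 ℕ.≤ k → 0# < x → x < y →
    ∃[ r ] 0# < r × r < 1# × x ≤ y * r ^ k
  root-gap {x} {y} k@(suc n) _ 0<x x<y = r , 0<r , r<1 , (begin
    x                                           ≈⟨ solve 2 (λ x y → x := y :- (y :- x)) refl x y ⟩
    y - (y - x)                                 ≈⟨ +-congˡ (-‿cong (x÷y*y (y - x) ky≉0)) ⟨
    y - δ * (fromℕ k * y)
      ≈⟨ solve 3 (λ d n y → y :- d :* ((:1 :+ n) :* y) := y :* ((:1 :+ n) :* ((:1 :- d) :* :1)
             :- n :* :1)) refl δ (fromℕ n) y ⟩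
    y * (fromℕ k * (r * 1#) - fromℕ n * 1#)
      ≈⟨ *-congˡ (+-cong (*-congˡ (*-congˡ (1^n≈1 n))) (-‿cong (*-congˡ (1^n≈1 k)))) ⟨
    y * (fromℕ k * (r * 1# ^ n) - fromℕ n * 1# ^ k)
      ≤⟨ *-monoʳ-≤ (<⇒≤ 0<y) (+-monoˡ-≤ _ (tangent n (<⇒≤ 0<r) 0≤1)) ⟩
    y * (r ^ k + fromℕ n * 1# ^ k - fromℕ n * 1# ^ k)
      ≈⟨ *-congˡ (solve 2 (λ u v → u :+ v :- v := u) refl _ _) ⟩
    y * r ^ k                                   ∎)
    where
    0<y : 0# < y
    0<y = ≤-<-trans (<⇒≤ 0<x) x<y
    0<ky : 0# < fromℕ k * y
    0<ky = *-pos (fromℕ-pos {k} (ℕ.s≤s ℕ.z≤n)) 0<y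
    ky≉0 : fromℕ k * y ≉ 0#
    ky≉0 = >⇒≉ 0<ky
    δ r : ℝ
    δ = (y - x) ÷ (fromℕ k * y)
    r = 1# - δ
    0<r : 0# < r
    0<r = x<y⇒0<y-x (≰⇒> λ 1≤δ → <⇒≱ 0<x (+-cancelʳ-≤ y (begin
      x + y  ≤⟨ +-monoʳ-≤ x (begin
        y                 ≤⟨ ≤-by (fromℕ n * y) (*-nonNeg (fromℕ-nonNeg n) (<⇒≤ 0<y))
                               (solve 2 (λ n y → y :+ n :* y := :1 :* ((:1 :+ n) :* y)) refl (fromℕ n) y) ⟩
        1# * (fromℕ k * y)  ≤⟨ *-monoˡ-≤ (<⇒≤ 0<ky) 1≤δ ⟩
        δ * (fromℕ k * y)   ≈⟨ x÷y*y (y - x) ky≉0 ⟩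
        y - x             ∎) ⟩
      x + (y - x)  ≈⟨ solve 2 (λ x y → x :+ (y :- x) := y) refl x y ⟩
      y            ≈⟨ +-identityˡ y ⟨
      0# + y       ∎)))
    0<δ : 0# < δ
    0<δ = *-pos (x<y⇒0<y-x x<y) (⁻¹-pos 0<ky)
    r<1 : r < 1#
    r<1 = ≰⇒> λ 1≤r → <⇒≱ 0<δ (+-cancelʳ-≤ r (begin
      δ + (1# - δ)  ≈⟨ solve 1 (λ d → d :+ (:1 :- d) := :1) refl δ ⟩
      1#            ≤⟨ 1≤r ⟩
      r             ≈⟨ +-identityˡ r ⟨
      0# + r        ∎))

  -- Exponential growth: a bound on (x / y)ᵏ that is uniform in k forces x ≤ y.
  bounded-ratio : ∀ {x y C} → 0# ≤ x → 0# < y → (∀ k → x ^ suc k ≤ C * y ^ suc k) → x ≤ y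
  bounded-ratio {x} {y} {C} 0≤x 0<y bound = ≤-stable λ x≰y →
    let 0<x-y = x<y⇒0<y-x (≰⇒> x≰y)
        x-y≉0 = >⇒≉ 0<x-y
    in archimedean ((C * y) ÷ (x - y)) λ (k , Cy÷[x-y]≤k) →
      <⇒≱ (<-≤-trans 0<y (<⇒≤ (≰⇒> x≰y))) (+-cancelʳ-≤ (fromℕ k * (x - y)) (begin
        x + fromℕ k * (x - y)        ≤⟨ linear k ⟩
        C * y                        ≈⟨ x÷y*y (C * y) x-y≉0 ⟨
        (C * y) ÷ (x - y) * (x - y)  ≤⟨ *-monoˡ-≤ (<⇒≤ 0<x-y) Cy÷[x-y]≤k ⟩
        fromℕ k * (x - y)            ≈⟨ +-identityˡ _ ⟨
        0# + fromℕ k * (x - y)       ∎))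
    where
    -- The tangent at y bounds xᵏ⁺¹ from below by yᵏ⁺¹ + (k + 1) yᵏ (x - y), so linear growth in k
    -- is all that `archimedean` has to refute.
    linear : ∀ k → x + fromℕ k * (x - y) ≤ C * y
    linear k = *-cancelʳ-≤ (^-pos k 0<y) (+-cancelʳ-≤ (fromℕ k * y ^ suc k) (begin
      (x + fromℕ k * (x - y)) * y ^ k + fromℕ k * (y * y ^ k)
        ≈⟨ solve 4 (λ x y k z → (x :+ k :* (x :- y)) :* z :+ k :* (y :* z)
             := (:1 :+ k) :* (x :* z)) refl x y (fromℕ k) (y ^ k) ⟩
      fromℕ (suc k) * (x * y ^ k)
        ≤⟨ tangent k 0≤x (<⇒≤ 0<y) ⟩
      x ^ suc k + fromℕ k * y ^ suc k
        ≤⟨ +-monoˡ-≤ _ (bound k) ⟩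
      C * (y * y ^ k) + fromℕ k * y ^ suc k
        ≈⟨ +-congʳ (*-assoc C y (y ^ k)) ⟨
      C * y * y ^ k + fromℕ k * y ^ suc k
        ∎))

  -- The side of `a` on which m / k must lie for x ^ (m / k) not to exceed x ^ a. At x = 1 both
  -- alternatives are open, so a proof that fixes the side of x meets the other alternative only
  -- there.
  Below : (x a : ℝ) (m k : ℕ) → Set
  Below x a m k = (1# ≤ x × fromℕ m ≤ fromℕ k * a) ⊎ (x ≤ 1# × fromℕ k * a ≤ fromℕ m)

  PowSet : (x a : ℝ) → ℝ → Set
  PowSet x a y = 0# ≤ y × ∃[ m ] ∃[ k ] (1 ℕ.≤ k) × (y ^ k ≤ x ^ m) × Below x a m k

  private
    ^-1 : ∀ x → x ^ 1 ≈ x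
    ^-1 = *-identityʳ

    1*a≈a : ∀ a → fromℕ 1 * a ≈ a
    1*a≈a a = trans (*-congʳ fromℕ-1) (*-identityˡ a)

    x≈1⇒x^m≤x^n : ∀ {x} m n → 1# ≤ x → x ≤ 1# → x ^ m ≤ x ^ n
    x≈1⇒x^m≤x^n m n 1≤x x≤1 = ≤-trans (x^n≤1 m (<⇒≤ (1≤x⇒0<x 1≤x)) x≤1) (1≤x^n n 1≤x)

  1∈PowSet : ∀ {x a} → 1# ≤ x → 0# ≤ a → PowSet x a 1#
  1∈PowSet {x} {a} 1≤x 0≤a = 0≤1 , 0 , 1 , ℕ.s≤s ℕ.z≤n , ≤-reflexive (^-1 1#) ,
    inj₁ (1≤x , ≤-respʳ-≈ (sym (1*a≈a a)) 0≤a)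

  x^n∈PowSet : ∀ {x a} n → 0# ≤ x → x ≤ 1# → a ≤ fromℕ n → PowSet x a (x ^ n)
  x^n∈PowSet {x} {a} n 0≤x x≤1 a≤n = ^-nonNeg n 0≤x , n , 1 , ℕ.s≤s ℕ.z≤n ,
    ≤-reflexive (^-1 _) , inj₂ (x≤1 , ≤-respˡ-≈ (sym (1*a≈a a)) a≤n)

  PowSet-inhabited : ∀ {x a} → 0# ≤ x → 0# ≤ a → ¬ ¬ ∃ (PowSet x a)
  PowSet-inhabited {x} {a} 0≤x 0≤a empty with ≤-total 1# x
  ... | inj₁ 1≤x = empty (1# , 1∈PowSet 1≤x 0≤a)
  ... | inj₂ x≤1 = archimedean a λ (n , a≤n) → empty (x ^ n , x^n∈PowSet n 0≤x x≤1 a≤n)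

  -- Take n ≥ a. Members are at most xⁿ if x ≥ 1, since then m ≤ n k, and at most 1 if x ≤ 1; the
  -- sum `1# + x ^ n` covers both cases.
  PowSet-bounded : ∀ {x a} → 0# ≤ x → ¬ ¬ ∃ (UpperBound (PowSet x a))
  PowSet-bounded {x} {a} 0≤x unbounded = archimedean a λ (n , a≤n) →
    unbounded (1# + x ^ n , λ
      { y (0≤y , m , k , 1≤k , yᵏ≤xᵐ , inj₁ (1≤x , m≤ka)) → begin
          y           ≤⟨ ^-cancel-≤ k 1≤k (^-nonNeg n 0≤x) (begin
            y ^ k            ≤⟨ yᵏ≤xᵐ ⟩
            x ^ m            ≤⟨ ^-monoʳ-≤ 1≤x (fromℕ-cancel-≤ {m} {n ℕ.* k} (begin
              fromℕ m             ≤⟨ m≤ka ⟩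
              fromℕ k * a         ≤⟨ *-monoʳ-≤ (fromℕ-nonNeg k) a≤n ⟩
              fromℕ k * fromℕ n   ≈⟨ *-comm _ _ ⟩
              fromℕ n * fromℕ k   ≈⟨ fromℕ-* n k ⟨
              fromℕ (n ℕ.* k)     ∎)) ⟩
            x ^ (n ℕ.* k)    ≈⟨ ^-assocʳ x n k ⟨
            (x ^ n) ^ k      ∎) ⟩
          x ^ n       ≤⟨ ≤-by 1# 0≤1 (+-comm _ _) ⟩
          1# + x ^ n  ∎
      ; y (0≤y , m , k , 1≤k , yᵏ≤xᵐ , inj₂ (x≤1 , _)) → begin
          y           ≤⟨ ^-cancel-≤ k 1≤k 0≤1 (begin
            y ^ k   ≤⟨ yᵏ≤xᵐ ⟩
            x ^ m   ≤⟨ x^n≤1 m 0≤x x≤1 ⟩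
            1#      ≈⟨ 1^n≈1 k ⟨
            1# ^ k  ∎) ⟩
          1#          ≤⟨ ≤-by (x ^ n) (^-nonNeg n 0≤x) refl ⟩
          1# + x ^ n  ∎
      })

  pow-upper : ∀ {x a y} → 0# ≤ x → PowSet x a y → y ≤ pow x a
  pow-upper {x} {a} {y} 0≤x y∈S = ≤-stable λ y≰ → PowSet-bounded {x} {a} 0≤x λ bounded →
    y≰ (sup-upper (PowSet x a) (y , y∈S) bounded y y∈S)

  pow-least : ∀ {x a b} → 0# ≤ x → 0# ≤ a → UpperBound (PowSet x a) b → pow x a ≤ b
  pow-least {x} {a} {b} 0≤x 0≤a bound = ≤-stable λ ≰b → PowSet-inhabited 0≤x 0≤a λ inhabited →
    ≰b (sup-least (PowSet x a) inhabited (b , bound) b bound)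

  pow-nonNeg : ∀ {x a} → 0# ≤ x → 0# ≤ a → 0# ≤ pow x a
  pow-nonNeg 0≤x 0≤a = ≤-stable λ 0≰ → PowSet-inhabited 0≤x 0≤a λ (y , y∈S) →
    0≰ (≤-trans (proj₁ y∈S) (pow-upper 0≤x y∈S))

  private
    pow-resp-≤ : ∀ {x y a b} → 0# ≤ x → 0# ≤ a → x ≈ y → a ≈ b → pow x a ≤ pow y b
    pow-resp-≤ {x} {y} {a} {b} 0≤x 0≤a x≈y a≈b = pow-least 0≤x 0≤a λ
      { z (0≤z , m , k , 1≤k , zᵏ≤xᵐ , below) → pow-upper (≤-respʳ-≈ x≈y 0≤x)
          (0≤z , m , k , 1≤k , ≤-respʳ-≈ (^-congˡ m x≈y) zᵏ≤xᵐ , Below-resp m k below) }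
      where
      Below-resp : ∀ m k → Below x a m k → Below y b m k
      Below-resp _ _ (inj₁ (1≤x , m≤ka)) = inj₁ (≤-respʳ-≈ x≈y 1≤x , ≤-respʳ-≈ (*-congˡ a≈b) m≤ka)
      Below-resp _ _ (inj₂ (x≤1 , ka≤m)) = inj₂ (≤-respˡ-≈ x≈y x≤1 , ≤-respˡ-≈ (*-congˡ a≈b) ka≤m)

  pow-cong : ∀ {x y a b} → 0# ≤ x → 0# ≤ a → x ≈ y → a ≈ b → pow x a ≈ pow y b
  pow-cong 0≤x 0≤a x≈y a≈b = ≤-antisym (pow-resp-≤ 0≤x 0≤a x≈y a≈b)
    (pow-resp-≤ (≤-respʳ-≈ x≈y 0≤x) (≤-respʳ-≈ a≈b 0≤a) (sym x≈y) (sym a≈b))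

  pow-congˡ : ∀ {x y a} → 0# ≤ a → 0# ≤ x → x ≈ y → pow x a ≈ pow y a
  pow-congˡ 0≤a 0≤x x≈y = pow-cong 0≤x 0≤a x≈y refl

  pow-congʳ : ∀ {x a b} → 0# ≤ x → 0# ≤ a → a ≈ b → pow x a ≈ pow x b
  pow-congʳ 0≤x 0≤a a≈b = pow-cong 0≤x 0≤a refl a≈b

  pow-≤1 : ∀ {x a} → 0# ≤ x → x ≤ 1# → 0# ≤ a → pow x a ≤ 1#
  pow-≤1 {x} 0≤x x≤1 0≤a = pow-least 0≤x 0≤a λ { y (_ , m , k , 1≤k , yᵏ≤xᵐ , _) →
    ^-cancel-≤ k 1≤k 0≤1 (begin
      y ^ k   ≤⟨ yᵏ≤xᵐ ⟩
      x ^ m   ≤⟨ x^n≤1 m 0≤x x≤1 ⟩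
      1#      ≈⟨ 1^n≈1 k ⟨
      1# ^ k  ∎) }

  1≤pow : ∀ {x a} → 1# ≤ x → 0# ≤ a → 1# ≤ pow x a
  1≤pow 1≤x 0≤a = pow-upper (<⇒≤ (1≤x⇒0<x 1≤x)) (1∈PowSet 1≤x 0≤a)

  pow-pos : ∀ {x a} → 0# < x → 0# ≤ a → 0# < pow x a
  pow-pos {x} {a} 0<x 0≤a with ≤-total 1# x
  ... | inj₁ 1≤x = 1≤x⇒0<x (1≤pow 1≤x 0≤a)
  ... | inj₂ x≤1 = ≰⇒> λ p≤0 → archimedean a λ (n , a≤n) →
    <⇒≱ (^-pos n 0<x) (≤-trans (pow-upper (<⇒≤ 0<x) (x^n∈PowSet n (<⇒≤ 0<x) x≤1 a≤n)) p≤0)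

  -- For x = 0 the lower bound rests on the empty product `x ^ 0`. This is the convention 0 ^ 0 = 1
  -- on which the exponents 1/∞ rely.
  pow-zeroʳ : ∀ {x a} → 0# ≤ x → a ≈ 0# → pow x a ≈ 1#
  pow-zeroʳ {x} {a} 0≤x a≈0 = ≤-antisym
    (pow-least 0≤x 0≤a λ
      { y (_ , m , k , 1≤k , yᵏ≤xᵐ , below) → ^-cancel-≤ k 1≤k 0≤1 (begin
          y ^ k   ≤⟨ yᵏ≤xᵐ ⟩
          x ^ m   ≤⟨ x^m≤1 m k below ⟩
          1#      ≈⟨ 1^n≈1 k ⟨
          1# ^ k  ∎) })
    1≤p
    where
    0≤a : 0# ≤ a
    0≤a = ≤-reflexive (sym a≈0)
    ka≈0 : ∀ k → fromℕ k * a ≈ 0#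
    ka≈0 k = trans (*-congˡ a≈0) (zeroʳ _)
    x^m≤1 : ∀ m k → Below x a m k → x ^ m ≤ 1#
    x^m≤1 zero    k _                   = ≤-refl
    x^m≤1 (suc m) k (inj₁ (_ , 1+m≤ka)) = contradiction (≤-respʳ-≈ (ka≈0 k) 1+m≤ka)
      (<⇒≱ (fromℕ-pos {suc m} (ℕ.s≤s ℕ.z≤n)))
    x^m≤1 m       k (inj₂ (x≤1 , _))    = x^n≤1 m 0≤x x≤1
    1≤p : 1# ≤ pow x a
    1≤p with ≤-total 1# x
    ... | inj₁ 1≤x = 1≤pow 1≤x 0≤a
    ... | inj₂ x≤1 = pow-upper 0≤x (x^n∈PowSet 0 0≤x x≤1 (≤-reflexive a≈0))

  pow-zeroˡ : ∀ {x a} → x ≈ 0# → 0# < a → pow x a ≈ 0#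
  pow-zeroˡ {x} {a} x≈0 0<a = ≤-antisym
    (pow-least 0≤x (<⇒≤ 0<a) λ
      { y (_ , m , k , 1≤k , yᵏ≤xᵐ , below) → ^-cancel-≤ k 1≤k ≤-refl (begin
          y ^ k   ≤⟨ yᵏ≤xᵐ ⟩
          x ^ m   ≤⟨ x^m≤0 m k 1≤k below ⟩
          0#      ≤⟨ ^-nonNeg k ≤-refl ⟩
          0# ^ k  ∎) })
    (pow-nonNeg 0≤x (<⇒≤ 0<a))
    where
    0≤x : 0# ≤ x
    0≤x = ≤-reflexive (sym x≈0)
    x^m≤0 : ∀ m k → 1 ℕ.≤ k → Below x a m k → x ^ m ≤ 0#
    x^m≤0 m       k 1≤k (inj₁ (1≤x , _))  = contradiction (≤-respʳ-≈ x≈0 1≤x) (<⇒≱ 0<1)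
    x^m≤0 zero    k 1≤k (inj₂ (_ , ka≤0)) = contradiction ka≤0 (<⇒≱ (*-pos (fromℕ-pos 1≤k) 0<a))
    x^m≤0 (suc m) k 1≤k (inj₂ _)          = ≤-reflexive (trans (*-congʳ x≈0) (zeroˡ _))

  -- Let P be the supremum. If Pᵏ < xᵐ, `root-gap` leaves room for some r < 1 such that P / r still
  -- belongs to the set, although it exceeds P.
  x^m≤pow^k : ∀ {x a} m k → 0# < x → 0# ≤ a → 1 ℕ.≤ k → Below x a m k → x ^ m ≤ pow x a ^ k
  x^m≤pow^k {x} {a} m k 0<x 0≤a 1≤k below = ≤-stable λ x^m≰P^k →
    let r , 0<r , r<1 , gap = root-gap k 1≤k (^-pos k 0<P) (≰⇒> x^m≰P^k)
        r≉0 = >⇒≉ 0<r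
        0<y = *-pos 0<P (⁻¹-pos 0<r)
    in <⇒≱ r<1 (*-cancelˡ-≤ 0<y (begin
      P ÷ r * 1#  ≈⟨ *-identityʳ _ ⟩
      P ÷ r       ≤⟨ pow-upper (<⇒≤ 0<x) (<⇒≤ 0<y , m , k , 1≤k ,
                       *-cancelʳ-≤ (^-pos k 0<r) (begin
                         (P ÷ r) ^ k * r ^ k  ≈⟨ ^-distrib-* _ r k ⟨
                         (P ÷ r * r) ^ k      ≈⟨ ^-congˡ k (x÷y*y P r≉0) ⟩
                         P ^ k                ≤⟨ gap ⟩
                         x ^ m * r ^ k        ∎) , below) ⟩
      P           ≈⟨ x÷y*y P r≉0 ⟨
      P ÷ r * r   ∎))
    where
    P : ℝ
    P = pow x a
    0<P : 0# < P
    0<P = pow-pos 0<x 0≤a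

  -- The dual argument: if xᵐ < Pᵏ, some P r with r < 1 would still bound the whole set. The last
  -- hypothesis says x ^ (m′ / k′) ≤ x ^ (m / k) for all admissible m′ / k′, with the roots cleared.
  pow^k≤x^m : ∀ {x a} m k → 0# < x → 0# ≤ a → 1 ℕ.≤ k →
    (∀ m′ k′ → Below x a m′ k′ → x ^ (m′ ℕ.* k) ≤ x ^ (m ℕ.* k′)) → pow x a ^ k ≤ x ^ m
  pow^k≤x^m {x} {a} m k 0<x 0≤a 1≤k above = ≤-stable λ P^k≰x^m →
    let r , 0<r , r<1 , gap = root-gap k 1≤k (^-pos m 0<x) (≰⇒> P^k≰x^m)
        0≤Pr = <⇒≤ (*-pos 0<P 0<r)
    in <⇒≱ r<1 (*-cancelˡ-≤ 0<P (begin
      P * 1#  ≈⟨ *-identityʳ P ⟩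
      P       ≤⟨ pow-least (<⇒≤ 0<x) 0≤a (λ
                   { w (0≤w , m′ , k′ , 1≤k′ , w^k′≤x^m′ , below) →
                     ^-cancel-≤ k 1≤k 0≤Pr (^-cancel-≤ k′ 1≤k′ (^-nonNeg k 0≤Pr) (begin
                       (w ^ k) ^ k′        ≈⟨ ^-swap w k k′ ⟩
                       (w ^ k′) ^ k        ≤⟨ ^-mono-≤ k (^-nonNeg k′ 0≤w) w^k′≤x^m′ ⟩
                       (x ^ m′) ^ k        ≈⟨ ^-assocʳ x m′ k ⟩
                       x ^ (m′ ℕ.* k)      ≤⟨ above m′ k′ below ⟩
                       x ^ (m ℕ.* k′)      ≈⟨ ^-assocʳ x m k′ ⟨
                       (x ^ m) ^ k′        ≤⟨ ^-mono-≤ k′ (^-nonNeg m (<⇒≤ 0<x)) gap ⟩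
                       (P ^ k * r ^ k) ^ k′  ≈⟨ ^-congˡ k′ (^-distrib-* P r k) ⟨
                       ((P * r) ^ k) ^ k′  ∎)) }) ⟩
      P * r   ∎))
    where
    P : ℝ
    P = pow x a
    0<P : 0# < P
    0<P = pow-pos 0<x 0≤a

  -- Comparing with the powers x ^ (m / k) only at m / k ≠ a still determines
  -- P = x ^ a, and spares the sum rule below an exact rational splitting.
  record IsPow (x a P : ℝ) : Set where
    field
      1≤P   : 1# ≤ P
      lower : ∀ m k → 1 ℕ.≤ k → fromℕ m < fromℕ k * a → x ^ m ≤ P ^ k
      upper : ∀ m k → 1 ℕ.≤ k → fromℕ k * a < fromℕ m → P ^ k ≤ x ^ m

  private
    cross-≤ : ∀ {a} m k m′ k′ → fromℕ m ≤ fromℕ k * a → fromℕ k′ * a ≤ fromℕ m′ →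
      m ℕ.* k′ ℕ.≤ m′ ℕ.* k
    cross-≤ {a} m k m′ k′ m≤ka k′a≤m′ = fromℕ-cancel-≤ {m ℕ.* k′} {m′ ℕ.* k} (begin
      fromℕ (m ℕ.* k′)           ≈⟨ fromℕ-* m k′ ⟩
      fromℕ m * fromℕ k′         ≤⟨ *-monoˡ-≤ (fromℕ-nonNeg k′) m≤ka ⟩
      fromℕ k * a * fromℕ k′
        ≈⟨ solve 3 (λ k a l → k :* a :* l := l :* a :* k) refl (fromℕ k) a (fromℕ k′) ⟩
      fromℕ k′ * a * fromℕ k     ≤⟨ *-monoˡ-≤ (fromℕ-nonNeg k) k′a≤m′ ⟩
      fromℕ m′ * fromℕ k         ≈⟨ fromℕ-* m′ k ⟨
      fromℕ (m′ ℕ.* k)           ∎)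

  isPow-pow : ∀ {x a} → 1# ≤ x → 0# ≤ a → IsPow x a (pow x a)
  isPow-pow {x} {a} 1≤x 0≤a = record
    { 1≤P   = 1≤pow 1≤x 0≤a
    ; lower = λ m k 1≤k m<ka → x^m≤pow^k m k 0<x 0≤a 1≤k (inj₁ (1≤x , <⇒≤ m<ka))
    ; upper = λ m k 1≤k ka<m → pow^k≤x^m m k 0<x 0≤a 1≤k λ
        { m′ k′ (inj₁ (_ , m′≤k′a)) → ^-monoʳ-≤ 1≤x (cross-≤ m′ k′ m k m′≤k′a (<⇒≤ ka<m))
        ; m′ k′ (inj₂ (x≤1 , _))    → x≈1⇒x^m≤x^n (m′ ℕ.* k) (m ℕ.* k′) 1≤x x≤1
        }
    }
    where
    0<x : 0# < x
    0<x = 1≤x⇒0<x 1≤x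

  private
    ^-⁻¹-antitone : ∀ {x y} m k → 0# < x → 0# < y → x ^ m ≤ y ^ k → (y ⁻¹) ^ k ≤ (x ⁻¹) ^ m
    ^-⁻¹-antitone {x} {y} m k 0<x 0<y x^m≤y^k =
      *-cancelʳ-≤ (^-pos m 0<x) (*-cancelʳ-≤ (^-pos k 0<y) (begin
        (y ⁻¹) ^ k * x ^ m * y ^ k
          ≈⟨ solve 3 (λ u v w → u :* v :* w := u :* w :* v) refl _ _ _ ⟩
        (y ⁻¹) ^ k * y ^ k * x ^ m   ≈⟨ *-congʳ (^-⁻¹ k (>⇒≉ 0<y)) ⟩
        1# * x ^ m                   ≤⟨ *-monoʳ-≤ 0≤1 x^m≤y^k ⟩
        1# * y ^ k                   ≈⟨ *-congʳ (^-⁻¹ m (>⇒≉ 0<x)) ⟨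
        (x ⁻¹) ^ m * x ^ m * y ^ k   ∎))

  -- Reciprocals reverse the order, so the upper estimates for `pow x a` become the lower ones for
  -- its inverse and conversely. This is the bridge from bases at most 1 to bases at least 1.
  isPow-pow⁻¹ : ∀ {x a} → 0# < x → x ≤ 1# → 0# ≤ a → IsPow (x ⁻¹) a (pow x a ⁻¹)
  isPow-pow⁻¹ {x} {a} 0<x x≤1 0≤a = record
    { 1≤P   = x≤1⇒1≤x⁻¹ 0<P (pow-≤1 (<⇒≤ 0<x) x≤1 0≤a)
    ; lower = λ m k 1≤k m<ka → ^-⁻¹-antitone k m 0<P 0<x (pow^k≤x^m m k 0<x 0≤a 1≤k λ
        { m′ k′ (inj₁ (1≤x , _))    → x≈1⇒x^m≤x^n (m′ ℕ.* k) (m ℕ.* k′) 1≤x x≤1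
        ; m′ k′ (inj₂ (_ , k′a≤m′)) →
            ^-antitoneʳ-≤ (<⇒≤ 0<x) x≤1 (cross-≤ m k m′ k′ (<⇒≤ m<ka) k′a≤m′)
        })
    ; upper = λ m k 1≤k ka<m →
        ^-⁻¹-antitone m k 0<x 0<P (x^m≤pow^k m k 0<x 0≤a 1≤k (inj₂ (x≤1 , <⇒≤ ka<m)))
    }
    where
    0<P : 0# < pow x a
    0<P = pow-pos 0<x 0≤a

  -- Here i is one less than the floor of k a, because `lower` demands a strict inequality; this is
  -- why the window has width 2. If the floor is 0, then i = 0 and the lower estimate comes from 1 ≤
  -- P instead.
  isPow-approx : ∀ {x a P} k → 1# ≤ x → 0# ≤ a → IsPow x a P → 1 ℕ.≤ k →
    ¬ ¬ (∃[ i ] (x ^ i ≤ P ^ k × P ^ k ≤ x ^ (2 ℕ.+ i) ×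
                 fromℕ i ≤ fromℕ k * a × fromℕ k * a < fromℕ (2 ℕ.+ i)))
  isPow-approx {x} {a} {P} k 1≤x 0≤a isP 1≤k none =
    floor (fromℕ k * a) (*-nonNeg (fromℕ-nonNeg k) 0≤a) λ
      { (zero , 0≤ka , ka<1) → none (0 , 1≤x^n k 1≤P ,
          ≤-trans (upper 1 k 1≤k ka<1) (^-monoʳ-≤ {m = 1} {2} 1≤x (ℕ.s≤s ℕ.z≤n)) , 0≤ka ,
          <-≤-trans ka<1 (<⇒≤ (n<1+n 1)))
      ; (suc i , 1+i≤ka , ka<2+i) → none (i , lower i k 1≤k (<-≤-trans (n<1+n i) 1+i≤ka) ,
          upper (2 ℕ.+ i) k 1≤k ka<2+i , ≤-trans (<⇒≤ (n<1+n i)) 1+i≤ka , ka<2+i)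
      }
    where open IsPow isP

  private
    -- The window of `isPow-approx` has width 2, so Pᵏ ≤ x² Qᵏ for every k ≥ 1. The factor x² does
    -- not depend on k, and `bounded-ratio` removes it.
    isPow-≤ : ∀ {x a P Q} → 1# ≤ x → 0# ≤ a → IsPow x a P → IsPow x a Q → P ≤ Q
    isPow-≤ {x} {a} {P} {Q} 1≤x 0≤a isP isQ =
      bounded-ratio {C = x * x} (≤-trans 0≤1 (IsPow.1≤P isP)) (1≤x⇒0<x (IsPow.1≤P isQ)) λ n →
        let k = suc n in
        ≤-stable λ ≰ → isPow-approx k 1≤x 0≤a isQ (ℕ.s≤s ℕ.z≤n)
          λ (i , x^i≤Q^k , _ , _ , ka<2+i) → ≰ (begin
            P ^ k            ≤⟨ IsPow.upper isP (2 ℕ.+ i) k (ℕ.s≤s ℕ.z≤n) ka<2+i ⟩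
            x * (x * x ^ i)  ≈⟨ *-assoc x x _ ⟨
            x * x * x ^ i    ≤⟨ *-monoʳ-≤ (square-nonNeg x) x^i≤Q^k ⟩
            x * x * Q ^ k    ∎)

  isPow-unique : ∀ {x a P} → 1# ≤ x → 0# ≤ a → IsPow x a P → pow x a ≈ P
  isPow-unique 1≤x 0≤a isP = ≤-antisym
    (isPow-≤ 1≤x 0≤a (isPow-pow 1≤x 0≤a) isP)
    (isPow-≤ 1≤x 0≤a isP (isPow-pow 1≤x 0≤a))

  1≤x*y : ∀ {x y} → 1# ≤ x → 1# ≤ y → 1# ≤ x * y
  1≤x*y {x} {y} 1≤x 1≤y = begin
    1#       ≈⟨ *-identityʳ 1# ⟨
    1# * 1#  ≤⟨ *-mono-≤ 0≤1 0≤1 1≤x 1≤y ⟩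
    x * y    ∎

  isPow-* : ∀ {x y a P Q} → 1# ≤ x → 1# ≤ y → IsPow x a P → IsPow y a Q → IsPow (x * y) a (P * Q)
  isPow-* {x} {y} {a} {P} {Q} 1≤x 1≤y isP isQ = record
    { 1≤P   = 1≤x*y P.1≤P Q.1≤P
    ; lower = λ m k 1≤k m<ka → begin
        (x * y) ^ m    ≈⟨ ^-distrib-* x y m ⟩
        x ^ m * y ^ m  ≤⟨ *-mono-≤ (^-nonNeg m (≤-trans 0≤1 1≤x)) (^-nonNeg m (≤-trans 0≤1 1≤y))
                            (P.lower m k 1≤k m<ka) (Q.lower m k 1≤k m<ka) ⟩
        P ^ k * Q ^ k  ≈⟨ ^-distrib-* P Q k ⟨
        (P * Q) ^ k    ∎
    ; upper = λ m k 1≤k ka<m → begin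
        (P * Q) ^ k    ≈⟨ ^-distrib-* P Q k ⟩
        P ^ k * Q ^ k  ≤⟨ *-mono-≤ (^-nonNeg k (≤-trans 0≤1 P.1≤P)) (^-nonNeg k (≤-trans 0≤1 Q.1≤P))
                            (P.upper m k 1≤k ka<m) (Q.upper m k 1≤k ka<m) ⟩
        x ^ m * y ^ m  ≈⟨ ^-distrib-* x y m ⟨
        (x * y) ^ m    ∎
    }
    where
    module P = IsPow isP
    module Q = IsPow isQ

  -- Scaling by N ≥ 4 / |k (a + b) − m| leaves room for the errors of the two approximations.
  isPow-+ : ∀ {x a b P Q} → 1# ≤ x → 0# ≤ a → 0# ≤ b →
    IsPow x a P → IsPow x b Q → IsPow x (a + b) (P * Q)
  isPow-+ {x} {a} {b} {P} {Q} 1≤x 0≤a 0≤b isP isQ = record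
    { 1≤P   = 1≤x*y (IsPow.1≤P isP) (IsPow.1≤P isQ)
    ; lower = lower
    ; upper = upper
    }
    where
    0≤x : 0# ≤ x
    0≤x = ≤-trans 0≤1 1≤x
    0≤P : 0# ≤ P
    0≤P = ≤-trans 0≤1 (IsPow.1≤P isP)
    0≤Q : 0# ≤ Q
    0≤Q = ≤-trans 0≤1 (IsPow.1≤P isQ)
    0≤PQ : 0# ≤ P * Q
    0≤PQ = *-nonNeg 0≤P 0≤Q

    scale : ∀ {u v} → u < v → ¬ ¬ (∃[ N ] (1 ℕ.≤ N × fromℕ N * u + fromℕ 4 ≤ fromℕ N * v))
    scale {u} {v} u<v none = archimedean (fromℕ 4 ÷ (v - u)) λ (n , 4÷[v-u]≤n) →
      none (suc n , ℕ.s≤s ℕ.z≤n , (begin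
        fromℕ (suc n) * u + fromℕ 4
          ≈⟨ +-congˡ (x÷y*y (fromℕ 4) (>⇒≉ 0<v-u)) ⟨
        fromℕ (suc n) * u + fromℕ 4 ÷ (v - u) * (v - u)
          ≤⟨ +-monoʳ-≤ _ (*-monoˡ-≤ (<⇒≤ 0<v-u) (≤-trans 4÷[v-u]≤n (<⇒≤ (n<1+n n)))) ⟩
        fromℕ (suc n) * u + fromℕ (suc n) * (v - u)
          ≈⟨ solve 3 (λ n u v → n :* u :+ n :* (v :- u) := n :* v) refl (fromℕ (suc n)) u v ⟩
        fromℕ (suc n) * v  ∎))
      where
      0<v-u : 0# < v - u
      0<v-u = x<y⇒0<y-x u<v

    split : ∀ N k → fromℕ N * (fromℕ k * (a + b)) ≈ fromℕ (N ℕ.* k) * a + fromℕ (N ℕ.* k) * b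
    split N k = trans
      (solve 4 (λ N k a b → N :* (k :* (a :+ b)) := N :* k :* a :+ N :* k :* b)
        refl (fromℕ N) (fromℕ k) a b)
      (sym (+-cong (*-congʳ (fromℕ-* N k)) (*-congʳ (fromℕ-* N k))))

    exponents : ∀ i j → fromℕ (2 ℕ.+ i) + fromℕ (2 ℕ.+ j) ≈ fromℕ (i ℕ.+ j) + fromℕ 4
    exponents i j = trans
      (solve 2 (λ i j → :1 :+ (:1 :+ i) :+ (:1 :+ (:1 :+ j))
          := i :+ j :+ (:1 :+ (:1 :+ (:1 :+ (:1 :+ :0)))))
        refl (fromℕ i) (fromℕ j))
      (+-congʳ (sym (fromℕ-+ i j)))

    *-power : ∀ N k → P ^ (N ℕ.* k) * Q ^ (N ℕ.* k) ≈ ((P * Q) ^ k) ^ N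
    *-power N k = trans (sym (^-distrib-* P Q (N ℕ.* k)))
      (trans (^-congʳ (P * Q) (ℕ.*-comm N k)) (sym (^-assocʳ (P * Q) k N)))

    lower : ∀ m k → 1 ℕ.≤ k → fromℕ m < fromℕ k * (a + b) → x ^ m ≤ (P * Q) ^ k
    lower m k 1≤k m<k[a+b] = ≤-stable λ ≰ → scale m<k[a+b] λ (N , 1≤N , gap) →
      let K   = N ℕ.* k
          1≤K = ℕ.*-mono-≤ 1≤N 1≤k
      in
      isPow-approx K 1≤x 0≤a isP 1≤K λ (i , x^i≤P^K , _ , _ , Ka<2+i) →
      isPow-approx K 1≤x 0≤b isQ 1≤K λ (j , x^j≤Q^K , _ , _ , Kb<2+j) →
      ≰ (^-cancel-≤ N 1≤N (^-nonNeg k 0≤PQ) (begin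
        (x ^ m) ^ N        ≈⟨ ^-assocʳ x m N ⟩
        x ^ (m ℕ.* N)      ≤⟨ ^-monoʳ-≤ 1≤x (fromℕ-cancel-≤ {m ℕ.* N} {i ℕ.+ j} (+-cancelʳ-≤ (fromℕ 4) (begin
          fromℕ (m ℕ.* N) + fromℕ 4        ≈⟨ +-congʳ (trans (fromℕ-* m N) (*-comm _ _)) ⟩
          fromℕ N * fromℕ m + fromℕ 4      ≤⟨ gap ⟩
          fromℕ N * (fromℕ k * (a + b))    ≈⟨ split N k ⟩
          fromℕ K * a + fromℕ K * b        ≤⟨ +-mono-≤ (<⇒≤ Ka<2+i) (<⇒≤ Kb<2+j) ⟩
          fromℕ (2 ℕ.+ i) + fromℕ (2 ℕ.+ j)  ≈⟨ exponents i j ⟩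
          fromℕ (i ℕ.+ j) + fromℕ 4        ∎))) ⟩
        x ^ (i ℕ.+ j)      ≈⟨ ^-homo-* x i j ⟩
        x ^ i * x ^ j      ≤⟨ *-mono-≤ (^-nonNeg i 0≤x) (^-nonNeg j 0≤x) x^i≤P^K x^j≤Q^K ⟩
        P ^ K * Q ^ K      ≈⟨ *-power N k ⟩
        ((P * Q) ^ k) ^ N  ∎))

    upper : ∀ m k → 1 ℕ.≤ k → fromℕ k * (a + b) < fromℕ m → (P * Q) ^ k ≤ x ^ m
    upper m k 1≤k k[a+b]<m = ≤-stable λ ≰ → scale k[a+b]<m λ (N , 1≤N , gap) →
      let K   = N ℕ.* k
          1≤K = ℕ.*-mono-≤ 1≤N 1≤k
      in
      isPow-approx K 1≤x 0≤a isP 1≤K λ (i , _ , P^K≤x^2+i , i≤Ka , _) →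
      isPow-approx K 1≤x 0≤b isQ 1≤K λ (j , _ , Q^K≤x^2+j , j≤Kb , _) →
      ≰ (^-cancel-≤ N 1≤N (^-nonNeg m 0≤x) (begin
        ((P * Q) ^ k) ^ N                ≈⟨ *-power N k ⟨
        P ^ K * Q ^ K                    ≤⟨ *-mono-≤ (^-nonNeg K 0≤P) (^-nonNeg K 0≤Q) P^K≤x^2+i Q^K≤x^2+j ⟩
        x ^ (2 ℕ.+ i) * x ^ (2 ℕ.+ j)    ≈⟨ ^-homo-* x (2 ℕ.+ i) (2 ℕ.+ j) ⟨
        x ^ (2 ℕ.+ i ℕ.+ (2 ℕ.+ j))      ≤⟨ ^-monoʳ-≤ 1≤x (fromℕ-cancel-≤ {2 ℕ.+ i ℕ.+ (2 ℕ.+ j)} {m ℕ.* N} (begin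
          fromℕ (2 ℕ.+ i ℕ.+ (2 ℕ.+ j))      ≈⟨ fromℕ-+ (2 ℕ.+ i) (2 ℕ.+ j) ⟩
          fromℕ (2 ℕ.+ i) + fromℕ (2 ℕ.+ j)  ≈⟨ exponents i j ⟩
          fromℕ (i ℕ.+ j) + fromℕ 4          ≈⟨ +-congʳ (fromℕ-+ i j) ⟩
          fromℕ i + fromℕ j + fromℕ 4        ≤⟨ +-monoˡ-≤ _ (+-mono-≤ i≤Ka j≤Kb) ⟩
          fromℕ K * a + fromℕ K * b + fromℕ 4  ≈⟨ +-congʳ (split N k) ⟨
          fromℕ N * (fromℕ k * (a + b)) + fromℕ 4  ≤⟨ gap ⟩
          fromℕ N * fromℕ m                  ≈⟨ fromℕ-* N m ⟨
          fromℕ (N ℕ.* m)                    ≈⟨ reflexive (≡.cong fromℕ (ℕ.*-comm N m)) ⟩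
          fromℕ (m ℕ.* N)                    ∎)) ⟩
        x ^ (m ℕ.* N)                    ≈⟨ ^-assocʳ x m N ⟨
        (x ^ m) ^ N                      ∎))

  -- Algebraic laws of real powers, Bernoulli and weighted AM-GM

  private
    pow-*-≥1 : ∀ {x y a} → 1# ≤ x → 1# ≤ y → 0# ≤ a → pow (x * y) a ≈ pow x a * pow y a
    pow-*-≥1 1≤x 1≤y 0≤a = isPow-unique (1≤x*y 1≤x 1≤y) 0≤a
      (isPow-* 1≤x 1≤y (isPow-pow 1≤x 0≤a) (isPow-pow 1≤y 0≤a))

    pow-+-≥1 : ∀ {x a b} → 1# ≤ x → 0# ≤ a → 0# ≤ b → pow x (a + b) ≈ pow x a * pow x b
    pow-+-≥1 1≤x 0≤a 0≤b = isPow-unique 1≤x (+-nonNeg 0≤a 0≤b)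
      (isPow-+ 1≤x 0≤a 0≤b (isPow-pow 1≤x 0≤a) (isPow-pow 1≤x 0≤b))

    pow-monoʳ-≥1 : ∀ {x a b} → 1# ≤ x → 0# ≤ a → a ≤ b → pow x a ≤ pow x b
    pow-monoʳ-≥1 {x} {a} {b} 1≤x 0≤a a≤b = begin
      pow x a                  ≈⟨ *-identityʳ _ ⟨
      pow x a * 1#             ≤⟨ *-monoʳ-≤ (pow-nonNeg (≤-trans 0≤1 1≤x) 0≤a) (1≤pow 1≤x 0≤b-a) ⟩
      pow x a * pow x (b - a)  ≈⟨ pow-+-≥1 1≤x 0≤a 0≤b-a ⟨
      pow x (a + (b - a))      ≈⟨ pow-congʳ (≤-trans 0≤1 1≤x) (+-nonNeg 0≤a 0≤b-a)
                                    (solve 2 (λ a b → a :+ (b :- a) := b) refl a b) ⟩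
      pow x b                  ∎
      where
      0≤b-a : 0# ≤ b - a
      0≤b-a = x≤y⇒0≤y-x a≤b

    pow-·-≥1 : ∀ {x a} m → 1# ≤ x → 0# ≤ a → pow x a ^ m ≈ pow x (fromℕ m * a)
    pow-·-≥1 {x} {a} zero    1≤x 0≤a = sym (pow-zeroʳ (≤-trans 0≤1 1≤x) (zeroˡ a))
    pow-·-≥1 {x} {a} (suc m) 1≤x 0≤a = begin-equality
      pow x a * pow x a ^ m            ≈⟨ *-congˡ (pow-·-≥1 m 1≤x 0≤a) ⟩
      pow x a * pow x (fromℕ m * a)    ≈⟨ pow-+-≥1 1≤x 0≤a 0≤ma ⟨
      pow x (a + fromℕ m * a)          ≈⟨ pow-congʳ (≤-trans 0≤1 1≤x) (+-nonNeg 0≤a 0≤ma)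
        (solve 2 (λ a m → a :+ m :* a := (:1 :+ m) :* a) refl a (fromℕ m)) ⟩
      pow x (fromℕ (suc m) * a)        ∎
      where
      0≤ma : 0# ≤ fromℕ m * a
      0≤ma = *-nonNeg (fromℕ-nonNeg m) 0≤a

    -- Natural powers of x ^ a are already known to be x ^ (m a), so the comparisons required by
    -- `IsPow` reduce to monotonicity in the exponent.
    pow-pow-≥1 : ∀ {x a b} → 1# ≤ x → 0# ≤ a → 0# ≤ b → pow (pow x a) b ≈ pow x (a * b)
    pow-pow-≥1 {x} {a} {b} 1≤x 0≤a 0≤b = isPow-unique (1≤pow 1≤x 0≤a) 0≤b (record
      { 1≤P   = 1≤pow 1≤x 0≤ab
      ; lower = λ m k _ m<kb → begin
          pow x a ^ m              ≈⟨ pow-·-≥1 m 1≤x 0≤a ⟩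
          pow x (fromℕ m * a)      ≤⟨ pow-monoʳ-≥1 1≤x (*-nonNeg (fromℕ-nonNeg m) 0≤a) (begin
            fromℕ m * a        ≤⟨ *-monoˡ-≤ 0≤a (<⇒≤ m<kb) ⟩
            fromℕ k * b * a    ≈⟨ rearrange k ⟩
            fromℕ k * (a * b)  ∎) ⟩
          pow x (fromℕ k * (a * b))  ≈⟨ pow-·-≥1 k 1≤x 0≤ab ⟨
          pow x (a * b) ^ k        ∎
      ; upper = λ m k _ kb<m → begin
          pow x (a * b) ^ k        ≈⟨ pow-·-≥1 k 1≤x 0≤ab ⟩
          pow x (fromℕ k * (a * b))  ≤⟨ pow-monoʳ-≥1 1≤x (*-nonNeg (fromℕ-nonNeg k) 0≤ab) (begin
            fromℕ k * (a * b)  ≈⟨ rearrange k ⟨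
            fromℕ k * b * a    ≤⟨ *-monoˡ-≤ 0≤a (<⇒≤ kb<m) ⟩
            fromℕ m * a        ∎) ⟩
          pow x (fromℕ m * a)      ≈⟨ pow-·-≥1 m 1≤x 0≤a ⟨
          pow x a ^ m              ∎
      })
      where
      0≤ab : 0# ≤ a * b
      0≤ab = *-nonNeg 0≤a 0≤b
      rearrange : ∀ k → fromℕ k * b * a ≈ fromℕ k * (a * b)
      rearrange k = solve 3 (λ k a b → k :* b :* a := k :* (a :* b)) refl (fromℕ k) a b

    pow-inverse-≤1 : ∀ {x a} → 0# < x → x ≤ 1# → 0# ≤ a → pow x a * pow (x ⁻¹) a ≈ 1#
    pow-inverse-≤1 {x} {a} 0<x x≤1 0≤a = begin-equality
      pow x a * pow (x ⁻¹) a  ≈⟨ *-congˡ (isPow-unique (x≤1⇒1≤x⁻¹ 0<x x≤1) 0≤a (isPow-pow⁻¹ 0<x x≤1 0≤a)) ⟩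
      pow x a * pow x a ⁻¹    ≈⟨ ⁻¹-inverseʳ _ (>⇒≉ (pow-pos 0<x 0≤a)) ⟩
      1#                      ∎

  pow-inverse : ∀ {x a} → 0# < x → 0# ≤ a → pow x a * pow (x ⁻¹) a ≈ 1#
  pow-inverse {x} {a} 0<x 0≤a with ≤-total 1# x
  ... | inj₂ x≤1 = pow-inverse-≤1 0<x x≤1 0≤a
  ... | inj₁ 1≤x = begin-equality
    pow x a * pow (x ⁻¹) a          ≈⟨ *-comm _ _ ⟩
    pow (x ⁻¹) a * pow x a
      ≈⟨ *-congˡ (pow-congˡ 0≤a (<⇒≤ 0<x) (sym (⁻¹-involutive (>⇒≉ 0<x)))) ⟩
    pow (x ⁻¹) a * pow (x ⁻¹ ⁻¹) a  ≈⟨ pow-inverse-≤1 (⁻¹-pos 0<x) (1≤x⇒x⁻¹≤1 1≤x) 0≤a ⟩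
    1#                              ∎

  private
    -- Carries a law from bases at least 1 to smaller bases: both of its sides turn out to be
    -- inverse to the same power of a reciprocal.
    inverse-unique : ∀ {u u′ v} → u * v ≈ 1# → u′ * v ≈ 1# → u ≈ u′
    inverse-unique uv≈1 u′v≈1 = trans (sym (⁻¹-unique uv≈1)) (⁻¹-unique u′v≈1)

    products-inverse : ∀ {u u′ v v′} → u * u′ ≈ 1# → v * v′ ≈ 1# → u * v * (u′ * v′) ≈ 1#
    products-inverse uu′≈1 vv′≈1 = trans
      (solve 4 (λ u v w z → u :* v :* (w :* z) := u :* w :* (v :* z)) refl _ _ _ _)
      (trans (*-cong uu′≈1 vv′≈1) (*-identityʳ 1#))

    ⁻¹-distrib-* : ∀ {x y} → 0# < x → 0# < y → (x * y) ⁻¹ ≈ x ⁻¹ * y ⁻¹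
    ⁻¹-distrib-* {x} {y} 0<x 0<y = ⁻¹-unique
      (products-inverse (⁻¹-inverseˡ x (>⇒≉ 0<x)) (⁻¹-inverseˡ y (>⇒≉ 0<y)))

    cancel-factor : ∀ {w u v} → u * v ≈ 1# → w * u * v ≈ w
    cancel-factor {w} uv≈1 = trans (*-assoc w _ _) (trans (*-congˡ uv≈1) (*-identityʳ w))

    pow-*-≤1 : ∀ {x y a} → 0# < x → x ≤ 1# → 0# < y → y ≤ 1# → 0# ≤ a →
      pow (x * y) a ≈ pow x a * pow y a
    pow-*-≤1 {x} {y} {a} 0<x x≤1 0<y y≤1 0≤a = inverse-unique (pow-inverse 0<xy 0≤a) (begin-equality
      pow x a * pow y a * pow ((x * y) ⁻¹) a
        ≈⟨ *-congˡ (pow-congˡ 0≤a (<⇒≤ (⁻¹-pos 0<xy)) (⁻¹-distrib-* 0<x 0<y)) ⟩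
      pow x a * pow y a * pow (x ⁻¹ * y ⁻¹) a
        ≈⟨ *-congˡ (pow-*-≥1 (x≤1⇒1≤x⁻¹ 0<x x≤1) (x≤1⇒1≤x⁻¹ 0<y y≤1) 0≤a) ⟩
      pow x a * pow y a * (pow (x ⁻¹) a * pow (y ⁻¹) a)
        ≈⟨ products-inverse (pow-inverse 0<x 0≤a) (pow-inverse 0<y 0≤a) ⟩
      1#  ∎)
      where
      0<xy : 0# < x * y
      0<xy = *-pos 0<x 0<y

    -- Either x = xy · 1/y or 1/y = x · 1/(xy) has all factors at least 1.
    pow-*-mixed : ∀ {x y a} → 1# ≤ x → 0# < y → y ≤ 1# → 0# ≤ a →
      pow (x * y) a ≈ pow x a * pow y a
    pow-*-mixed {x} {y} {a} 1≤x 0<y y≤1 0≤a with ≤-total 1# (x * y)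
    ... | inj₁ 1≤xy = begin-equality
      pow (x * y) a                              ≈⟨ cancel-factor y⁻¹y ⟨
      pow (x * y) a * pow (y ⁻¹) a * pow y a     ≈⟨ *-congʳ (pow-*-≥1 1≤xy (x≤1⇒1≤x⁻¹ 0<y y≤1) 0≤a) ⟨
      pow (x * y * y ⁻¹) a * pow y a
        ≈⟨ *-congʳ (pow-congˡ 0≤a (<⇒≤ (*-pos (*-pos 0<x 0<y) (⁻¹-pos 0<y)))
                     (cancel-factor (⁻¹-inverseʳ y (>⇒≉ 0<y)))) ⟩
      pow x a * pow y a                          ∎
      where
      0<x : 0# < x
      0<x = 1≤x⇒0<x 1≤x
      y⁻¹y : pow (y ⁻¹) a * pow y a ≈ 1#
      y⁻¹y = trans (*-comm _ _) (pow-inverse 0<y 0≤a)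
    ... | inj₂ xy≤1 = inverse-unique (pow-inverse 0<xy 0≤a) (begin-equality
      pow x a * pow y a * pow ((x * y) ⁻¹) a
        ≈⟨ solve 3 (λ u v w → u :* v :* w := v :* (u :* w)) refl _ _ _ ⟩
      pow y a * (pow x a * pow ((x * y) ⁻¹) a)   ≈⟨ *-congˡ (pow-*-≥1 1≤x (x≤1⇒1≤x⁻¹ 0<xy xy≤1) 0≤a) ⟨
      pow y a * pow (x * (x * y) ⁻¹) a
        ≈⟨ *-congˡ (pow-congˡ 0≤a (<⇒≤ (*-pos 0<x (⁻¹-pos 0<xy))) (sym (⁻¹-unique (begin-equality
             x * (x * y) ⁻¹ * y  ≈⟨ solve 3 (λ x y w → x :* w :* y := x :* y :* w) refl x y _ ⟩
             x * y * (x * y) ⁻¹  ≈⟨ ⁻¹-inverseʳ _ (>⇒≉ 0<xy) ⟩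
             1#                  ∎)))) ⟩
      pow y a * pow (y ⁻¹) a                     ≈⟨ pow-inverse 0<y 0≤a ⟩
      1#                                         ∎)
      where
      0<x : 0# < x
      0<x = 1≤x⇒0<x 1≤x
      0<xy : 0# < x * y
      0<xy = *-pos 0<x 0<y

    pow-*-pos : ∀ {x y a} → 0# < x → 0# < y → 0# ≤ a → pow (x * y) a ≈ pow x a * pow y a
    pow-*-pos {x} {y} {a} 0<x 0<y 0≤a with ≤-total 1# x | ≤-total 1# y
    ... | inj₁ 1≤x | inj₁ 1≤y = pow-*-≥1 1≤x 1≤y 0≤a
    ... | inj₁ 1≤x | inj₂ y≤1 = pow-*-mixed 1≤x 0<y y≤1 0≤a
    ... | inj₂ x≤1 | inj₂ y≤1 = pow-*-≤1 0<x x≤1 0<y y≤1 0≤a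
    ... | inj₂ x≤1 | inj₁ 1≤y = begin-equality
      pow (x * y) a      ≈⟨ pow-congˡ 0≤a (<⇒≤ (*-pos 0<x 0<y)) (*-comm x y) ⟩
      pow (y * x) a      ≈⟨ pow-*-mixed 1≤y 0<x x≤1 0≤a ⟩
      pow y a * pow x a  ≈⟨ *-comm _ _ ⟩
      pow x a * pow y a  ∎

  pow-* : ∀ {x y a} → 0# ≤ x → 0# ≤ y → 0# ≤ a → pow (x * y) a ≈ pow x a * pow y a
  pow-* {x} {y} {a} 0≤x 0≤y 0≤a with pos-or-zero 0≤a
  -- The exponent 0 is separated before the bases, because 0 ^ a is 1 for a = 0 and 0 for a > 0.
  ... | inj₁ a≈0 = trans (pow-zeroʳ (*-nonNeg 0≤x 0≤y) a≈0)
    (sym (trans (*-cong (pow-zeroʳ 0≤x a≈0) (pow-zeroʳ 0≤y a≈0)) (*-identityʳ 1#)))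
  ... | inj₂ 0<a with pos-or-zero 0≤x | pos-or-zero 0≤y
  ...   | inj₁ x≈0 | _        = trans (pow-zeroˡ (trans (*-congʳ x≈0) (zeroˡ y)) 0<a)
    (sym (trans (*-congʳ (pow-zeroˡ x≈0 0<a)) (zeroˡ _)))
  ...   | inj₂ 0<x | inj₁ y≈0 = trans (pow-zeroˡ (trans (*-congˡ y≈0) (zeroʳ x)) 0<a)
    (sym (trans (*-congˡ (pow-zeroˡ y≈0 0<a)) (zeroʳ _)))
  ...   | inj₂ 0<x | inj₂ 0<y = pow-*-pos 0<x 0<y 0≤a

  private
    pow-+-pos : ∀ {x a b} → 0# < x → 0# ≤ a → 0# ≤ b → pow x (a + b) ≈ pow x a * pow x b
    pow-+-pos {x} {a} {b} 0<x 0≤a 0≤b with ≤-total 1# x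
    ... | inj₁ 1≤x = pow-+-≥1 1≤x 0≤a 0≤b
    ... | inj₂ x≤1 = inverse-unique (pow-inverse 0<x (+-nonNeg 0≤a 0≤b)) (begin-equality
      pow x a * pow x b * pow (x ⁻¹) (a + b)
        ≈⟨ *-congˡ (pow-+-≥1 (x≤1⇒1≤x⁻¹ 0<x x≤1) 0≤a 0≤b) ⟩
      pow x a * pow x b * (pow (x ⁻¹) a * pow (x ⁻¹) b)
        ≈⟨ products-inverse (pow-inverse 0<x 0≤a) (pow-inverse 0<x 0≤b) ⟩
      1#  ∎)

  pow-+ : ∀ {x a b} → 0# ≤ x → 0# ≤ a → 0# ≤ b → pow x (a + b) ≈ pow x a * pow x b
  pow-+ {x} {a} {b} 0≤x 0≤a 0≤b with pos-or-zero 0≤x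
  ... | inj₂ 0<x = pow-+-pos 0<x 0≤a 0≤b
  ... | inj₁ x≈0 with pos-or-zero 0≤a
  ...   | inj₁ a≈0 = begin-equality
    pow x (a + b)      ≈⟨ pow-congʳ 0≤x (+-nonNeg 0≤a 0≤b) (trans (+-congʳ a≈0) (+-identityˡ b)) ⟩
    pow x b            ≈⟨ *-identityˡ _ ⟨
    1# * pow x b       ≈⟨ *-congʳ (pow-zeroʳ 0≤x a≈0) ⟨
    pow x a * pow x b  ∎
  ...   | inj₂ 0<a = trans (pow-zeroˡ x≈0 (+-pos-nonNeg 0<a 0≤b))
    (sym (trans (*-congʳ (pow-zeroˡ x≈0 0<a)) (zeroˡ _)))

  pow-oneˡ : ∀ {a} → 0# ≤ a → pow 1# a ≈ 1#
  pow-oneˡ 0≤a = ≤-antisym (pow-≤1 0≤1 ≤-refl 0≤a) (1≤pow ≤-refl 0≤a)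

  private
    pow-pow-pos : ∀ {x a b} → 0# < x → 0# ≤ a → 0# ≤ b → pow (pow x a) b ≈ pow x (a * b)
    pow-pow-pos {x} {a} {b} 0<x 0≤a 0≤b with ≤-total 1# x
    ... | inj₁ 1≤x = pow-pow-≥1 1≤x 0≤a 0≤b
    ... | inj₂ x≤1 = inverse-unique (begin-equality
      pow (pow x a) b * pow (x ⁻¹) (a * b)
        ≈⟨ *-congˡ (pow-pow-≥1 (x≤1⇒1≤x⁻¹ 0<x x≤1) 0≤a 0≤b) ⟨
      pow (pow x a) b * pow (pow (x ⁻¹) a) b
        ≈⟨ pow-* 0≤P 0≤P′ 0≤b ⟨
      pow (pow x a * pow (x ⁻¹) a) b
        ≈⟨ pow-congˡ 0≤b (*-nonNeg 0≤P 0≤P′) (pow-inverse 0<x 0≤a) ⟩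
      pow 1# b
        ≈⟨ pow-oneˡ 0≤b ⟩
      1#  ∎) (pow-inverse 0<x (*-nonNeg 0≤a 0≤b))
      where
      0≤P : 0# ≤ pow x a
      0≤P = pow-nonNeg (<⇒≤ 0<x) 0≤a
      0≤P′ : 0# ≤ pow (x ⁻¹) a
      0≤P′ = pow-nonNeg (<⇒≤ (⁻¹-pos 0<x)) 0≤a

  pow-pow : ∀ {x a b} → 0# ≤ x → 0# ≤ a → 0# ≤ b → pow (pow x a) b ≈ pow x (a * b)
  pow-pow {x} {a} {b} 0≤x 0≤a 0≤b with pos-or-zero 0≤x | pos-or-zero 0≤a | pos-or-zero 0≤b
  ... | inj₂ 0<x | _        | _        = pow-pow-pos 0<x 0≤a 0≤b
  ... | inj₁ x≈0 | inj₁ a≈0 | _        = begin-equality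
    pow (pow x a) b  ≈⟨ pow-congˡ 0≤b (pow-nonNeg 0≤x 0≤a) (pow-zeroʳ 0≤x a≈0) ⟩
    pow 1# b         ≈⟨ pow-oneˡ 0≤b ⟩
    1#               ≈⟨ pow-zeroʳ 0≤x (trans (*-congʳ a≈0) (zeroˡ b)) ⟨
    pow x (a * b)    ∎
  ... | inj₁ x≈0 | inj₂ 0<a | inj₁ b≈0 = trans (pow-zeroʳ (pow-nonNeg 0≤x 0≤a) b≈0)
    (sym (pow-zeroʳ 0≤x (trans (*-congˡ b≈0) (zeroʳ a))))
  ... | inj₁ x≈0 | inj₂ 0<a | inj₂ 0<b = trans (pow-zeroˡ (pow-zeroˡ x≈0 0<a) 0<b)
    (sym (pow-zeroˡ x≈0 (*-pos 0<a 0<b)))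

  -- Write x = (x / y) y; by multiplicativity only the factor (x / y) ^ a has to be estimated, and
  -- its base is at most 1.
  pow-mono-≤ : ∀ {x y a} → 0# ≤ x → x ≤ y → 0# ≤ a → pow x a ≤ pow y a
  pow-mono-≤ {x} {y} {a} 0≤x x≤y 0≤a with pos-or-zero (≤-trans 0≤x x≤y)
  ... | inj₁ y≈0 = ≤-reflexive (pow-congˡ 0≤a 0≤x (≤-antisym x≤y (≤-respˡ-≈ (sym y≈0) 0≤x)))
  ... | inj₂ 0<y = begin
    pow x a                    ≈⟨ pow-congˡ 0≤a 0≤x (sym (x÷y*y x (>⇒≉ 0<y))) ⟩
    pow (x ÷ y * y) a          ≈⟨ pow-* 0≤x÷y (<⇒≤ 0<y) 0≤a ⟩
    pow (x ÷ y) a * pow y a    ≤⟨ *-monoˡ-≤ (pow-nonNeg (<⇒≤ 0<y) 0≤a) (pow-≤1 0≤x÷y x÷y≤1 0≤a) ⟩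
    1# * pow y a               ≈⟨ *-identityˡ _ ⟩
    pow y a                    ∎
    where
    0≤x÷y : 0# ≤ x ÷ y
    0≤x÷y = ÷-nonNeg 0≤x 0<y
    x÷y≤1 : x ÷ y ≤ 1#
    x÷y≤1 = *-cancelʳ-≤ 0<y (begin
      x ÷ y * y  ≈⟨ x÷y*y x (>⇒≉ 0<y) ⟩
      x          ≤⟨ x≤y ⟩
      y          ≈⟨ *-identityˡ y ⟨
      1# * y     ∎)

  pow-oneʳ : ∀ {x} → 0# ≤ x → pow x 1# ≈ x
  pow-oneʳ {x} 0≤x = ≤-antisym (pow-least 0≤x 0≤1 upper) (pow-upper 0≤x x∈S)
    where
    x∈S : PowSet x 1# x
    x∈S with ≤-total 1# x
    ... | inj₁ 1≤x = 0≤x , 1 , 1 , ℕ.s≤s ℕ.z≤n , ≤-refl , inj₁ (1≤x , ≤-reflexive (sym (*-identityʳ _)))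
    ... | inj₂ x≤1 = 0≤x , 1 , 1 , ℕ.s≤s ℕ.z≤n , ≤-refl , inj₂ (x≤1 , ≤-reflexive (*-identityʳ _))
    upper : UpperBound (PowSet x 1#) x
    upper y (0≤y , m , k , 1≤k , yᵏ≤xᵐ , inj₁ (1≤x , m≤k)) = ^-cancel-≤ k 1≤k 0≤x
      (≤-trans yᵏ≤xᵐ (^-monoʳ-≤ 1≤x (fromℕ-cancel-≤ {m} {k} (≤-respʳ-≈ (*-identityʳ _) m≤k))))
    upper y (0≤y , m , k , 1≤k , yᵏ≤xᵐ , inj₂ (x≤1 , k≤m)) = ^-cancel-≤ k 1≤k 0≤x
      (≤-trans yᵏ≤xᵐ (^-antitoneʳ-≤ 0≤x x≤1 (fromℕ-cancel-≤ {k} {m} (≤-respˡ-≈ (*-identityʳ _) k≤m))))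

  pow-pow-inverse : ∀ {x a b} → 0# ≤ x → 0# ≤ a → 0# ≤ b → a * b ≈ 1# → pow (pow x a) b ≈ x
  pow-pow-inverse 0≤x 0≤a 0≤b ab≈1 = trans (pow-pow 0≤x 0≤a 0≤b)
    (trans (pow-congʳ 0≤x (*-nonNeg 0≤a 0≤b) ab≈1) (pow-oneʳ 0≤x))

  -- Splits x as x ^ a times x ^ (1 - a), whose second factor is at most 1.
  x≤pow : ∀ {x a} → 0# ≤ x → x ≤ 1# → 0# ≤ a → a ≤ 1# → x ≤ pow x a
  x≤pow {x} {a} 0≤x x≤1 0≤a a≤1 = begin
    x                         ≈⟨ pow-oneʳ 0≤x ⟨
    pow x 1#                  ≈⟨ pow-congʳ 0≤x 0≤1 (solve 1 (λ a → :1 := a :+ (:1 :- a)) refl a) ⟩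
    pow x (a + (1# - a))      ≈⟨ pow-+ 0≤x 0≤a 0≤1-a ⟩
    pow x a * pow x (1# - a)  ≤⟨ *-monoʳ-≤ (pow-nonNeg 0≤x 0≤a) (pow-≤1 0≤x x≤1 0≤1-a) ⟩
    pow x a * 1#              ≈⟨ *-identityʳ _ ⟩
    pow x a                   ∎
    where
    0≤1-a : 0# ≤ 1# - a
    0≤1-a = x≤y⇒0≤y-x a≤1

  -- Weighted AM-GM for j ones and m copies of t, adding the ones successively.
  am-gm-ones : ∀ {t} m j A → 0# ≤ t → 0# ≤ A → 1 ℕ.≤ j ℕ.+ m →
    fromℕ (j ℕ.+ m) * A ≈ fromℕ j + fromℕ m * t → t ^ m ≤ A ^ (j ℕ.+ m)
  am-gm-ones {t} zero    j       A 0≤t 0≤A 1≤j+m mean = 1≤x^n (j ℕ.+ 0) (≤-reflexive (sym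
    (*-cancelʳ (>⇒≉ (fromℕ-pos 1≤j+m)) (begin-equality
      A * fromℕ (j ℕ.+ 0)   ≈⟨ *-comm _ _ ⟩
      fromℕ (j ℕ.+ 0) * A   ≈⟨ mean ⟩
      fromℕ j + 0# * t      ≈⟨ solve 2 (λ j t → j :+ :0 :* t := :1 :* (j :+ :0)) refl (fromℕ j) t ⟩
      1# * (fromℕ j + 0#)   ≈⟨ *-congˡ (fromℕ-+ j 0) ⟨
      1# * fromℕ (j ℕ.+ 0)  ∎))))
  am-gm-ones {t} (suc m) zero    A 0≤t 0≤A 1≤j+m mean = ≤-reflexive (^-congˡ (suc m) (sym
    (*-cancelʳ (>⇒≉ (fromℕ-pos 1≤j+m)) (begin-equality
      A * fromℕ (suc m)       ≈⟨ *-comm _ _ ⟩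
      fromℕ (suc m) * A       ≈⟨ mean ⟩
      0# + fromℕ (suc m) * t  ≈⟨ +-identityˡ _ ⟩
      fromℕ (suc m) * t       ≈⟨ *-comm _ _ ⟩
      t * fromℕ (suc m)       ∎))))
  am-gm-ones {t} m@(suc _) (suc j) A 0≤t 0≤A 1≤j+m mean = begin
    t ^ m      ≤⟨ am-gm-ones m j B 0≤t 0≤B 1≤n nB ⟩
    -- B is the mean without one of the ones, so (n + 1) A = 1 + n B. The tangent inequality at B
    -- then reads (1 + n B) Bⁿ ≤ Aⁿ⁺¹ + n Bⁿ⁺¹, where n Bⁿ⁺¹ cancels.
    B ^ n      ≤⟨ +-cancelʳ-≤ (fromℕ n * B ^ suc n) (begin
      B ^ n + fromℕ n * (B * B ^ n)
        ≈⟨ solve 3 (λ n b z → z :+ n :* (b :* z) := (:1 :+ n :* b) :* z) refl (fromℕ n) B (B ^ n) ⟩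
      (1# + fromℕ n * B) * B ^ n
        ≈⟨ *-congʳ (trans (+-congˡ nB) (trans (sym (+-assoc 1# _ _)) (sym mean))) ⟩
      fromℕ (suc n) * A * B ^ n
        ≈⟨ *-assoc _ A _ ⟩
      fromℕ (suc n) * (A * B ^ n)
        ≤⟨ tangent n 0≤A 0≤B ⟩
      A ^ suc n + fromℕ n * B ^ suc n  ∎) ⟩
    A ^ suc n  ∎
    where
    n : ℕ
    n = j ℕ.+ m
    1≤n : 1 ℕ.≤ n
    1≤n = ℕ.≤-trans (ℕ.s≤s ℕ.z≤n) (ℕ.m≤n+m m j)
    B : ℝ
    B = (fromℕ j + fromℕ m * t) ÷ fromℕ n
    0≤B : 0# ≤ B
    0≤B = ÷-nonNeg (+-nonNeg (fromℕ-nonNeg j) (*-nonNeg (fromℕ-nonNeg m) 0≤t)) (fromℕ-pos 1≤n)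
    nB : fromℕ n * B ≈ fromℕ j + fromℕ m * t
    nB = trans (*-comm _ _) (x÷y*y _ (>⇒≉ (fromℕ-pos 1≤n)))

  -- For m ≤ k, AM-GM with k - m ones and m copies of t gives y ≤ 1 + (m / k) (t - 1). Replacing m /
  -- k by `a` can only increase the right side: m / k lies below `a` when t ≥ 1 and above it when t
  -- ≤ 1.
  bernoulli : ∀ {t a} → 0# ≤ t → 0# ≤ a → a ≤ 1# → pow t a ≤ (1# - a) + a * t
  bernoulli {t} {a} 0≤t 0≤a a≤1 = pow-least 0≤t 0≤a λ
    { y (0≤y , m , k , 1≤k , yᵏ≤tᵐ , inj₁ (1≤t , m≤ka)) →
        *-cancelˡ-≤ (fromℕ-pos 1≤k) (begin
          fromℕ k * y
            ≤⟨ rational y m k 0≤y 1≤k yᵏ≤tᵐ (fromℕ-cancel-≤ (begin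
                 fromℕ m       ≤⟨ m≤ka ⟩
                 fromℕ k * a   ≤⟨ *-monoʳ-≤ (fromℕ-nonNeg k) a≤1 ⟩
                 fromℕ k * 1#  ≈⟨ *-identityʳ _ ⟩
                 fromℕ k       ∎)) ⟩
          fromℕ k + fromℕ m * (t - 1#)
            ≤⟨ +-monoʳ-≤ _ (*-monoˡ-≤ (x≤y⇒0≤y-x 1≤t) m≤ka) ⟩
          fromℕ k + fromℕ k * a * (t - 1#)
            ≈⟨ expand k ⟩
          fromℕ k * ((1# - a) + a * t)  ∎)
    ; y (0≤y , m , k , 1≤k , yᵏ≤tᵐ , inj₂ (t≤1 , ka≤m)) → *-cancelˡ-≤ (fromℕ-pos 1≤k) (begin
          fromℕ k * y
            ≤⟨ below-one y m k 0≤y 1≤k yᵏ≤tᵐ t≤1 ka≤m ⟩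
          fromℕ k + fromℕ k * a * (t - 1#)
            ≈⟨ expand k ⟩
          fromℕ k * ((1# - a) + a * t)  ∎)
    }
    where
    expand : ∀ k → fromℕ k + fromℕ k * a * (t - 1#) ≈ fromℕ k * ((1# - a) + a * t)
    expand k = solve 3 (λ k a t → k :+ k :* a :* (t :- :1) := k :* ((:1 :- a) :+ a :* t))
      refl (fromℕ k) a t

    rational : ∀ y m k → 0# ≤ y → 1 ℕ.≤ k → y ^ k ≤ t ^ m → m ℕ.≤ k →
      fromℕ k * y ≤ fromℕ k + fromℕ m * (t - 1#)
    rational y m k 0≤y 1≤k yᵏ≤tᵐ m≤k with k ℕ.∸ m | ℕ.m∸n+n≡m m≤k
    ... | j | ≡.refl = begin
      fromℕ k * y  ≤⟨ *-monoʳ-≤ (fromℕ-nonNeg k) (^-cancel-≤ k 1≤k 0≤A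
                        (≤-trans yᵏ≤tᵐ (am-gm-ones m j A 0≤t 0≤A 1≤k kA))) ⟩
      fromℕ k * A  ≈⟨ kA ⟩
      fromℕ j + fromℕ m * t
        ≈⟨ solve 3 (λ j m t → j :+ m :* t := j :+ m :+ m :* (t :- :1)) refl (fromℕ j) (fromℕ m) t ⟩
      fromℕ j + fromℕ m + fromℕ m * (t - 1#)  ≈⟨ +-congʳ (fromℕ-+ j m) ⟨
      fromℕ k + fromℕ m * (t - 1#)  ∎
      where
      A : ℝ
      A = (fromℕ j + fromℕ m * t) ÷ fromℕ k
      0≤A : 0# ≤ A
      0≤A = ÷-nonNeg (+-nonNeg (fromℕ-nonNeg j) (*-nonNeg (fromℕ-nonNeg m) 0≤t)) (fromℕ-pos 1≤k)
      kA : fromℕ k * A ≈ fromℕ j + fromℕ m * t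
      kA = trans (*-comm _ _) (x÷y*y _ (>⇒≉ (fromℕ-pos 1≤k)))

    decrease : ∀ k {u v} → t ≤ 1# → u ≤ v → fromℕ k + v * (t - 1#) ≤ fromℕ k + u * (t - 1#)
    decrease k {u} {v} t≤1 u≤v = ≤-by ((v - u) * (1# - t))
      (*-nonNeg (x≤y⇒0≤y-x u≤v) (x≤y⇒0≤y-x t≤1))
      (solve 4 (λ k u v t → k :+ v :* (t :- :1) :+ (v :- u) :* (:1 :- t) := k :+ u :* (t :- :1))
        refl (fromℕ k) u v t)

    below-one : ∀ y m k → 0# ≤ y → 1 ℕ.≤ k → y ^ k ≤ t ^ m → t ≤ 1# → fromℕ k * a ≤ fromℕ m →
      fromℕ k * y ≤ fromℕ k + fromℕ k * a * (t - 1#)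
    below-one y m k 0≤y 1≤k yᵏ≤tᵐ t≤1 ka≤m with ℕ.≤-total m k
    ... | inj₁ m≤k = ≤-trans (rational y m k 0≤y 1≤k yᵏ≤tᵐ m≤k) (decrease k t≤1 ka≤m)
    -- An exponent m / k above 1 can occur here, since m / k only has to be at least `a`. As t ≤ 1,
    -- tᵐ may be weakened to tᵏ, and k / k = 1 is still at least `a`.
    ... | inj₂ k≤m = ≤-trans
      (rational y k k 0≤y 1≤k (≤-trans yᵏ≤tᵐ (^-antitoneʳ-≤ 0≤t t≤1 k≤m)) ℕ.≤-refl)
      (decrease k t≤1 (≤-respʳ-≈ (*-identityʳ _) (*-monoʳ-≤ (fromℕ-nonNeg k) a≤1)))

  -- Both sides are homogeneous of degree a + b = 1 in (x, y), so division by y reduces the claim to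
  -- `bernoulli` at x / y. For y = 0 the outcome depends on whether b is 0.
  weighted-am-gm : ∀ {x y a b} → 0# ≤ x → 0# ≤ y → 0# ≤ a → 0# ≤ b → a + b ≈ 1# →
    pow x a * pow y b ≤ a * x + b * y
  weighted-am-gm {x} {y} {a} {b} 0≤x 0≤y 0≤a 0≤b a+b≈1 with pos-or-zero 0≤y | pos-or-zero 0≤b
  ... | inj₁ y≈0 | inj₂ 0<b = begin
    pow x a * pow y b  ≈⟨ trans (*-congˡ (pow-zeroˡ y≈0 0<b)) (zeroʳ _) ⟩
    0#                 ≤⟨ +-nonNeg (*-nonNeg 0≤a 0≤x) (*-nonNeg 0≤b 0≤y) ⟩
    a * x + b * y      ∎
  ... | inj₁ y≈0 | inj₁ b≈0 = begin
    pow x a * pow y b  ≈⟨ *-cong (trans (pow-congʳ 0≤x 0≤a a≈1) (pow-oneʳ 0≤x)) (pow-zeroʳ 0≤y b≈0) ⟩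
    x * 1#             ≈⟨ *-comm x 1# ⟩
    1# * x             ≈⟨ *-congʳ a≈1 ⟨
    a * x              ≤⟨ ≤-by (b * y) (*-nonNeg 0≤b 0≤y) refl ⟩
    a * x + b * y      ∎
    where
    a≈1 : a ≈ 1#
    a≈1 = trans (sym (trans (+-congˡ b≈0) (+-identityʳ a))) a+b≈1
  ... | inj₂ 0<y | _ = begin
    pow x a * pow y b            ≈⟨ *-congʳ (pow-congˡ 0≤a 0≤x (sym (x÷y*y x (>⇒≉ 0<y)))) ⟩
    pow (t * y) a * pow y b      ≈⟨ *-congʳ (pow-* 0≤t 0≤y 0≤a) ⟩
    pow t a * pow y a * pow y b  ≈⟨ *-assoc _ _ _ ⟩
    pow t a * (pow y a * pow y b)
      ≈⟨ *-congˡ (trans (sym (pow-+ 0≤y 0≤a 0≤b))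
           (trans (pow-congʳ 0≤y (+-nonNeg 0≤a 0≤b) a+b≈1) (pow-oneʳ 0≤y))) ⟩
    pow t a * y                  ≤⟨ *-monoˡ-≤ 0≤y (bernoulli 0≤t 0≤a a≤1) ⟩
    ((1# - a) + a * t) * y       ≈⟨ *-congʳ (+-congʳ (+-congʳ a+b≈1)) ⟨
    ((a + b - a) + a * t) * y
      ≈⟨ solve 4 (λ a b t y → ((a :+ b :- a) :+ a :* t) :* y := a :* (t :* y) :+ b :* y) refl a b t y ⟩
    a * (t * y) + b * y          ≈⟨ +-congʳ (*-congˡ (x÷y*y x (>⇒≉ 0<y))) ⟩
    a * x + b * y                ∎
    where
    t : ℝ
    t = x ÷ y
    0≤t : 0# ≤ t
    0≤t = ÷-nonNeg 0≤x 0<y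
    a≤1 : a ≤ 1#
    a≤1 = ≤-by b 0≤b a+b≈1

-- Positive linear functionals, Hölder's inequality and norms

module Averages (R : Reals) where
  open Analysis R hiding (zero)
  open OrderedField R
  open Powers R
  open ≤-Reasoning
  open SumProperties semiring public
    using (*-distribˡ-sum; *-distribʳ-sum; ∑-distrib-+; ∑-comm; sum-cong-≋)

  -- Common interface of finite sums, sums over vectors and all expectations below. Congruence is no
  -- field because it follows from monotonicity by antisymmetry.
  record PositiveLinear {I : Set} (E : (I → ℝ) → ℝ) : Set where
    field
      mono-≤ : ∀ {f g} → (∀ i → f i ≤ g i) → E f ≤ E g
      add    : ∀ f g → E (λ i → f i + g i) ≈ E f + E g
      scale  : ∀ c f → E (λ i → c * f i) ≈ c * E f

    cong : ∀ {f g} → (∀ i → f i ≈ g i) → E f ≈ E g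
    cong f≈g = ≤-antisym (mono-≤ (λ i → ≤-reflexive (f≈g i))) (mono-≤ (λ i → ≤-reflexive (sym (f≈g i))))

    vanish : ∀ {f} → (∀ i → f i ≈ 0#) → E f ≈ 0#
    vanish {f} f≈0 = begin-equality
      E f                 ≈⟨ cong (λ i → trans (f≈0 i) (sym (zeroˡ (f i)))) ⟩
      E (λ i → 0# * f i)  ≈⟨ scale 0# f ⟩
      0# * E f            ≈⟨ zeroˡ _ ⟩
      0#                  ∎

    nonNeg : ∀ {f} → (∀ i → 0# ≤ f i) → 0# ≤ E f
    nonNeg {f} 0≤f = ≤-respˡ-≈ (vanish (λ _ → refl)) (mono-≤ 0≤f)

    swap-sum : ∀ {n} (f : Fin n → I → ℝ) → E (λ i → sum (λ j → f j i)) ≈ sum (λ j → E (f j))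
    swap-sum {zero}  f = vanish (λ _ → refl)
    swap-sum {suc n} f = trans (add _ _) (+-congˡ (swap-sum (f ∘ suc)))

  open PositiveLinear

  sum-mono-≤ : ∀ {n} {f g : Fin n → ℝ} → (∀ i → f i ≤ g i) → sum f ≤ sum g
  sum-mono-≤ {zero}  f≤g = ≤-refl
  sum-mono-≤ {suc n} f≤g = +-mono-≤ (f≤g zero) (sum-mono-≤ (f≤g ∘ suc))

  sum-positiveLinear : ∀ n → PositiveLinear (sum {n})
  sum-positiveLinear n = record
    { mono-≤ = sum-mono-≤
    ; add    = ∑-distrib-+
    ; scale  = λ c f → sym (*-distribˡ-sum c f)
    }

  sum-cong : ∀ {n} {f g : Fin n → ℝ} → (∀ i → f i ≈ g i) → sum f ≈ sum g
  sum-cong = sum-cong-≋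

  sum-nonNeg : ∀ {n} {f : Fin n → ℝ} → (∀ i → 0# ≤ f i) → 0# ≤ sum f
  sum-nonNeg = nonNeg (sum-positiveLinear _)

  term≤sum : ∀ {n} {f : Fin n → ℝ} → (∀ i → 0# ≤ f i) → ∀ i → f i ≤ sum f
  term≤sum 0≤f zero    = ≤-by _ (sum-nonNeg (0≤f ∘ suc)) refl
  term≤sum 0≤f (suc i) = ≤-trans (term≤sum (0≤f ∘ suc) i) (≤-by _ (0≤f zero) (+-comm _ _))

  sumVec-positiveLinear : ∀ {n} ℓ → PositiveLinear (sumVec {n} ℓ)
  sumVec-positiveLinear zero    = record
    { mono-≤ = λ f≤g → f≤g []
    ; add    = λ f g → refl
    ; scale  = λ c f → refl
    }
  sumVec-positiveLinear {n} (suc ℓ) = record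
    { mono-≤ = λ f≤g → sum-mono-≤ λ i → mono-≤ IH λ is → f≤g (i ∷ is)
    ; add    = λ f g → trans (sum-cong {n} λ i → add IH _ _) (∑-distrib-+ {n} _ _)
    ; scale  = λ c f → trans (sum-cong {n} λ i → scale IH c _) (sym (*-distribˡ-sum {n} c _))
    }
    where
    IH : PositiveLinear (sumVec {n} ℓ)
    IH = sumVec-positiveLinear ℓ

  weighted : ∀ {I} {E : (I → ℝ) → ℝ} {w : I → ℝ} → PositiveLinear E → (∀ i → 0# ≤ w i) →
    PositiveLinear (λ f → E (λ i → w i * f i))
  weighted {w = w} L 0≤w = record
    { mono-≤ = λ f≤g → mono-≤ L λ i → *-monoʳ-≤ (0≤w i) (f≤g i)
    ; add    = λ f g → trans (cong L λ i → distribˡ (w i) (f i) (g i)) (add L _ _)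
    ; scale  = λ c f → trans
        (cong L λ i → solve 3 (λ w c f → w :* (c :* f) := c :* (w :* f)) refl (w i) c (f i))
        (scale L c _)
    }

  iterated : ∀ {I J} {E : (I → ℝ) → ℝ} {F : (J → ℝ) → ℝ} → PositiveLinear E → PositiveLinear F →
    PositiveLinear (λ (f : I × J → ℝ) → E (λ i → F (λ j → f (i , j))))
  iterated L M = record
    { mono-≤ = λ f≤g → mono-≤ L λ i → mono-≤ M λ j → f≤g (i , j)
    ; add    = λ f g → trans (cong L λ i → add M _ _) (add L _ _)
    ; scale  = λ c f → trans (cong L λ i → scale M c _) (scale L c _)
    }

  private
    -- AM-GM for the normalised values x / X and y / Y. When X and Y are the totals, the brackets
    -- add up to a + b = 1.
    hölder-pos : ∀ {x y X Y a b} → 0# ≤ x → 0# ≤ y → 0# < X → 0# < Y →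
      0# ≤ a → 0# ≤ b → a + b ≈ 1# →
      pow x a * pow y b ≤ (a * (x ÷ X) + b * (y ÷ Y)) * (pow X a * pow Y b)
    hölder-pos {x} {y} {X} {Y} {a} {b} 0≤x 0≤y 0<X 0<Y 0≤a 0≤b a+b≈1 = begin
      pow x a * pow y b
        ≈⟨ *-cong (rescale 0≤x 0<X 0≤a) (rescale 0≤y 0<Y 0≤b) ⟩
      pow (x ÷ X) a * pow X a * (pow (y ÷ Y) b * pow Y b)
        ≈⟨ solve 4 (λ u v w z → u :* v :* (w :* z) := u :* w :* (v :* z)) refl _ _ _ _ ⟩
      pow (x ÷ X) a * pow (y ÷ Y) b * (pow X a * pow Y b)
        ≤⟨ *-monoˡ-≤ (*-nonNeg (pow-nonNeg (<⇒≤ 0<X) 0≤a) (pow-nonNeg (<⇒≤ 0<Y) 0≤b))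
             (weighted-am-gm (÷-nonNeg 0≤x 0<X) (÷-nonNeg 0≤y 0<Y) 0≤a 0≤b a+b≈1) ⟩
      (a * (x ÷ X) + b * (y ÷ Y)) * (pow X a * pow Y b)  ∎
      where
      rescale : ∀ {x X a} → 0# ≤ x → 0# < X → 0# ≤ a → pow x a ≈ pow (x ÷ X) a * pow X a
      rescale 0≤x 0<X 0≤a = trans (pow-congˡ 0≤a 0≤x (sym (x÷y*y _ (>⇒≉ 0<X))))
        (pow-* (÷-nonNeg 0≤x 0<X) (<⇒≤ 0<X) 0≤a)

    x+y≈0⇒x≈0 : ∀ {x y} → 0# ≤ x → 0# ≤ y → x + y ≈ 0# → x ≈ 0#
    x+y≈0⇒x≈0 0≤x 0≤y x+y≈0 = ≤-antisym (≤-by _ 0≤y x+y≈0) 0≤x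

  -- Two terms suffice for the induction, which merges the first term with the sums over the rest.
  -- Positivity of a and b makes the left side vanish when one of the totals is 0.
  hölder₂ : ∀ {x y x′ y′ a b} → 0# ≤ x → 0# ≤ y → 0# ≤ x′ → 0# ≤ y′ →
    0# < a → 0# < b → a + b ≈ 1# →
    pow x a * pow y b + pow x′ a * pow y′ b ≤ pow (x + x′) a * pow (y + y′) b
  hölder₂ {x} {y} {x′} {y′} {a} {b} 0≤x 0≤y 0≤x′ 0≤y′ 0<a 0<b a+b≈1
    with pos-or-zero (+-nonNeg 0≤x 0≤x′) | pos-or-zero (+-nonNeg 0≤y 0≤y′)
  ... | inj₁ X≈0 | _ = begin
    pow x a * pow y b + pow x′ a * pow y′ b
      ≈⟨ +-cong (*-congʳ (pow-zeroˡ (x+y≈0⇒x≈0 0≤x 0≤x′ X≈0) 0<a))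
           (*-congʳ (pow-zeroˡ (x+y≈0⇒x≈0 0≤x′ 0≤x (trans (+-comm _ _) X≈0)) 0<a)) ⟩
    0# * pow y b + 0# * pow y′ b
      ≈⟨ solve 2 (λ u v → :0 :* u :+ :0 :* v := :0) refl _ _ ⟩
    0#
      ≤⟨ *-nonNeg (pow-nonNeg (+-nonNeg 0≤x 0≤x′) (<⇒≤ 0<a)) (pow-nonNeg (+-nonNeg 0≤y 0≤y′) (<⇒≤ 0<b)) ⟩
    pow (x + x′) a * pow (y + y′) b  ∎
  ... | inj₂ 0<X | inj₁ Y≈0 = begin
    pow x a * pow y b + pow x′ a * pow y′ b
      ≈⟨ +-cong (*-congˡ (pow-zeroˡ (x+y≈0⇒x≈0 0≤y 0≤y′ Y≈0) 0<b))
           (*-congˡ (pow-zeroˡ (x+y≈0⇒x≈0 0≤y′ 0≤y (trans (+-comm _ _) Y≈0)) 0<b)) ⟩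
    pow x a * 0# + pow x′ a * 0#
      ≈⟨ solve 2 (λ u v → u :* :0 :+ v :* :0 := :0) refl _ _ ⟩
    0#
      ≤⟨ *-nonNeg (pow-nonNeg (<⇒≤ 0<X) (<⇒≤ 0<a)) (pow-nonNeg (+-nonNeg 0≤y 0≤y′) (<⇒≤ 0<b)) ⟩
    pow (x + x′) a * pow (y + y′) b  ∎
  ... | inj₂ 0<X | inj₂ 0<Y = begin
    pow x a * pow y b + pow x′ a * pow y′ b
      ≤⟨ +-mono-≤ (hölder-pos 0≤x 0≤y 0<X 0<Y (<⇒≤ 0<a) (<⇒≤ 0<b) a+b≈1)
           (hölder-pos 0≤x′ 0≤y′ 0<X 0<Y (<⇒≤ 0<a) (<⇒≤ 0<b) a+b≈1) ⟩
    (a * (x ÷ X) + b * (y ÷ Y)) * Z + (a * (x′ ÷ X) + b * (y′ ÷ Y)) * Z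
      ≈⟨ solve 9 (λ a b x y x′ y′ u v z →
             (a :* (x :* u) :+ b :* (y :* v)) :* z :+ (a :* (x′ :* u) :+ b :* (y′ :* v)) :* z
             := (a :* ((x :+ x′) :* u) :+ b :* ((y :+ y′) :* v)) :* z)
           refl a b x y x′ y′ (X ⁻¹) (Y ⁻¹) Z ⟩
    (a * (X ÷ X) + b * (Y ÷ Y)) * Z
      ≈⟨ *-congʳ (+-cong (*-congˡ (⁻¹-inverseʳ X (>⇒≉ 0<X))) (*-congˡ (⁻¹-inverseʳ Y (>⇒≉ 0<Y)))) ⟩
    (a * 1# + b * 1#) * Z
      ≈⟨ *-congʳ (trans (+-cong (*-identityʳ a) (*-identityʳ b)) a+b≈1) ⟩
    1# * Z
      ≈⟨ *-identityˡ Z ⟩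
    Z  ∎
    where
    X Y Z : ℝ
    X = x + x′
    Y = y + y′
    Z = pow X a * pow Y b

  hölder : ∀ {n a b} {f g : Fin n → ℝ} → (∀ i → 0# ≤ f i) → (∀ i → 0# ≤ g i) →
    0# < a → 0# < b → a + b ≈ 1# →
    sum (λ i → pow (f i) a * pow (g i) b) ≤ pow (sum f) a * pow (sum g) b
  hölder {zero}  0≤f 0≤g 0<a 0<b a+b≈1 =
    *-nonNeg (pow-nonNeg ≤-refl (<⇒≤ 0<a)) (pow-nonNeg ≤-refl (<⇒≤ 0<b))
  hölder {suc n} 0≤f 0≤g 0<a 0<b a+b≈1 = ≤-trans
    (+-monoʳ-≤ _ (hölder (0≤f ∘ suc) (0≤g ∘ suc) 0<a 0<b a+b≈1))
    (hölder₂ (0≤f zero) (0≤g zero) (sum-nonNeg (0≤f ∘ suc)) (sum-nonNeg (0≤g ∘ suc)) 0<a 0<b a+b≈1)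

  recip-nonNeg : ∀ p → 0# ≤ recip p
  recip-nonNeg (fin x 1≤x) = <⇒≤ (⁻¹-pos (1≤x⇒0<x 1≤x))
  recip-nonNeg ∞           = ≤-refl

  recip≤1 : ∀ p → recip p ≤ 1#
  recip≤1 (fin x 1≤x) = 1≤x⇒x⁻¹≤1 1≤x
  recip≤1 ∞           = 0≤1

  recip-antitone : ∀ {p q} → p ≼ q → recip q ≤ recip p
  recip-antitone {fin x 1≤x} {fin y _} x≤y = ⁻¹-antitone (1≤x⇒0<x 1≤x) x≤y
  recip-antitone {p}         {∞}       _   = recip-nonNeg p

  ∣nonNeg∣ : ∀ {x y} → 0# ≤ x → y ≈ 0# → ∣ x +i y ∣ℂ ≈ x
  ∣nonNeg∣ {x} {y} 0≤x y≈0 = begin-equality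
    pow (x * x + y * y) h  ≈⟨ pow-congˡ 0≤h (+-nonNeg (square-nonNeg x) (square-nonNeg y))
                                (trans (+-congˡ (trans (*-congʳ y≈0) (zeroˡ y))) (+-identityʳ _)) ⟩
    pow (x * x) h          ≈⟨ pow-* 0≤x 0≤x 0≤h ⟩
    pow x h * pow x h      ≈⟨ pow-+ 0≤x 0≤h 0≤h ⟨
    pow x (h + h)          ≈⟨ pow-congʳ 0≤x (+-nonNeg 0≤h 0≤h) h+h≈1 ⟩
    pow x 1#               ≈⟨ pow-oneʳ 0≤x ⟩
    x                      ∎
    where
    0<2 : 0# < 1# + 1#
    0<2 = +-pos-nonNeg 0<1 0≤1
    h : ℝ
    h = (1# + 1#) ⁻¹
    0≤h : 0# ≤ h
    0≤h = <⇒≤ (⁻¹-pos 0<2)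
    h+h≈1 : h + h ≈ 1#
    h+h≈1 = trans (solve 1 (λ h → h :+ h := (:1 :+ :1) :* h) refl h) (⁻¹-inverseʳ _ (>⇒≉ 0<2))

  -- For finite q the weight is split as μ ^ a μ ^ b, which is possible since a + b = 1, and
  -- `hölder` is applied to μ h ^ q and μ ψ. For q = ∞ the exponent b is 1, and each h i with
  -- positive weight is at most the norm.
  hölder-norm : ∀ {n} (μ : Fin n → ℝ) q {b} (F : Fin n → ℂ) (h ψ : Fin n → ℝ) →
    (∀ i → 0# ≤ μ i) → (∀ i → 0# ≤ h i) → (∀ i → 0# ≤ ψ i) → (∀ i → ∣ F i ∣ℂ ≈ h i) →
    0# < b → recip q + b ≈ 1# →
    sum (λ i → μ i * h i * pow (ψ i) b) ≤ norm μ q F * pow (sum (λ i → μ i * ψ i)) b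
  hölder-norm μ (fin x 1≤x) {b} F h ψ 0≤μ 0≤h 0≤ψ ∣F∣≈h 0<b a+b≈1 = begin
    sum (λ i → μ i * h i * pow (ψ i) b)
      ≈⟨ sum-cong (λ i → sym (term (0≤μ i) (0≤h i) (0≤ψ i))) ⟩
    sum (λ i → pow (μ i * pow (h i) x) a * pow (μ i * ψ i) b)
      ≤⟨ hölder (λ i → 0≤μhˣ i) (λ i → *-nonNeg (0≤μ i) (0≤ψ i)) 0<a 0<b a+b≈1 ⟩
    pow (sum (λ i → μ i * pow (h i) x)) a * pow (sum (λ i → μ i * ψ i)) b
      ≈⟨ *-congʳ (pow-congˡ (<⇒≤ 0<a) (sum-nonNeg 0≤μhˣ)
           (sum-cong λ i → *-congˡ (pow-congˡ 0≤x (0≤h i) (sym (∣F∣≈h i))))) ⟩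
    norm μ (fin x 1≤x) F * pow (sum (λ i → μ i * ψ i)) b  ∎
    where
    0<x : 0# < x
    0<x = 1≤x⇒0<x 1≤x
    0≤x : 0# ≤ x
    0≤x = <⇒≤ 0<x
    a : ℝ
    a = x ⁻¹
    0<a : 0# < a
    0<a = ⁻¹-pos 0<x
    0≤μhˣ : ∀ i → 0# ≤ μ i * pow (h i) x
    0≤μhˣ i = *-nonNeg (0≤μ i) (pow-nonNeg (0≤h i) 0≤x)
    term : ∀ {m t s} → 0# ≤ m → 0# ≤ t → 0# ≤ s → pow (m * pow t x) a * pow (m * s) b ≈ m * t * pow s b
    term {m} {t} {s} 0≤m 0≤t 0≤s = begin-equality
      pow (m * pow t x) a * pow (m * s) b
        ≈⟨ *-cong (pow-* 0≤m (pow-nonNeg 0≤t 0≤x) (<⇒≤ 0<a)) (pow-* 0≤m 0≤s (<⇒≤ 0<b)) ⟩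
      pow m a * pow (pow t x) a * (pow m b * pow s b)
        ≈⟨ *-congʳ (*-congˡ (pow-pow-inverse 0≤t 0≤x (<⇒≤ 0<a) (⁻¹-inverseʳ x (>⇒≉ 0<x)))) ⟩
      pow m a * t * (pow m b * pow s b)
        ≈⟨ solve 4 (λ u t v w → u :* t :* (v :* w) := u :* v :* t :* w) refl _ _ _ _ ⟩
      pow m a * pow m b * t * pow s b
        ≈⟨ *-congʳ (*-congʳ (trans (sym (pow-+ 0≤m (<⇒≤ 0<a) (<⇒≤ 0<b)))
             (trans (pow-congʳ 0≤m (+-nonNeg (<⇒≤ 0<a) (<⇒≤ 0<b)) a+b≈1) (pow-oneʳ 0≤m)))) ⟩
      m * t * pow s b  ∎
  hölder-norm {n} μ ∞ {b} F h ψ 0≤μ 0≤h 0≤ψ ∣F∣≈h 0<b 0+b≈1 = begin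
    sum (λ i → μ i * h i * pow (ψ i) b)
      ≤⟨ sum-mono-≤ (λ i → ≤-trans (≤-reflexive (*-congˡ (pow-b (0≤ψ i)))) (term i)) ⟩
    sum (λ i → N * (μ i * ψ i))
      ≈⟨ *-distribˡ-sum {n} N _ ⟨
    N * sum (λ i → μ i * ψ i)
      ≈⟨ *-congˡ (pow-b (sum-nonNeg λ i → *-nonNeg (0≤μ i) (0≤ψ i))) ⟨
    N * pow (sum (λ i → μ i * ψ i)) b  ∎
    where
    N : ℝ
    N = norm μ ∞ F
    pow-b : ∀ {x} → 0# ≤ x → pow x b ≈ x
    pow-b 0≤x = trans (pow-congʳ 0≤x (<⇒≤ 0<b) (trans (sym (+-identityˡ b)) 0+b≈1)) (pow-oneʳ 0≤x)
    0≤∣F∣ : ∀ i → 0# ≤ ∣ F i ∣ℂ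
    0≤∣F∣ i = ≤-respʳ-≈ (sym (∣F∣≈h i)) (0≤h i)
    h≤N : ∀ i → 0# < μ i → h i ≤ N
    h≤N i 0<μᵢ = ≤-respˡ-≈ (∣F∣≈h i) (sup-upper _ (_ , member)
      -- The supremum needs some upper bound to have its expected value; the sum of all moduli is a
      -- crude one.
      (sum (λ j → ∣ F j ∣ℂ) , λ { r (j , _ , r≈∣Fⱼ∣) → ≤-respˡ-≈ (sym r≈∣Fⱼ∣) (term≤sum 0≤∣F∣ j) })
      _ member)
      where
      member : ∃[ j ] (0# < μ j) × (∣ F i ∣ℂ ≈ ∣ F j ∣ℂ)
      member = i , 0<μᵢ , refl
    term : ∀ i → μ i * h i * ψ i ≤ N * (μ i * ψ i)
    -- The L∞ norm sees only points of positive weight; at the others both sides vanish.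
    term i with pos-or-zero (0≤μ i)
    ... | inj₁ μ≈0 = ≤-reflexive (begin-equality
      μ i * h i * ψ i     ≈⟨ *-congʳ (*-congʳ μ≈0) ⟩
      0# * h i * ψ i      ≈⟨ solve 3 (λ h s n → :0 :* h :* s := n :* (:0 :* s)) refl (h i) (ψ i) N ⟩
      N * (0# * ψ i)      ≈⟨ *-congˡ (*-congʳ μ≈0) ⟨
      N * (μ i * ψ i)     ∎)
    ... | inj₂ 0<μ = begin
      μ i * h i * ψ i     ≈⟨ solve 3 (λ m h s → m :* h :* s := h :* (m :* s)) refl (μ i) (h i) (ψ i) ⟩
      h i * (μ i * ψ i)   ≤⟨ *-monoˡ-≤ (*-nonNeg (0≤μ i) (0≤ψ i)) (h≤N i 0<μ) ⟩
      N * (μ i * ψ i)     ∎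

-- From hypercontractivity to a bound on success probabilities

module Agreement (R : Reals) {m k : ℕ} (ρ : Analysis.JointDistribution R m k) where
  open Analysis R hiding (zero)
  open OrderedField R
  open Powers R
  open Averages R
  open ≤-Reasoning
  open PositiveLinear renaming (nonNeg to average-nonNeg)
  open JointDistribution ρ

  marginalV-nonNeg : ∀ v → 0# ≤ marginalV v
  marginalV-nonNeg v = sum-nonNeg λ u → nonNeg u v

  power-nonNeg : ∀ {ℓ} us vs → 0# ≤ power ρ {ℓ} us vs
  power-nonNeg []       []       = 0≤1
  power-nonNeg (u ∷ us) (v ∷ vs) = *-nonNeg (nonNeg u v) (power-nonNeg us vs)

  sum₂ : (Fin m → Fin k → ℝ) → ℝ
  sum₂ F = sum λ u → sum λ v → F u v

  E₁ : (Fin m → Fin k → ℝ) → ℝ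
  E₁ F = sum₂ λ u v → mass u v * F u v

  E₁-positiveLinear : PositiveLinear {Fin m × Fin k} (λ F → E₁ λ u v → F (u , v))
  E₁-positiveLinear = weighted {w = λ (u , v) → mass u v}
    (iterated (sum-positiveLinear m) (sum-positiveLinear k)) (λ (u , v) → nonNeg u v)

  𝔼-positiveLinear : ∀ ℓ →
    PositiveLinear {Vec (Fin m) ℓ × Vec (Fin k) ℓ} (λ F → 𝔼 ρ ℓ λ us vs → F (us , vs))
  𝔼-positiveLinear ℓ = weighted {w = λ (us , vs) → power ρ us vs}
    (iterated (sumVec-positiveLinear ℓ) (sumVec-positiveLinear ℓ)) (λ (us , vs) → power-nonNeg us vs)

  -- In `𝔼` the sum over the first `v` stands inside the sums over all of `us`, so conditioning on
  -- the first pair requires moving it outwards.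
  𝔼-suc : ∀ ℓ F → 𝔼 ρ (suc ℓ) F ≈ E₁ λ u v → 𝔼 ρ ℓ λ us vs → F (u ∷ us) (v ∷ vs)
  𝔼-suc ℓ F = sum-cong {m} λ u → begin-equality
    (sumVec ℓ λ us → sum λ v → sumVec ℓ λ vs → mass u v * power ρ us vs * F (u ∷ us) (v ∷ vs))
      ≈⟨ swap-sum SVU (λ v us → sumVec ℓ λ vs → mass u v * power ρ us vs * F (u ∷ us) (v ∷ vs)) ⟩
    (sum λ v → sumVec ℓ λ us → sumVec ℓ λ vs → mass u v * power ρ us vs * F (u ∷ us) (v ∷ vs))
      ≈⟨ sum-cong {k} (λ v → begin-equality
           (sumVec ℓ λ us → sumVec ℓ λ vs → mass u v * power ρ us vs * F (u ∷ us) (v ∷ vs))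
             ≈⟨ cong SVU (λ us → trans
                  (cong SVV λ vs → *-assoc (mass u v) (power ρ us vs) (F (u ∷ us) (v ∷ vs)))
                  (scale SVV (mass u v) λ vs → power ρ us vs * F (u ∷ us) (v ∷ vs))) ⟩
           (sumVec ℓ λ us → mass u v * sumVec ℓ λ vs → power ρ us vs * F (u ∷ us) (v ∷ vs))
             ≈⟨ scale SVU (mass u v) _ ⟩
           (mass u v * 𝔼 ρ ℓ λ us vs → F (u ∷ us) (v ∷ vs))  ∎) ⟩
    (sum λ v → mass u v * 𝔼 ρ ℓ λ us vs → F (u ∷ us) (v ∷ vs))  ∎
    where
    SVU : PositiveLinear (sumVec {m} ℓ)
    SVU = sumVec-positiveLinear ℓ
    SVV : PositiveLinear (sumVec {k} ℓ)
    SVV = sumVec-positiveLinear ℓ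

  𝔼-1 : ∀ ℓ → 𝔼 ρ ℓ (λ _ _ → 1#) ≈ 1#
  𝔼-1 zero    = *-identityʳ 1#
  𝔼-1 (suc ℓ) = begin-equality
    𝔼 ρ (suc ℓ) (λ _ _ → 1#)          ≈⟨ 𝔼-suc ℓ (λ _ _ → 1#) ⟩
    E₁ (λ _ _ → 𝔼 ρ ℓ (λ _ _ → 1#))   ≈⟨ cong E₁-positiveLinear (λ _ → 𝔼-1 ℓ) ⟩
    E₁ (λ _ _ → 1#)                    ≈⟨ sum-cong {m} (λ u → sum-cong {k} λ v → *-identityʳ _) ⟩
    sum₂ mass                          ≈⟨ total ⟩
    1#                                 ∎

  -- The two-function form of q-to-p hypercontractivity, with α = 1/p and β = 1/q',
  -- written for φ = f ᵖ and ψ = g ^ q'; this form tensorises without Minkowski's inequality.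
  BilinearBound : (α β : ℝ) → Set
  BilinearBound α β = ∀ (φ : Fin m → ℝ) (ψ : Fin k → ℝ) → (∀ u → 0# ≤ φ u) → (∀ v → 0# ≤ ψ v) →
    E₁ (λ u v → pow (φ u) α * pow (ψ v) β) ≤ pow (E₁ λ u v → φ u) α * pow (E₁ λ u v → ψ v) β

  module _ {α β : ℝ} (0≤α : 0# ≤ α) (0≤β : 0# ≤ β) where

    tensorise : BilinearBound α β → ∀ ℓ (φ : Vec (Fin m) ℓ → ℝ) (ψ : Vec (Fin k) ℓ → ℝ) →
      (∀ us → 0# ≤ φ us) → (∀ vs → 0# ≤ ψ vs) →
      𝔼 ρ ℓ (λ us vs → pow (φ us) α * pow (ψ vs) β) ≤
      pow (𝔼 ρ ℓ λ us vs → φ us) α * pow (𝔼 ρ ℓ λ us vs → ψ vs) β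
    tensorise B zero φ ψ 0≤φ 0≤ψ = ≤-reflexive (trans (*-identityˡ _) (*-cong
      (pow-congˡ 0≤α (0≤φ []) (sym (*-identityˡ _))) (pow-congˡ 0≤β (0≤ψ []) (sym (*-identityˡ _)))))
    tensorise B (suc ℓ) φ ψ 0≤φ 0≤ψ = begin
      𝔼 ρ (suc ℓ) (λ us vs → pow (φ us) α * pow (ψ vs) β)
        ≈⟨ 𝔼-suc ℓ (λ us vs → pow (φ us) α * pow (ψ vs) β) ⟩
      E₁ (λ u v → 𝔼 ρ ℓ λ us vs → pow (φ (u ∷ us)) α * pow (ψ (v ∷ vs)) β)
        ≤⟨ mono-≤ E₁-positiveLinear (λ (u , v) →
             tensorise B ℓ (λ us → φ (u ∷ us)) (λ vs → ψ (v ∷ vs)) (λ us → 0≤φ (u ∷ us)) (λ vs → 0≤ψ (v ∷ vs))) ⟩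
      E₁ (λ u v → pow (Φ u) α * pow (Ψ v) β)
        -- The remaining coordinates are independent of the first pair, so Φ depends on u alone and
        -- Ψ on v alone; the one-coordinate bound therefore applies to them.
        ≤⟨ B Φ Ψ 0≤Φ 0≤Ψ ⟩
      pow (E₁ λ u v → Φ u) α * pow (E₁ λ u v → Ψ v) β
        ≈⟨ *-cong (pow-congˡ 0≤α (average-nonNeg E₁-positiveLinear λ (u , v) → 0≤Φ u) (sym (𝔼-suc ℓ λ us vs → φ us)))
             (pow-congˡ 0≤β (average-nonNeg E₁-positiveLinear λ (u , v) → 0≤Ψ v) (sym (𝔼-suc ℓ λ us vs → ψ vs))) ⟩
      pow (𝔼 ρ (suc ℓ) λ us vs → φ us) α * pow (𝔼 ρ (suc ℓ) λ us vs → ψ vs) β  ∎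
      where
      Φ : Fin m → ℝ
      Φ u = 𝔼 ρ ℓ λ us vs → φ (u ∷ us)
      Ψ : Fin k → ℝ
      Ψ v = 𝔼 ρ ℓ λ us vs → ψ (v ∷ vs)
      0≤Φ : ∀ u → 0# ≤ Φ u
      0≤Φ u = average-nonNeg (𝔼-positiveLinear ℓ) λ (us , vs) → 0≤φ (u ∷ us)
      0≤Ψ : ∀ v → 0# ≤ Ψ v
      0≤Ψ v = average-nonNeg (𝔼-positiveLinear ℓ) λ (us , vs) → 0≤ψ (v ∷ vs)

    success-bound : α ≤ 1# → β ≤ 1# → BilinearBound α β → (P : AgreementProtocol ρ) →
      let open AgreementProtocol P in
      success ≤ pow (𝔼 ρ ℓ λ us vs → f us) α * pow (𝔼 ρ ℓ λ us vs → g vs) β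
    success-bound α≤1 β≤1 B P = ≤-trans
      (mono-≤ (𝔼-positiveLinear ℓ) λ (us , vs) →
        let 0≤f , f≤1 = f-range us ; 0≤g , g≤1 = g-range vs in
        *-mono-≤ 0≤f 0≤g (x≤pow 0≤f f≤1 0≤α α≤1) (x≤pow 0≤g g≤1 0≤β β≤1))
      (tensorise B ℓ f g (proj₁ ∘ f-range) (proj₁ ∘ g-range))
      where open AgreementProtocol P

  E₁-marginalU : ∀ (φ : Fin m → ℝ) → E₁ (λ u v → φ u) ≈ sum (λ u → marginalU u * φ u)
  E₁-marginalU φ = sum-cong {m} λ u → sym (*-distribʳ-sum {k} (φ u) (mass u))

  E₁-swap : ∀ F → E₁ F ≈ sum (λ v → sum λ u → mass u v * F u v)
  E₁-swap F = ∑-comm {m} {k} _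

  E₁-marginalV : ∀ (ψ : Fin k → ℝ) → E₁ (λ u v → ψ v) ≈ sum (λ v → marginalV v * ψ v)
  E₁-marginalV ψ = trans (E₁-swap λ u v → ψ v) (sum-cong {k} λ v → sym (*-distribʳ-sum {m} (ψ v) (λ u → mass u v)))

  private
    -- Serves the case p = ∞, which forces q = ∞ and q′ = 1. The substitution φ = f ^ p makes no
    -- sense there, but both sides equal the mean of ψ.
    bilinear-0-1 : ∀ {α β} → α ≈ 0# → β ≈ 1# → BilinearBound α β
    bilinear-0-1 {α} {β} α≈0 β≈1 φ ψ 0≤φ 0≤ψ = ≤-reflexive (begin-equality
      E₁ (λ u v → pow (φ u) α * pow (ψ v) β)
        ≈⟨ cong E₁-positiveLinear (λ (u , v) → drop (0≤φ u) (0≤ψ v)) ⟩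
      E₁ (λ u v → ψ v)
        ≈⟨ drop (average-nonNeg E₁-positiveLinear λ (u , v) → 0≤φ u)
             (average-nonNeg E₁-positiveLinear λ (u , v) → 0≤ψ v) ⟨
      pow (E₁ λ u v → φ u) α * pow (E₁ λ u v → ψ v) β  ∎)
      where
      drop : ∀ {x y} → 0# ≤ x → 0# ≤ y → pow x α * pow y β ≈ y
      drop 0≤x 0≤y = trans
        (*-cong (pow-zeroʳ 0≤x α≈0)
          (trans (pow-congʳ 0≤y (≤-respʳ-≈ (sym β≈1) 0≤1) β≈1) (pow-oneʳ 0≤y)))
        (*-identityˡ _)

    -- Serves the case q′ = ∞, which forces p = q = 1. Both sides equal the mean of φ.
    bilinear-1-0 : ∀ {α β} → α ≈ 1# → β ≈ 0# → BilinearBound α β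
    bilinear-1-0 {α} {β} α≈1 β≈0 φ ψ 0≤φ 0≤ψ = ≤-reflexive (begin-equality
      E₁ (λ u v → pow (φ u) α * pow (ψ v) β)
        ≈⟨ cong E₁-positiveLinear (λ (u , v) → drop (0≤φ u) (0≤ψ v)) ⟩
      E₁ (λ u v → φ u)
        ≈⟨ drop (average-nonNeg E₁-positiveLinear λ (u , v) → 0≤φ u)
             (average-nonNeg E₁-positiveLinear λ (u , v) → 0≤ψ v) ⟨
      pow (E₁ λ u v → φ u) α * pow (E₁ λ u v → ψ v) β  ∎)
      where
      drop : ∀ {x y} → 0# ≤ x → 0# ≤ y → pow x α * pow y β ≈ x
      drop 0≤x 0≤y = trans
        (*-cong (trans (pow-congʳ 0≤x (≤-respʳ-≈ (sym α≈1) 0≤1) α≈1) (pow-oneʳ 0≤x))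
          (pow-zeroʳ 0≤y β≈0))
        (*-identityʳ _)

    module _ (q : [1,∞]) (x : ℝ) (1≤x : 1# ≤ x) {β : ℝ} (0<β : 0# < β) (1/q+β≈1 : recip q + β ≈ 1#)
             (hyp : Hypercontractive ρ q (fin x 1≤x)) where

      -- Summing over u for fixed v turns f = φ ^ α into `marginalV` times T f. Hölder separates T f
      -- from ψ ^ β, hypercontractivity replaces the norm of T f by that of f, and the latter is (𝔼
      -- φ) ^ α.
      bilinear-finite : BilinearBound (x ⁻¹) β
      bilinear-finite φ ψ 0≤φ 0≤ψ = begin
        E₁ (λ u v → f u * pow (ψ v) β)
          ≈⟨ E₁-swap (λ u v → f u * pow (ψ v) β) ⟩
        sum (λ v → sum λ u → mass u v * (f u * pow (ψ v) β))
          ≈⟨ sum-cong {k} (λ v → trans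
               (sum-cong {m} λ u → sym (*-assoc (mass u v) (f u) (pow (ψ v) β)))
               (sym (*-distribʳ-sum {m} (pow (ψ v) β) (λ u → mass u v * f u)))) ⟩
        sum (λ v → sum (λ u → mass u v * f u) * pow (ψ v) β)
          ≈⟨ sum-cong {k} (λ v → *-congʳ (marginalV*h v)) ⟨
        sum (λ v → marginalV v * h v * pow (ψ v) β)
          ≤⟨ hölder-norm marginalV q (T ρ F) h ψ marginalV-nonNeg 0≤h 0≤ψ ∣TF∣≈h 0<β 1/q+β≈1 ⟩
        norm marginalV q (T ρ F) * pow (sum λ v → marginalV v * ψ v) β
          ≤⟨ *-monoˡ-≤ (pow-nonNeg 0≤Eψ 0≤β) (hyp F) ⟩
        norm marginalU (fin x 1≤x) F * pow (sum λ v → marginalV v * ψ v) β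
          ≈⟨ *-cong norm-F (pow-congˡ 0≤β 0≤Eψ (sym (E₁-marginalV ψ))) ⟩
        pow (E₁ λ u v → φ u) α * pow (E₁ λ u v → ψ v) β  ∎
        where
        α : ℝ
        α = x ⁻¹
        0<x : 0# < x
        0<x = 1≤x⇒0<x 1≤x
        0≤α : 0# ≤ α
        0≤α = <⇒≤ (⁻¹-pos 0<x)
        0≤β : 0# ≤ β
        0≤β = <⇒≤ 0<β
        f : Fin m → ℝ
        f u = pow (φ u) α
        F : Fin m → ℂ
        F u = f u +i 0#
        0≤f : ∀ u → 0# ≤ f u
        0≤f u = pow-nonNeg (0≤φ u) 0≤α
        h : Fin k → ℝ
        h v = sum λ u → mass u v ÷ marginalV v * f u
        0≤Eψ : 0# ≤ sum (λ v → marginalV v * ψ v)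
        0≤Eψ = sum-nonNeg λ v → *-nonNeg (marginalV-nonNeg v) (0≤ψ v)

        -- Where `marginalV` vanishes the division in `T` is unspecified, but it only ever
        -- multiplies masses that are 0 as well.
        mass≈0 : ∀ {v} → marginalV v ≈ 0# → ∀ u → mass u v ≈ 0#
        mass≈0 {v} mV≈0 u = ≤-antisym
          (≤-respʳ-≈ mV≈0 (term≤sum (λ u → nonNeg u v) u)) (nonNeg u v)

        0≤h : ∀ v → 0# ≤ h v
        0≤h v with pos-or-zero (marginalV-nonNeg v)
        ... | inj₂ 0<mV = sum-nonNeg λ u → *-nonNeg (÷-nonNeg (nonNeg u v) 0<mV) (0≤f u)
        ... | inj₁ mV≈0 = ≤-reflexive (sym (vanish (sum-positiveLinear m) λ u → begin-equality
          mass u v ÷ marginalV v * f u  ≈⟨ *-congʳ (*-congʳ (mass≈0 mV≈0 u)) ⟩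
          0# ÷ marginalV v * f u        ≈⟨ solve 2 (λ y z → :0 :* y :* z := :0) refl _ _ ⟩
          0#                            ∎))

        marginalV*h : ∀ v → marginalV v * h v ≈ sum λ u → mass u v * f u
        marginalV*h v = trans (*-distribˡ-sum {m} (marginalV v) _) (sum-cong {m} term)
          where
          term : ∀ u → marginalV v * (mass u v ÷ marginalV v * f u) ≈ mass u v * f u
          term u with pos-or-zero (marginalV-nonNeg v)
          ... | inj₂ 0<mV = begin-equality
            marginalV v * (mass u v ÷ marginalV v * f u)
              ≈⟨ solve 3 (λ c d e → c :* (d :* e) := d :* c :* e) refl (marginalV v) _ (f u) ⟩
            mass u v ÷ marginalV v * marginalV v * f u
              ≈⟨ *-congʳ (x÷y*y (mass u v) (>⇒≉ 0<mV)) ⟩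
            mass u v * f u  ∎
          ... | inj₁ mV≈0 = begin-equality
            marginalV v * (mass u v ÷ marginalV v * f u)  ≈⟨ *-congʳ mV≈0 ⟩
            0# * (mass u v ÷ marginalV v * f u)           ≈⟨ zeroˡ _ ⟩
            0#                                            ≈⟨ zeroˡ _ ⟨
            0# * f u                                      ≈⟨ *-congʳ (mass≈0 mV≈0 u) ⟨
            mass u v * f u                                ∎

        ∣TF∣≈h : ∀ v → ∣ T ρ F v ∣ℂ ≈ h v
        ∣TF∣≈h v = ∣nonNeg∣ (0≤h v) (vanish (sum-positiveLinear m) λ u → zeroʳ (mass u v ÷ marginalV v))

        ∣F∣ˣ≈φ : ∀ u → pow ∣ F u ∣ℂ x ≈ φ u
        ∣F∣ˣ≈φ u = trans
          (pow-congˡ (<⇒≤ 0<x) (≤-respʳ-≈ (sym ∣F∣≈f) (0≤f u)) ∣F∣≈f)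
          (pow-pow-inverse (0≤φ u) 0≤α (<⇒≤ 0<x) (⁻¹-inverseˡ x (>⇒≉ 0<x)))
          where
          ∣F∣≈f : ∣ F u ∣ℂ ≈ f u
          ∣F∣≈f = ∣nonNeg∣ (0≤f u) refl

        norm-F : norm marginalU (fin x 1≤x) F ≈ pow (E₁ λ u v → φ u) α
        norm-F = sym (pow-congˡ 0≤α (average-nonNeg E₁-positiveLinear λ (u , v) → 0≤φ u)
          (trans (E₁-marginalU φ) (sum-cong {m} λ u → *-congˡ (sym (∣F∣ˣ≈φ u)))))

  bilinear-bound : ∀ p q q′ → p ≼ q → recip q + recip q′ ≈ 1# → Hypercontractive ρ q p →
    BilinearBound (recip p) (recip q′)
  bilinear-bound ∞ q q′ p≼q 1/q+1/q′≈1 hyp = bilinear-0-1 refl (begin-equality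
    recip q′            ≈⟨ +-identityˡ _ ⟨
    0# + recip q′       ≈⟨ +-congʳ (≤-antisym (recip-antitone {∞} {q} p≼q) (recip-nonNeg q)) ⟨
    recip q + recip q′  ≈⟨ 1/q+1/q′≈1 ⟩
    1#                  ∎)
  bilinear-bound p@(fin _ _) q ∞ p≼q 1/q+0≈1 hyp = bilinear-1-0
    (≤-antisym (recip≤1 p) (begin
      1#           ≈⟨ 1/q+0≈1 ⟨
      recip q + 0# ≈⟨ +-identityʳ _ ⟩
      recip q      ≤⟨ recip-antitone {p} {q} p≼q ⟩
      recip p      ∎))
    refl
  bilinear-bound (fin x 1≤x) q (fin y 1≤y) p≼q 1/q+1/q′≈1 hyp =
    bilinear-finite q x 1≤x (⁻¹-pos (1≤x⇒0<x 1≤y)) 1/q+1/q′≈1 hyp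

-- Minimal total cost for a given success probability

module ConjugateExponents (R : Reals) (p q q′ : Analysis.[1,∞] R)
  (p≼q : Analysis._≼_ R p q)
  (1/q+1/q′≈1 : Reals._≈_ R (Reals._+_ R (Analysis.recip R q) (Analysis.recip R q′)) (Reals.1# R))
  where
  open Analysis R hiding (zero)
  open OrderedField R
  open Powers R
  open Averages R
  open ≤-Reasoning

  private
    -- Removes the factor p ^ (1/p) by rescaling a to a′ = p a. For p = ∞ the power is constantly 1
    -- and a′ = 0 will do; this case is the reason for asking only for an inequality between a′ / p
    -- and a.
    absorb-selfRoot : ∀ p {a} → 0# ≤ a → ∃[ a′ ]
      (0# ≤ a′) × (recip p * a′ ≤ a) × (selfRoot p * pow a (recip p) ≈ pow a′ (recip p))
    absorb-selfRoot (fin x 1≤x) {a} 0≤a = x * a , *-nonNeg 0≤x 0≤a ,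
      ≤-reflexive (trans (sym (*-assoc _ x a)) (trans (*-congʳ (⁻¹-inverseˡ x (>⇒≉ (1≤x⇒0<x 1≤x)))) (*-identityˡ a))) ,
      sym (pow-* 0≤x 0≤a (recip-nonNeg (fin x 1≤x)))
      where
      0≤x : 0# ≤ x
      0≤x = <⇒≤ (1≤x⇒0<x 1≤x)
    absorb-selfRoot ∞ {a} 0≤a = 0# , ≤-refl , ≤-respˡ-≈ (sym (zeroˡ 0#)) 0≤a ,
      trans (*-identityˡ _) (trans (pow-zeroʳ 0≤a refl) (sym (pow-zeroʳ ≤-refl refl)))

  selfRoot-pos : ∀ p → 0# < selfRoot p
  selfRoot-pos (fin x 1≤x) = pow-pos (1≤x⇒0<x 1≤x) (recip-nonNeg (fin x 1≤x))
  selfRoot-pos ∞           = 0<1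

  α β c : ℝ
  α = recip p
  β = recip q′
  c = (α + β) ⁻¹

  1≤α+β : 1# ≤ α + β
  1≤α+β = begin
    1#                  ≈⟨ 1/q+1/q′≈1 ⟨
    recip q + recip q′  ≤⟨ +-monoˡ-≤ (recip q′) (recip-antitone {p} {q} p≼q) ⟩
    α + β               ∎

  0<c : 0# < c
  0<c = ⁻¹-pos (1≤x⇒0<x 1≤α+β)

  c≤1 : c ≤ 1#
  c≤1 = 1≤x⇒x⁻¹≤1 1≤α+β

  σ : ℝ
  σ = selfRoot p * selfRoot q′

  0<σ : 0# < σ
  0<σ = *-pos (selfRoot-pos p) (selfRoot-pos q′)

  minimal-cost : ∀ {a b z} → 0# ≤ a → 0# ≤ b → 0# ≤ z → z ≤ pow a α * pow b β →
    pow (σ * z) c ÷ c ≤ a + b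
  minimal-cost {a} {b} {z} 0≤a 0≤b 0≤z z≤aᵅbᵝ = *-cancelʳ-≤ 0<c (begin
    pow (σ * z) c ÷ c * c
      ≈⟨ x÷y*y _ (>⇒≉ 0<c) ⟩
    pow (σ * z) c
      ≤⟨ pow-mono-≤ (*-nonNeg (<⇒≤ 0<σ) 0≤z) (begin
           selfRoot p * selfRoot q′ * z
             ≤⟨ *-monoʳ-≤ (<⇒≤ 0<σ) z≤aᵅbᵝ ⟩
           selfRoot p * selfRoot q′ * (pow a α * pow b β)
             ≈⟨ solve 4 (λ s t u v → s :* t :* (u :* v) := s :* u :* (t :* v)) refl _ _ _ _ ⟩
           selfRoot p * pow a α * (selfRoot q′ * pow b β)
             ≈⟨ *-cong absorb-a absorb-b ⟩
           pow a′ α * pow b′ β  ∎) 0≤c ⟩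
    pow (pow a′ α * pow b′ β) c
      ≈⟨ pow-* (pow-nonNeg 0≤a′ 0≤α) (pow-nonNeg 0≤b′ 0≤β) 0≤c ⟩
    pow (pow a′ α) c * pow (pow b′ β) c
      ≈⟨ *-cong (pow-pow 0≤a′ 0≤α 0≤c) (pow-pow 0≤b′ 0≤β 0≤c) ⟩
    pow a′ (α * c) * pow b′ (β * c)
      ≤⟨ weighted-am-gm 0≤a′ 0≤b′ (*-nonNeg 0≤α 0≤c) (*-nonNeg 0≤β 0≤c)
           (trans (sym (distribʳ c α β)) (⁻¹-inverseʳ _ (>⇒≉ (1≤x⇒0<x 1≤α+β)))) ⟩
    α * c * a′ + β * c * b′
      ≈⟨ solve 5 (λ α β c a b → α :* c :* a :+ β :* c :* b := (α :* a :+ β :* b) :* c) refl α β c a′ b′ ⟩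
    (α * a′ + β * b′) * c
      ≤⟨ *-monoˡ-≤ 0≤c (+-mono-≤ αa′≤a βb′≤b) ⟩
    (a + b) * c  ∎)
    where
    0≤α : 0# ≤ α
    0≤α = recip-nonNeg p
    0≤β : 0# ≤ β
    0≤β = recip-nonNeg q′
    0≤c : 0# ≤ c
    0≤c = <⇒≤ 0<c
    A = absorb-selfRoot p 0≤a
    B = absorb-selfRoot q′ 0≤b
    a′ b′ : ℝ
    a′ = proj₁ A
    b′ = proj₁ B
    0≤a′ : 0# ≤ a′
    0≤a′ = proj₁ (proj₂ A)
    0≤b′ : 0# ≤ b′
    0≤b′ = proj₁ (proj₂ B)
    αa′≤a : α * a′ ≤ a
    αa′≤a = proj₁ (proj₂ (proj₂ A))
    βb′≤b : β * b′ ≤ b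
    βb′≤b = proj₁ (proj₂ (proj₂ B))
    absorb-a : selfRoot p * pow a α ≈ pow a′ α
    absorb-a = proj₂ (proj₂ (proj₂ A))
    absorb-b : selfRoot q′ * pow b β ≈ pow b′ β
    absorb-b = proj₂ (proj₂ (proj₂ B))

-- The lower bound for agreement complexity

module AgreementBound (R : Reals) {m k : ℕ} (ρ : Analysis.JointDistribution R m k)
  (p q q′ : Analysis.[1,∞] R) (p≼q : Analysis._≼_ R p q)
  (1/q+1/q′≈1 : Reals._≈_ R (Reals._+_ R (Analysis.recip R q) (Analysis.recip R q′)) (Reals.1# R))
  (hyp : Analysis.Hypercontractive R ρ q p) where
  open Analysis R hiding (zero)
  open OrderedField R
  open Averages R
  open Agreement R ρ
  open ConjugateExponents R p q q′ p≼q 1/q+1/q′≈1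
  open ≤-Reasoning
  open PositiveLinear renaming (nonNeg to average-nonNeg)

  protocol-cost : ∀ {z} → 0# ≤ z → (P : AgreementProtocol ρ) →
    z ≤ AgreementProtocol.success P → pow (σ * z) c ÷ c ≤ AgreementProtocol.cost P
  protocol-cost {z} 0≤z P z≤success = ≤-respʳ-≈
    (sym (add (𝔼-positiveLinear ℓ) (λ (us , vs) → f us) (λ (us , vs) → g vs)))
    (minimal-cost
      (average-nonNeg (𝔼-positiveLinear ℓ) λ (us , vs) → proj₁ (f-range us))
      (average-nonNeg (𝔼-positiveLinear ℓ) λ (us , vs) → proj₁ (g-range vs))
      0≤z
      (≤-trans z≤success (success-bound (recip-nonNeg p) (recip-nonNeg q′) (recip≤1 p) (recip≤1 q′)
        (bilinear-bound p q q′ p≼q 1/q+1/q′≈1 hyp) P)))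
    where open AgreementProtocol P

  -- Has success probability 1, so it is admissible for every z ≤ 1 and the infimum defining `agr`
  -- ranges over an inhabited set.
  agree-always : AgreementProtocol ρ
  agree-always = record
    { ℓ       = 0
    ; f       = λ _ → 1#
    ; g       = λ _ → 1#
    ; f-range = λ _ → 0≤1 , ≤-refl
    ; g-range = λ _ → 0≤1 , ≤-refl
    }

  agr-bound : ∀ z → 0# ≤ z → z ≤ 1# → pow (σ * z) c ÷ c ≤ agr ρ z
  agr-bound z 0≤z z≤1 = ≤-inf (λ r → ∃[ P ] (z ≤ AgreementProtocol.success P) × (r ≈ AgreementProtocol.cost P))
    (- AgreementProtocol.cost agree-always , agree-always , z≤success ,
      solve 1 (λ x → :- (:- x) := x) refl _)
    (λ { r (P , z≤success , r≈cost) → ≤-respʳ-≈ (sym r≈cost) (protocol-cost 0≤z P z≤success) })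
    where
    z≤success : z ≤ AgreementProtocol.success agree-always
    z≤success = ≤-respʳ-≈ (sym (trans (*-identityˡ _) (*-identityʳ 1#))) z≤1

-- Indicators, means and inhabited sample spaces

module Distributions (R : Reals) where
  open Analysis R hiding (zero)
  open OrderedField R
  open Averages R
  open ≤-Reasoning
  open PositiveLinear

  sum-const : ∀ n x → sum {n} (λ _ → x) ≈ fromℕ n * x
  sum-const zero    x = sym (zeroˡ x)
  sum-const (suc n) x = trans (+-congˡ (sum-const n x))
    (solve 2 (λ n x → x :+ n :* x := (:1 :+ n) :* x) refl (fromℕ n) x)

  indicator-∩ : ∀ {n} (i : Fin n) S S′ → indicator i (S ∩ S′) ≈ indicator i S * indicator i S′
  indicator-∩ zero    (inside  ∷ S) (inside  ∷ S′) = sym (*-identityʳ 1#)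
  indicator-∩ zero    (inside  ∷ S) (outside ∷ S′) = sym (zeroʳ 1#)
  indicator-∩ zero    (outside ∷ S) (_       ∷ S′) = sym (zeroˡ _)
  indicator-∩ (suc i) (_       ∷ S) (_       ∷ S′) = indicator-∩ i S S′

  indicator-⊤ : ∀ {n} (i : Fin n) → indicator i ⊤ ≈ 1#
  indicator-⊤ i with i ∈? ⊤
  ... | yes _   = refl
  ... | no  i∉⊤ = contradiction ∈⊤ i∉⊤

  indicator-range : ∀ {n} (i : Fin n) S → 0# ≤ indicator i S × indicator i S ≤ 1#
  indicator-range i S with i ∈? S
  ... | yes _ = 0≤1 , ≤-refl
  ... | no  _ = ≤-refl , 0≤1

  sum-indicator : ∀ {n} (S : Subset n) → sum (λ i → indicator i S) ≈ fromℕ ∣ S ∣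
  sum-indicator []            = refl
  sum-indicator (inside  ∷ S) = +-congˡ (sum-indicator S)
  sum-indicator (outside ∷ S) = trans (+-identityˡ _) (sum-indicator S)

  module _ {n : ℕ} (D : Distribution n) where
    open Distribution D

    mean : (Fin n → ℝ) → ℝ
    mean f = sum λ i → mass i * f i

    mean-positiveLinear : PositiveLinear mean
    mean-positiveLinear = weighted (sum-positiveLinear n) (Distribution.nonNeg D)

    mean-≤ : ∀ {f b} → (∀ i → f i ≤ b) → mean f ≤ b
    mean-≤ {f} {b} f≤b = begin
      mean f         ≤⟨ mono-≤ mean-positiveLinear f≤b ⟩
      mean (λ _ → b) ≈⟨ *-distribʳ-sum {n} b mass ⟨
      sum mass * b   ≈⟨ *-congʳ total ⟩
      1# * b         ≈⟨ *-identityˡ b ⟩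
      b              ∎

  mean-product : ∀ {m n} (D : Distribution m) (D′ : Distribution n) f g →
    mean D f * mean D′ g ≈
    sum λ i → sum λ j → Distribution.mass D i * Distribution.mass D′ j * (f i * g j)
  mean-product {m} {n} D D′ f g = begin-equality
    mean D f * mean D′ g
      ≈⟨ *-distribʳ-sum {m} (mean D′ g) _ ⟩
    (sum λ i → Distribution.mass D i * f i * mean D′ g)
      ≈⟨ sum-cong {m} (λ i → trans (*-distribˡ-sum {n} _ _) (sum-cong {n} λ j →
           solve 4 (λ u f v g → u :* f :* (v :* g) := u :* v :* (f :* g)) refl _ _ _ _)) ⟩
    (sum λ i → sum λ j → Distribution.mass D i * Distribution.mass D′ j * (f i * g j))  ∎

  -- Total mass 1 rules out an empty sample space. Only some point is wanted, and its own mass may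
  -- be 0.
  support : ∀ {n} → Distribution n → Fin n
  support {zero}  D = contradiction (Distribution.total D) 0≉1
  support {suc n} D = zero

  joint-support : ∀ {m k} → JointDistribution m k → Fin m × Fin k
  joint-support {zero}          ρ = contradiction (JointDistribution.total ρ) 0≉1
  joint-support {suc m} {suc k} ρ = zero , zero
  joint-support {suc m} {zero}  ρ = contradiction
    (trans (sym (vanish (sum-positiveLinear (suc m)) λ _ → refl)) (JointDistribution.total ρ)) 0≉1

-- The lower bound for collision complexity

module CollisionBound (R : Reals) {m k : ℕ} (ρ : Analysis.JointDistribution R m k)
  (p q q′ : Analysis.[1,∞] R) (p≼q : Analysis._≼_ R p q)
  (1/q+1/q′≈1 : Reals._≈_ R (Reals._+_ R (Analysis.recip R q) (Analysis.recip R q′)) (Reals.1# R))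
  (hyp : Analysis.Hypercontractive R ρ q p) where
  open Analysis R hiding (zero)
  open OrderedField R
  open Powers R
  open Averages R
  open Distributions R
  open Agreement R ρ
  open ConjugateExponents R p q q′ p≼q 1/q+1/q′≈1 using (c; σ; 0<c; c≤1; 0<σ)
  open AgreementBound R ρ p q q′ p≼q 1/q+1/q′≈1 hyp
  open ≤-Reasoning
  open PositiveLinear renaming (nonNeg to average-nonNeg)

  module _ {n : ℕ} {z : ℝ} (P : CollisionProtocol ρ n z) where
    open CollisionProtocol P

    SizeSet : ℝ → Set
    SizeSet r = ∃[ s ] ∃[ t ] ∃[ us ] ∃[ vs ] r ≈ fromℕ (∣ A s us ∣ ℕ.⊔ ∣ B t vs ∣)

    size≤output : ∀ s t us vs → fromℕ (∣ A s us ∣ ℕ.⊔ ∣ B t vs ∣) ≤ outputSize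
    size≤output s t us vs = sup-upper SizeSet (_ , member)
      (fromℕ n , λ { r (s , t , us , vs , r≈) → ≤-respˡ-≈ (sym r≈)
        (fromℕ-mono-≤ (ℕ.⊔-lub (∣p∣≤n (A s us)) (∣p∣≤n (B t vs)))) })
      _ member
      where
      member : SizeSet (fromℕ (∣ A s us ∣ ℕ.⊔ ∣ B t vs ∣))
      member = s , t , us , vs , refl

    -- The supremum in `outputSize` ranges over seeds and inputs of both parties, so an arbitrary
    -- seed and input of the other party must be supplied.
    ∣A∣≤output : ∀ s us → fromℕ ∣ A s us ∣ ≤ outputSize
    ∣A∣≤output s us = ≤-trans (fromℕ-mono-≤ (ℕ.m≤m⊔n ∣ A s us ∣ ∣ B t vs ∣)) (size≤output s t us vs)
      where
      t : Fin b
      t = support β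
      vs : Vec (Fin k) ℓ
      vs = replicate ℓ (proj₂ (joint-support ρ))

    ∣B∣≤output : ∀ t vs → fromℕ ∣ B t vs ∣ ≤ outputSize
    ∣B∣≤output t vs = ≤-trans (fromℕ-mono-≤ (ℕ.m≤n⊔m ∣ A s us ∣ ∣ B t vs ∣)) (size≤output s t us vs)
      where
      s : Fin a
      s = support α
      us : Vec (Fin m) ℓ
      us = replicate ℓ (proj₁ (joint-support ρ))

    private
      -- The probability over the private seed that i is output. Agreement protocols may take
      -- fractional values, so averaging removes the randomness.
      f : Fin n → Vec (Fin m) ℓ → ℝ
      f i us = mean α λ s → indicator i (A s us)

      g : Fin n → Vec (Fin k) ℓ → ℝ
      g i vs = mean β λ t → indicator i (B t vs)

    agreement : Fin n → AgreementProtocol ρ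
    agreement i = record
      { ℓ       = ℓ
      ; f       = f i
      ; g       = g i
      ; f-range = λ us → average-nonNeg (mean-positiveLinear α) (λ s → proj₁ (indicator-range i (A s us))) ,
                         mean-≤ α (λ s → proj₂ (indicator-range i (A s us)))
      ; g-range = λ vs → average-nonNeg (mean-positiveLinear β) (λ t → proj₁ (indicator-range i (B t vs))) ,
                         mean-≤ β (λ t → proj₂ (indicator-range i (B t vs)))
      }

    -- The two seeds are independent of each other and of the inputs: the product of the means is a
    -- mean over pairs of seeds, which commutes with `𝔼`.
    success≈collisionProb : ∀ i → AgreementProtocol.success (agreement i) ≈ collisionProb i
    success≈collisionProb i = begin-equality
      𝔼 ρ ℓ (λ us vs → f i us * g i vs)
        ≈⟨ cong E (λ (us , vs) → trans
             (mean-product α β (λ s → indicator i (A s us)) (λ t → indicator i (B t vs)))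
             (sum-cong {a} λ s → sum-cong {b} λ t → *-congˡ (sym (indicator-∩ i (A s us) (B t vs))))) ⟩
      𝔼 ρ ℓ (λ us vs → sum λ s → sum λ t → w s t * both s t us vs)
        ≈⟨ swap-sum E {a} (λ s (us , vs) → sum λ t → w s t * both s t us vs) ⟩
      sum (λ s → 𝔼 ρ ℓ λ us vs → sum λ t → w s t * both s t us vs)
        ≈⟨ sum-cong {a} (λ s → trans
             (swap-sum E {b} (λ t (us , vs) → w s t * both s t us vs))
             (sum-cong {b} λ t → scale E (w s t) (λ (us , vs) → both s t us vs))) ⟩
      collisionProb i  ∎
      where
      E : PositiveLinear {Vec (Fin m) ℓ × Vec (Fin k) ℓ} (λ F → 𝔼 ρ ℓ λ us vs → F (us , vs))
      E = 𝔼-positiveLinear ℓ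
      w : Fin a → Fin b → ℝ
      w s t = Distribution.mass α s * Distribution.mass β t
      both : Fin a → Fin b → Vec (Fin m) ℓ → Vec (Fin k) ℓ → ℝ
      both s t us vs = indicator i (A s us ∩ B t vs)

    private
      sum-f≤output : ∀ us → sum (λ i → f i us) ≤ outputSize
      sum-f≤output us = begin
        sum (λ i → mean α λ s → indicator i (A s us))
          ≈⟨ swap-sum (mean-positiveLinear α) {n} (λ i s → indicator i (A s us)) ⟨
        mean α (λ s → sum λ i → indicator i (A s us))
          ≤⟨ mean-≤ α (λ s → ≤-respˡ-≈ (sym (sum-indicator (A s us))) (∣A∣≤output s us)) ⟩
        outputSize  ∎

      sum-g≤output : ∀ vs → sum (λ i → g i vs) ≤ outputSize
      sum-g≤output vs = begin
        sum (λ i → mean β λ t → indicator i (B t vs))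
          ≈⟨ swap-sum (mean-positiveLinear β) {n} (λ i t → indicator i (B t vs)) ⟨
        mean β (λ t → sum λ i → indicator i (B t vs))
          ≤⟨ mean-≤ β (λ t → ≤-respˡ-≈ (sym (sum-indicator (B t vs))) (∣B∣≤output t vs)) ⟩
        outputSize  ∎

    total-cost≤2output : sum (λ i → AgreementProtocol.cost (agreement i)) ≤ outputSize + outputSize
    total-cost≤2output = begin
      sum (λ i → 𝔼 ρ ℓ λ us vs → f i us + g i vs)
        ≈⟨ swap-sum E {n} (λ i (us , vs) → f i us + g i vs) ⟨
      𝔼 ρ ℓ (λ us vs → sum λ i → f i us + g i vs)
        ≤⟨ mono-≤ E (λ (us , vs) → begin
             sum (λ i → f i us + g i vs)
               ≈⟨ ∑-distrib-+ {n} (λ i → f i us) (λ i → g i vs) ⟩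
             sum (λ i → f i us) + sum (λ i → g i vs)
               ≤⟨ +-mono-≤ (sum-f≤output us) (sum-g≤output vs) ⟩
             outputSize + outputSize
               ≈⟨ *-identityʳ _ ⟨
             (outputSize + outputSize) * 1#  ∎) ⟩
      𝔼 ρ ℓ (λ us vs → (outputSize + outputSize) * 1#)
        ≈⟨ scale E (outputSize + outputSize) (λ _ → 1#) ⟩
      (outputSize + outputSize) * 𝔼 ρ ℓ (λ us vs → 1#)
        ≈⟨ *-congˡ (𝔼-1 ℓ) ⟩
      (outputSize + outputSize) * 1#
        ≈⟨ *-identityʳ _ ⟩
      outputSize + outputSize  ∎
      where
      E : PositiveLinear {Vec (Fin m) ℓ × Vec (Fin k) ℓ} (λ F → 𝔼 ρ ℓ λ us vs → F (us , vs))
      E = 𝔼-positiveLinear ℓ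

    output-bound : 0# ≤ z → fromℕ n * (pow (σ * z) c ÷ c) ≤ outputSize + outputSize
    output-bound 0≤z = begin
      fromℕ n * (pow (σ * z) c ÷ c)
        ≈⟨ sum-const n _ ⟨
      sum {n} (λ _ → pow (σ * z) c ÷ c)
        ≤⟨ sum-mono-≤ {n} (λ i → protocol-cost 0≤z (agreement i)
             (≤-respʳ-≈ (sym (success≈collisionProb i)) (collides i))) ⟩
      sum (λ i → AgreementProtocol.cost (agreement i))
        ≤⟨ total-cost≤2output ⟩
      outputSize + outputSize  ∎

  -- Every index collides with certainty, which makes the set of output sizes inhabited whenever z ≤
  -- 1, in particular for z = 1/n with n ≥ 1.
  collide-always : ∀ {n z} → z ≤ 1# → CollisionProtocol ρ n z
  collide-always {n} {z} z≤1 = record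
    { ℓ        = 0
    ; α        = point
    ; β        = point
    ; A        = λ _ _ → ⊤
    ; B        = λ _ _ → ⊤
    ; collides = λ i → ≤-respʳ-≈ (sym (trans
        (solve 1 (λ x → :1 :* :1 :* (:1 :* x) :+ :0 :+ :0 := x) refl (indicator i (⊤ ∩ ⊤)))
        (trans (indicator-∩ i ⊤ ⊤) (trans (*-cong (indicator-⊤ i) (indicator-⊤ i)) (*-identityʳ 1#))))) z≤1
    }
    where
    point : Distribution 1
    point = record { mass = λ _ → 1# ; nonNeg = λ _ → 0≤1 ; total = +-identityʳ 1# }

  private
    0≤c : 0# ≤ c
    0≤c = <⇒≤ 0<c

    n*n⁻ᶜ : ∀ {x} → 0# < x → x * pow (x ⁻¹) c ≈ pow x (1# - c)
    n*n⁻ᶜ {x} 0<x = begin-equality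
      x * pow (x ⁻¹) c
        ≈⟨ *-congʳ (pow-oneʳ 0≤x) ⟨
      pow x 1# * pow (x ⁻¹) c
        ≈⟨ *-congʳ (pow-congʳ 0≤x 0≤1 (solve 1 (λ c → :1 := :1 :- c :+ c) refl c)) ⟩
      pow x (1# - c + c) * pow (x ⁻¹) c
        ≈⟨ *-congʳ (pow-+ 0≤x (x≤y⇒0≤y-x c≤1) 0≤c) ⟩
      pow x (1# - c) * pow x c * pow (x ⁻¹) c
        ≈⟨ *-assoc _ _ _ ⟩
      pow x (1# - c) * (pow x c * pow (x ⁻¹) c)
        ≈⟨ *-congˡ (pow-inverse 0<x 0≤c) ⟩
      pow x (1# - c) * 1#
        ≈⟨ *-identityʳ _ ⟩
      pow x (1# - c)  ∎
      where
      0≤x : 0# ≤ x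
      0≤x = <⇒≤ 0<x

    0<2 : 0# < 1# + 1#
    0<2 = +-pos-nonNeg 0<1 0≤1

  -- At z = 1/n, `output-bound` has left side n (σ / n) ^ c / c = (σ ^ c / c) n ^ (1 - c). The final
  -- division by 2 accounts for the two sets A and B, each of which is at most the output size.
  K : ℝ
  K = pow σ c ÷ c ÷ (1# + 1#)

  0<K : 0# < K
  0<K = *-pos (*-pos (pow-pos 0<σ 0≤c) (⁻¹-pos 0<c)) (⁻¹-pos 0<2)

  col-bound : ∀ n → 1 ℕ.≤ n → K * pow (fromℕ n) (1# - c) ≤ col ρ n
  col-bound n 1≤n = ≤-inf (λ r → ∃[ P ] r ≈ CollisionProtocol.outputSize {n = n} {p = fromℕ n ⁻¹} P)
    (- CollisionProtocol.outputSize trivial , trivial ,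
      solve 1 (λ x → :- (:- x) := x) refl _)
    λ { r (P , r≈output) → ≤-respʳ-≈ (sym r≈output) (*-cancelʳ-≤ 0<2 (begin
      K * pow x (1# - c) * (1# + 1#)
        ≈⟨ solve 3 (λ K u t → K :* u :* t := K :* t :* u) refl K _ (1# + 1#) ⟩
      K * (1# + 1#) * pow x (1# - c)
        ≈⟨ *-cong (x÷y*y _ (>⇒≉ 0<2)) (sym (n*n⁻ᶜ 0<x)) ⟩
      pow σ c ÷ c * (x * pow (x ⁻¹) c)
        ≈⟨ solve 4 (λ s d x u → s :* d :* (x :* u) := x :* (s :* u :* d)) refl (pow σ c) (c ⁻¹) x _ ⟩
      x * (pow σ c * pow (x ⁻¹) c ÷ c)
        ≈⟨ *-congˡ (*-congʳ (pow-* (<⇒≤ 0<σ) 0≤1/x 0≤c)) ⟨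
      x * (pow (σ * x ⁻¹) c ÷ c)
        ≤⟨ output-bound P 0≤1/x ⟩
      CollisionProtocol.outputSize P + CollisionProtocol.outputSize P
        ≈⟨ solve 1 (λ s → s :+ s := s :* (:1 :+ :1)) refl _ ⟩
      CollisionProtocol.outputSize P * (1# + 1#)  ∎)) }
    where
    x : ℝ
    x = fromℕ n
    trivial : CollisionProtocol ρ n (x ⁻¹)
    trivial = collide-always (1≤x⇒x⁻¹≤1 (≤-respˡ-≈ fromℕ-1 (fromℕ-mono-≤ 1≤n)))
    0<x : 0# < x
    0<x = fromℕ-pos 1≤n
    0≤1/x : 0# ≤ x ⁻¹
    0≤1/x = <⇒≤ (⁻¹-pos 0<x)

lemmaA4 : (R : Reals) →
    let open Analysis R in
    ∀ {m k : ℕ} (ρ : JointDistribution m k) →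
    NonDegenerate ρ →
    ∀ (p q q' : [1,∞]) →
    p ≼ q →
    recip q + recip q' ≈ 1# →
    let c = (recip p + recip q') ⁻¹ in
    Hypercontractive ρ q p →
    (∀ z → 0# ≤ z → z ≤ 1# →
    pow (selfRoot p * selfRoot q' * z) c ÷ c ≤ agr ρ z)
    ×
    IsΩ (col ρ) (λ n → pow (fromℕ n) (1# - c))
lemmaA4 R ρ _ p q q' p≼q 1/q+1/q'≈1 hyp = agr-bound , K , 0<K , 1 , col-bound
  where
  open AgreementBound R ρ p q q' p≼q 1/q+1/q'≈1 hyp
  open CollisionBound R ρ p q q' p≼q 1/q+1/q'≈1 hyp
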